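{- For all integers $n\ge k\ge0$, \[ \tilde\sigma^{AW,H}_{n,k}(a_1,a_2,a_3,a_4;q)=\sum_{\mathbf T\in\mathcal T_{n,k}}\mathbf a^{s(\mathbf T)}\,q^{\lVert\mathbf T\rVert_{n,k}}\begin{bmatrix}n\\k,m(\mathbf T)\end{bmatrix}_q . \]
   Context: The set $\mathcal T$. Let $\mathcal T$ be the set of quadruples $(t_1,t_2,t_3,t_4)$ of nonnegative integers such that $t_1+t_2+t_3+t_4$ is odd and $|t_i-t_j|\le1$ for all $1\le i,j\le4$. It is totally ordered by: $(t_1,t_2,t_3,t_4)\le(s_1,s_2,s_3,s_4)$ if and only if $(t_4,t_3,t_2,-t_1)\le(s_4,s_3,s_2,-s_1)$ in lexicographic order. For $T=(t_1,t_2,t_3,t_4)$ put $\mathbf a^T=a_1^{t_1}a_2^{t_2}a_3^{t_3}a_4^{t_4}$ and $|T|=t_1+t_2+t_3+t_4$. For $n\ge k\ge0$ let \[ \mathcal T_{n,k}=\{(T_k,T_{k+1},\dots,T_{n-1})\in\mathcal T^{n-k}:T_k\ge T_{k+1}\ge\cdots\ge T_{n-1}\}. \] For $\mathbf T=(T_k,\dots,T_{n-1})\in\mathcal T_{n,k}$ let $s(\mathbf T)=T_k+\cdots+T_{n-1}$ (componentwise sum), let $m(\mathbf T)=(m_1,\dots,m_r)$ be the sequence of positive integers with $m_1+\cdots+m_r=n-k$ giving the lengths of the maximal runs of equal entries, i.e. $T_k=\cdots=T_{k+m_1-1}>T_{k+m_1}=\cdots=T_{k+m_1+m_2-1}>\cdots>T_{k+m_1+\cdots+m_{r-1}}=\cdots=T_{n-1}$,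 and let \[ \lVert\mathbf T\rVert_{n,k}=\sum_{i=k}^{n-1}\frac{i(|T_i|-1)}2,\qquad \begin{bmatrix}n\\k,m(\mathbf T)\end{bmatrix}_q=\frac{[n]_q!}{[k]_q!\,[m_1]_q!\cdots[m_r]_q!}, \] where $[n]_q!=\prod_{i=1}^n\frac{1-q^i}{1-q}$. Polynomials. Write $(z;q)_n=\prod_{i=0}^{n-1}(1-zq^i)$, $(z_1,\dots,z_r;q)_n=\prod_s(z_s;q)_n$, and ${}_r\phi_s(\alpha_1,\dots,\alpha_r;\beta_1,\dots,\beta_s;q,z)=\sum_{k\ge0}\frac{(\alpha_1,\dots,\alpha_r;q)_k}{(q,\beta_1,\dots,\beta_s;q)_k}\big((-1)^kq^{\binom k2}\big)^{1+s-r}z^k$. With $x=\cos\theta$ and $\mathbf i=\sqrt{ -1}$, the monic Askey--Wilson polynomials are \[ p_n(x;a,b,c,d|q)=\frac{(ab,ac,ad;q)_n}{2^na^n(abcdq^{n-1};q)_n}\;{}_4\phi_3\!\left(\begin{matrix}q^{ -n},\,abcdq^{n-1},\,ae^{\mathbf i\theta},\,ae^{ -\mathbf i\theta}\\ ab,\,ac,\,ad\end{matrix};q,q\right), \] and the monic continuous $q$-Hermite polynomials are $H_n(x|q)=\frac{e^{\mathbf in\theta}}{2^n}\,{}_2\phi_0\!\left(\begin{matrix}q^{ -n},0\\-\end{matrix};q,q^ne^{ -2\mathbf i\theta}\right)$. Define $\sigma^{AW,H}_{n,k}$ by $H_n(x|q)=\sum_{k=0}^n\sigma^{AW,H}_{n,k}(a,b,c,d;q)\,p_k(x;a,b,c,d|q)$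 and \[ \tilde\sigma^{AW,H}_{n,k}(a,b,c,d;q)=\frac{2^{n-k}}{\mathbf i^{\,n-k}}\sigma^{AW,H}_{n,k}(\mathbf ia,\mathbf ib,\mathbf ic,\mathbf id;q). \] The parameters $a_1,a_2,a_3,a_4$ are used in place of $a,b,c,d$; the identity is one of formal power series in the indeterminates $a_1,a_2,a_3,a_4$ with coefficients in $\mathbb{Q}(q)$. -}

module Defs where

open import Algebra.Bundles using (CommutativeRing)
open import Algebra.Morphism.Structures using (module RingMorphisms)
import Algebra.Consequences.Setoid as Consequences
import Algebra.Definitions
import Algebra.Structures
import Algebra.Morphism.Construct.Composition as Composition
import Algebra.Properties.CommutativeMonoid.Sum as CMSum
import Algebra.Properties.Ring as RingProperties
import Algebra.Properties.Semiring.Exp as Exp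
import Algebra.Solver.Ring.NaturalCoefficients.Default as CommutativeSemiringSolver
open import Data.Bool.Base using (if_then_else_)
open import Data.Fin.Base as Fin using (Fin; toℕ)
open import Data.Fin.Properties using (all?)
open import Data.Integer.Base as ℤ using (ℤ; +_; -[1+_]; _⊖_)
import Data.Integer.Properties as ℤ
open import Data.List.Base as List using (List; []; _∷_; length; upTo; filter; cartesianProductWith)
open import Data.Nat.Base as ℕ using (ℕ; zero; suc; _∸_; _≤_; _<_; z≤n; s≤s; ∣_-_∣)
import Data.Nat.Properties as ℕ
open import Data.Nat.Combinatorics using (_C_)
import Data.Nat.DivMod as ℕ
open import Data.Nat.Induction using (<-rec)
open import Data.Product.Base using (Σ; Σ-syntax; _×_; _,_; proj₁; proj₂)
open import Data.Rational.Base using (½)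
import Data.Rational.Properties as ℚ
open import Data.Vec.Base as Vec using (Vec; []; _∷_; lookup; zipWith; replicate)
import Data.Vec.Properties as Vec
import Data.Vec.Relation.Binary.Lex.NonStrict as Lex
open import Data.Vec.Relation.Unary.All as All using (All)
open import Data.Vec.Relation.Unary.Linked as Linked using (Linked)
open import Function.Base using (_∘_; flip)
open import Level using (0ℓ)
open import Relation.Binary.Core using (Rel)
open import Relation.Binary.Bundles using (Setoid)
open import Relation.Binary.Structures using (IsEquivalence)
open import Relation.Binary.PropositionalEquality.Core as ≡ using (_≡_)
import Relation.Binary.Reasoning.Setoid as SetoidReasoning
open import Relation.Nullary.Decidable using (does; _×-dec_)
open import Relation.Unary using (Decidable)

Ring₀ : Set₁
Ring₀ = CommutativeRing 0ℓ 0ℓ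

El : Ring₀ → Set
El = CommutativeRing.Carrier

module _ {S : Set} {_≈_ : Rel S 0ℓ} {_+_ _*_ : S → S → S} { -_ : S → S} {0# 1# : S}
         (isEquivalence : IsEquivalence _≈_) where
  open Algebra.Definitions _≈_
  open Algebra.Structures _≈_ using (IsCommutativeRing)
  private
    setoid : Setoid 0ℓ 0ℓ
    setoid = record { isEquivalence = isEquivalence }
  open Consequences setoid

  mkIsCommutativeRing : Congruent₂ _+_ → Associative _+_ → Commutative _+_ → LeftIdentity 0# _+_ →
           Congruent₁ -_ → LeftInverse 0# -_ _+_ →
           Congruent₂ _*_ → Associative _*_ → Commutative _*_ → LeftIdentity 1# _*_ →
           _*_ DistributesOverʳ _+_ → IsCommutativeRing _+_ _*_ -_ 0# 1#
  mkIsCommutativeRing +-cong +-assoc +-comm +-idˡ -‿cong -‿invˡ *-cong *-assoc *-comm *-idˡ distribʳ = record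
    { isRing = record
      { +-isAbelianGroup = record
        { isGroup = record
          { isMonoid = record
            { isSemigroup = record
              { isMagma = record { isEquivalence = isEquivalence ; ∙-cong = +-cong }
              ; assoc   = +-assoc }
            ; identity = comm∧idˡ⇒id +-comm +-idˡ }
          ; inverse = comm∧invˡ⇒inv +-comm -‿invˡ
          ; ⁻¹-cong = -‿cong }
        ; comm = +-comm }
      ; *-cong     = *-cong
      ; *-assoc    = *-assoc
      ; *-identity = comm∧idˡ⇒id *-comm *-idˡ
      ; distrib    = comm∧distrʳ⇒distr +-cong *-comm distribʳ }
    ; *-comm = *-comm }

module Units (A : Ring₀) where
  open CommutativeRing A hiding (isCommutativeRing)
  open Exp semiring using (_^_)
  open SetoidReasoning setoid
  open RingProperties ring using (-‿distribʳ-*; x∙y⁻¹≈ε⇒x≈y)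

  record Unit (x : Carrier) : Set where
    constructor mkUnit
    field
      inv     : Carrier
      inverse : x * inv ≈ 1#
  open Unit public using (inv)

  unit-resp : ∀ {x y} → x ≈ y → Unit x → Unit y
  unit-resp x≈y (mkUnit x⁻¹ r) = mkUnit x⁻¹ (trans (*-congʳ (sym x≈y)) r)

  unit-* : ∀ {x y} → Unit x → Unit y → Unit (x * y)
  unit-* {x} {y} (mkUnit x⁻¹ p) (mkUnit y⁻¹ r) = mkUnit (x⁻¹ * y⁻¹) (begin
    (x * y) * (x⁻¹ * y⁻¹) ≈⟨ solve 4 (λ a b c d → (a :* b) :* (c :* d) := (a :* c) :* (b :* d)) refl x y x⁻¹ y⁻¹ ⟩
    (x * x⁻¹) * (y * y⁻¹) ≈⟨ *-cong p r ⟩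
    1# * 1#               ≈⟨ *-identityˡ 1# ⟩
    1#                    ∎)
    where open CommutativeSemiringSolver commutativeSemiring

  unit-inv : ∀ {x} (u : Unit x) → Unit (inv u)
  unit-inv {x} (mkUnit _ r) = mkUnit x (trans (*-comm _ _) r)

  infixr 8 _^ᶻ_

  _^ᶻ_ : ∀ {x} → Unit x → ℤ → Carrier
  _^ᶻ_ {x} u (+ n)    = x ^ n
  u ^ᶻ -[1+ n ]       = inv u ^ suc n

  record Regular (x : Carrier) : Set where
    constructor mkRegular
    field annihilator-0 : ∀ y → x * y ≈ 0# → y ≈ 0#
  open Regular public

  regular-resp : ∀ {x y} → x ≈ y → Regular x → Regular y
  regular-resp x≈y (mkRegular r) = mkRegular λ z yz≈0 → r z (trans (*-congʳ x≈y) yz≈0)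

  regular-* : ∀ {x y} → Regular x → Regular y → Regular (x * y)
  regular-* (mkRegular r) (mkRegular s) = mkRegular λ z xyz≈0 → s z (r _ (trans (sym (*-assoc _ _ _)) xyz≈0))

  regular-1 : Regular 1#
  regular-1 = mkRegular λ y 1y≈0 → trans (sym (*-identityˡ y)) 1y≈0

  regular-cancel : ∀ {x} → Regular x → ∀ {y z} → x * y ≈ x * z → y ≈ z
  regular-cancel {x} (mkRegular r) {y} {z} xy≈xz = x∙y⁻¹≈ε⇒x≈y _ _ (r _ (begin
    x * (y - z)         ≈⟨ distribˡ _ _ _ ⟩
    x * y + x * (- z)   ≈⟨ +-congˡ (-‿distribʳ-* x z) ⟨
    x * y - x * z       ≈⟨ +-congʳ xy≈xz ⟩
    x * z - x * z       ≈⟨ -‿inverseʳ _ ⟩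
    0#                  ∎))

module Hom (A B : Ring₀) where
  private
    module A = CommutativeRing A
    module B = CommutativeRing B
    open RingMorphisms A.rawRing B.rawRing

  record IsHom (f : El A → El B) : Set where
    constructor isHom
    field isRingHomomorphism : IsRingHomomorphism f
    open IsRingHomomorphism isRingHomomorphism public

  mkHom : (f : El A → El B) →
          (∀ {x y} → x A.≈ y → f x B.≈ f y) →
          (∀ x y → f (x A.+ y) B.≈ f x B.+ f y) →
          (∀ x y → f (x A.* y) B.≈ f x B.* f y) →
          f A.0# B.≈ B.0# → f A.1# B.≈ B.1# →
          (∀ x → f (A.- x) B.≈ B.- f x) →
          IsHom f
  mkHom f cong +-homo *-homo 0-homo 1-homo -‿homo = isHom record
    { isSemiringHomomorphism = record
      { isNearSemiringHomomorphism = record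
        { +-isMonoidHomomorphism = record
          { isMagmaHomomorphism = record { isRelHomomorphism = record { cong = cong } ; homo = +-homo }
          ; ε-homo = 0-homo }
        ; *-homo = *-homo }
      ; 1#-homo = 1-homo }
    ; -‿homo = -‿homo }

  module _ {f : El A → El B} (hom : IsHom f) where
    private
      module UA = Units A
      module UB = Units B
      module f = IsHom hom
      module EA = Exp A.semiring
      module EB = Exp B.semiring

    unit-hom : ∀ {x} → UA.Unit x → UB.Unit (f x)
    unit-hom (Units.mkUnit x⁻¹ r) = Units.mkUnit (f x⁻¹) (B.trans (B.sym (f.*-homo _ _)) (B.trans (f.⟦⟧-cong r) f.1#-homo))

    ^-hom : ∀ x n → f (x EA.^ n) B.≈ f x EB.^ n
    ^-hom x zero    = f.1#-homo
    ^-hom x (suc n) = B.trans (f.*-homo _ _) (B.*-congˡ (^-hom x n))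

    ^ᶻ-hom : ∀ {x} (u : UA.Unit x) n → f (u UA.^ᶻ n) B.≈ unit-hom u UB.^ᶻ n
    ^ᶻ-hom {x} u (+ n)    = ^-hom x n
    ^ᶻ-hom u -[1+ n ]     = ^-hom (UA.inv u) (suc n)

    2-hom : UA.Unit (A.1# A.+ A.1#) → UB.Unit (B.1# B.+ B.1#)
    2-hom u = UB.unit-resp (B.trans (f.+-homo _ _) (B.+-cong f.1#-homo f.1#-homo)) (unit-hom u)

    1-xyⁿ-hom : ∀ x y n → f (A.1# A.- x A.* y EA.^ n) B.≈ B.1# B.- f x B.* f y EB.^ n
    1-xyⁿ-hom x y n = B.trans (f.+-homo _ _) (B.+-cong f.1#-homo
      (B.trans (f.-‿homo _) (B.-‿cong (B.trans (f.*-homo _ _) (B.*-congˡ (^-hom y n))))))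

    1-xyⁿ-unit : ∀ x y n → UB.Unit (f (A.1# A.- x A.* y EA.^ n)) → UB.Unit (B.1# B.- f x B.* f y EB.^ n)
    1-xyⁿ-unit x y n = UB.unit-resp (1-xyⁿ-hom x y n)

hom-∘ : ∀ {A B D : Ring₀} {f : El A → El B} {g : El B → El D} →
        Hom.IsHom A B f → Hom.IsHom B D g →
        Hom.IsHom A D (g ∘ f)
hom-∘ {D = D} (Hom.isHom f) (Hom.isHom g) = Hom.isHom (Composition.isRingHomomorphism (CommutativeRing.trans D) f g)

-- A[𝐢] with 𝐢² = -1; (x , y) is x + y𝐢.
module Gaussian (A : Ring₀) where
  open CommutativeRing A hiding (isCommutativeRing)
  open RingProperties ring using (-0#≈0#; -1*x≈-x)
  open CommutativeSemiringSolver commutativeSemiring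

  _·_ : Carrier × Carrier → Carrier × Carrier → Carrier × Carrier
  (a , b) · (c , d) = (a * c) - (b * d) , (a * d) + (b * c)

  private
    m : Carrier
    m = - 1#

    -‿m : ∀ x y → x - y ≈ x + m * y
    -‿m x y = +-congˡ (sym (-1*x≈-x y))

  infix 4 _≋_
  _≋_ : Carrier × Carrier → Carrier × Carrier → Set
  (a , b) ≋ (c , d) = (a ≈ c) × (b ≈ d)

  _⊞_ : Carrier × Carrier → Carrier × Carrier → Carrier × Carrier
  (a , b) ⊞ (c , d) = a + c , b + d

  ⊟_ : Carrier × Carrier → Carrier × Carrier
  ⊟ (a , b) = - a , - b

  -- The proofs of the ring laws are abstract throughout: unfolding them makes conversion
  -- checking in the iterated rings below prohibitively slow.
  abstract
    isCommutativeRing : Algebra.Structures.IsCommutativeRing _≋_ _⊞_ _·_ ⊟_ (0# , 0#) (1# , 0#)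
    isCommutativeRing = mkIsCommutativeRing
      (record { refl  = refl , refl ; sym = λ (p , r) → sym p , sym r
              ; trans = λ (p , r) (p′ , r′) → trans p p′ , trans r r′ })
      (λ (p , r) (p′ , r′) → +-cong p p′ , +-cong r r′)
      (λ _ _ _ → +-assoc _ _ _ , +-assoc _ _ _)
      (λ _ _ → +-comm _ _ , +-comm _ _)
      (λ _ → +-identityˡ _ , +-identityˡ _)
      (λ (p , r) → -‿cong p , -‿cong r)
      (λ _ → -‿inverseˡ _ , -‿inverseˡ _)
      (λ (p , r) (p′ , r′) → +-cong (*-cong p p′) (-‿cong (*-cong r r′)) , +-cong (*-cong p r′) (*-cong r p′))
      (λ (a , b) (c , d) (e , f) →
         trans (trans (+-congʳ (*-congʳ (-‿m _ _))) (-‿m _ _)) (trans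
           (solve 7 (λ m a b c d e f →
              (a :* c :+ m :* (b :* d)) :* e :+ m :* ((a :* d :+ b :* c) :* f) :=
              a :* (c :* e :+ m :* (d :* f)) :+ m :* (b :* (c :* f :+ d :* e))) refl m a b c d e f)
           (sym (trans (+-congʳ (*-congˡ (-‿m _ _))) (-‿m _ _))))
       , trans (+-congʳ (*-congʳ (-‿m _ _))) (trans
           (solve 7 (λ m a b c d e f →
              (a :* c :+ m :* (b :* d)) :* f :+ (a :* d :+ b :* c) :* e :=
              a :* (c :* f :+ d :* e) :+ b :* (c :* e :+ m :* (d :* f))) refl m a b c d e f)
           (sym (+-congˡ (*-congˡ (-‿m _ _))))))
      (λ (a , b) (c , d) →
         +-cong (*-comm a c) (-‿cong (*-comm b d))
       , trans (+-comm _ _) (+-cong (*-comm b c) (*-comm a d)))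
      (λ (a , b) →
         trans (+-cong (*-identityˡ a) (trans (-‿cong (zeroˡ b)) -0#≈0#)) (+-identityʳ a)
       , trans (+-cong (*-identityˡ b) (zeroˡ a)) (+-identityʳ b))
      (λ (a , b) (c , d) (e , f) →
         trans (-‿m _ _) (trans
           (solve 7 (λ m a b c d e f →
              (c :+ e) :* a :+ m :* ((d :+ f) :* b) :=
              (c :* a :+ m :* (d :* b)) :+ (e :* a :+ m :* (f :* b))) refl m a b c d e f)
           (sym (+-cong (-‿m _ _) (-‿m _ _))))
       , solve 6 (λ a b c d e f →
           (c :+ e) :* b :+ (d :+ f) :* a := (c :* b :+ d :* a) :+ (e :* b :+ f :* a)) refl a b c d e f)

  gaussian : Ring₀
  gaussian = record { isCommutativeRing = isCommutativeRing }

  re : Carrier → Carrier × Carrier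
  re x = x , 0#

  𝐢 : Carrier × Carrier
  𝐢 = 0# , 1#

  re-hom : Hom.IsHom A gaussian re
  re-hom = Hom.mkHom A gaussian re (λ p → p , refl)
    (λ _ _ → refl , sym (+-identityˡ 0#))
    (λ x y → sym (trans (+-congˡ (trans (-‿cong (zeroˡ 0#)) -0#≈0#)) (+-identityʳ _))
           , sym (trans (+-cong (zeroʳ x) (zeroˡ y)) (+-identityˡ 0#)))
    (refl , refl) (refl , refl) (λ _ → refl , sym -0#≈0#)

  𝐢-unit : Units.Unit gaussian 𝐢
  𝐢-unit = Units.mkUnit (0# , - 1#)
    ( trans (+-cong (zeroˡ 0#) (trans (-‿cong (*-identityˡ _)) (-‿involutive 1#))) (+-identityˡ 1#)
    , trans (+-cong (zeroˡ _) (zeroʳ 1#)) (+-identityˡ 0#))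
    where open RingProperties ring using (-‿involutive)

-- Power series in one variable, as coefficient sequences.
module Series (A : Ring₀) where
  open CommutativeRing A hiding (isCommutativeRing)
  open Units A
  open SetoidReasoning setoid
  open CommutativeSemiringSolver commutativeSemiring

  -- Cauchy product: conv f g n is the sum of f i * g j over i + j = n.
  conv : (ℕ → Carrier) → (ℕ → Carrier) → ℕ → Carrier
  conv f g zero    = f 0 * g 0
  conv f g (suc n) = f 0 * g (suc n) + conv (f ∘ suc) g n

  const : Carrier → ℕ → Carrier
  const c zero    = c
  const c (suc n) = 0#

  X : ℕ → Carrier
  X zero    = 0#
  X (suc n) = const 1# n

  conv-cong : ∀ {f f′ g g′} → (∀ n → f n ≈ f′ n) → (∀ n → g n ≈ g′ n) → ∀ n → conv f g n ≈ conv f′ g′ n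
  conv-cong p r zero    = *-cong (p 0) (r 0)
  conv-cong p r (suc n) = +-cong (*-cong (p 0) (r (suc n))) (conv-cong (p ∘ suc) r n)

  conv-0ˡ : ∀ {f} g → (∀ n → f n ≈ 0#) → ∀ n → conv f g n ≈ 0#
  conv-0ˡ g p zero    = trans (*-congʳ (p 0)) (zeroˡ _)
  conv-0ˡ g p (suc n) = trans (+-cong (trans (*-congʳ (p 0)) (zeroˡ _)) (conv-0ˡ g (p ∘ suc) n)) (+-identityˡ 0#)

  conv-0ʳ : ∀ f {g} n → (∀ i → i ≤ n → g i ≈ 0#) → conv f g n ≈ 0#
  conv-0ʳ f zero    p = trans (*-congˡ (p 0 z≤n)) (zeroʳ _)
  conv-0ʳ f (suc n) p = trans (+-cong (trans (*-congˡ (p (suc n) ℕ.≤-refl)) (zeroʳ _))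
    (conv-0ʳ (f ∘ suc) n (λ i i≤n → p i (ℕ.m≤n⇒m≤1+n i≤n)))) (+-identityˡ 0#)

  conv-constˡ : ∀ c g n → conv (const c) g n ≈ c * g n
  conv-constˡ c g zero    = refl
  conv-constˡ c g (suc n) = trans (+-congˡ (conv-0ˡ g (λ _ → refl) n)) (+-identityʳ _)

  conv-distribʳ : ∀ h f g n → conv (λ i → f i + g i) h n ≈ conv f h n + conv g h n
  conv-distribʳ h f g zero    = distribʳ _ _ _
  conv-distribʳ h f g (suc n) = trans (+-cong (distribʳ _ _ _) (conv-distribʳ h (f ∘ suc) (g ∘ suc) n))
    (solve 4 (λ a b c d → (a :+ b) :+ (c :+ d) := (a :+ c) :+ (b :+ d)) refl _ _ _ _)

  conv-scaleˡ : ∀ c f g n → conv (λ i → c * f i) g n ≈ c * conv f g n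
  conv-scaleˡ c f g zero    = *-assoc _ _ _
  conv-scaleˡ c f g (suc n) = trans (+-cong (*-assoc _ _ _) (conv-scaleˡ c (f ∘ suc) g n)) (sym (distribˡ _ _ _))

  conv-assoc : ∀ f g h n → conv (conv f g) h n ≈ conv f (conv g h) n
  conv-assoc f g h zero    = *-assoc _ _ _
  conv-assoc f g h (suc n) = begin
    (f 0 * g 0) * h (suc n) + conv (λ i → f 0 * g (suc i) + conv (f ∘ suc) g i) h n
      ≈⟨ +-congˡ (conv-distribʳ h _ _ n) ⟩
    (f 0 * g 0) * h (suc n) + (conv (λ i → f 0 * g (suc i)) h n + conv (conv (f ∘ suc) g) h n)
      ≈⟨ +-cong (*-assoc _ _ _) (+-cong (conv-scaleˡ (f 0) (g ∘ suc) h n) (conv-assoc (f ∘ suc) g h n)) ⟩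
    f 0 * (g 0 * h (suc n)) + (f 0 * conv (g ∘ suc) h n + conv (f ∘ suc) (conv g h) n)
      ≈⟨ solve 4 (λ a b c d → a :* b :+ (a :* c :+ d) := a :* (b :+ c) :+ d) refl (f 0) _ _ _ ⟩
    f 0 * (g 0 * h (suc n) + conv (g ∘ suc) h n) + conv (f ∘ suc) (conv g h) n ∎

  conv-sucʳ : ∀ f g n → conv f g (suc n) ≈ conv f (g ∘ suc) n + f (suc n) * g 0
  conv-sucʳ f g zero    = refl
  conv-sucʳ f g (suc n) = trans (+-congˡ (conv-sucʳ (f ∘ suc) g n)) (sym (+-assoc _ _ _))

  conv-comm : ∀ f g n → conv f g n ≈ conv g f n
  conv-comm f g zero    = *-comm _ _
  conv-comm f g (suc n) = begin
    conv f g (suc n)                         ≈⟨ conv-sucʳ f g n ⟩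
    conv f (g ∘ suc) n + f (suc n) * g 0     ≈⟨ +-comm _ _ ⟩
    f (suc n) * g 0 + conv f (g ∘ suc) n     ≈⟨ +-cong (*-comm _ _) (conv-comm f (g ∘ suc) n) ⟩
    g 0 * f (suc n) + conv (g ∘ suc) f n     ∎

  infix 4 _≋_
  _≋_ : (ℕ → Carrier) → (ℕ → Carrier) → Set
  f ≋ g = ∀ n → f n ≈ g n

  _⊞_ : (ℕ → Carrier) → (ℕ → Carrier) → ℕ → Carrier
  (f ⊞ g) n = f n + g n

  ⊟_ : (ℕ → Carrier) → ℕ → Carrier
  (⊟ f) n = - f n

  abstract
    isCommutativeRing : Algebra.Structures.IsCommutativeRing _≋_ _⊞_ conv ⊟_ (λ _ → 0#) (const 1#)
    isCommutativeRing = mkIsCommutativeRing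
      (record { refl = λ _ → refl ; sym = λ p n → sym (p n) ; trans = λ p r n → trans (p n) (r n) })
      (λ p r n → +-cong (p n) (r n))
      (λ _ _ _ _ → +-assoc _ _ _)
      (λ _ _ _ → +-comm _ _)
      (λ _ _ → +-identityˡ _)
      (λ p n → -‿cong (p n))
      (λ _ _ → -‿inverseˡ _)
      conv-cong conv-assoc conv-comm
      (λ f n → trans (conv-constˡ 1# f n) (*-identityˡ _))
      conv-distribʳ

  series : Ring₀
  series = record { isCommutativeRing = isCommutativeRing }

  const-hom : Hom.IsHom A series const
  const-hom = Hom.mkHom A series const
    (λ { p zero → p ; p (suc n) → refl })
    (λ { x y zero → refl ; x y (suc n) → sym (+-identityˡ 0#) })
    (λ { x y zero → refl ; x y (suc n) → sym (trans (conv-constˡ x (const y) (suc n)) (zeroʳ x)) })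
    (λ { zero → refl ; (suc n) → refl }) (λ _ → refl)
    (λ { x zero → refl ; x (suc n) → sym -0#≈0# })
    where open RingProperties ring using (-0#≈0#)

  regular-series : ∀ f → Regular (f 0) → Units.Regular series f
  regular-series f (mkRegular r) = Units.mkRegular λ g fg≈0 → <-rec _ (step g fg≈0)
    where
    step : ∀ g → (∀ n → conv f g n ≈ 0#) → ∀ n → (∀ {i} → i < n → g i ≈ 0#) → g n ≈ 0#
    step g fg≈0 zero    rec = r _ (fg≈0 0)
    step g fg≈0 (suc n) rec = r _ (begin
      f 0 * g (suc n)                        ≈⟨ +-identityʳ _ ⟨
      f 0 * g (suc n) + 0#                   ≈⟨ +-congˡ (conv-0ʳ (f ∘ suc) n (λ i i≤n → rec (s≤s i≤n))) ⟨
      f 0 * g (suc n) + conv (f ∘ suc) g n   ≈⟨ fg≈0 (suc n) ⟩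
      0#                                     ∎)

  regular-X : Units.Regular series X
  regular-X = Units.mkRegular λ g Xg≈0 n → begin
    g n                            ≈⟨ trans (conv-constˡ 1# g n) (*-identityˡ _) ⟨
    conv (const 1#) g n            ≈⟨ trans (+-congʳ (zeroˡ _)) (+-identityˡ _) ⟨
    0# * g (suc n) + conv (const 1#) g n ≈⟨ Xg≈0 (suc n) ⟩
    0#                             ∎

  private module Sʳ = CommutativeRing series

  regular-1-X* : ∀ f → Units.Regular series (Sʳ.1# Sʳ.- X Sʳ.* f)
  regular-1-X* f = regular-series _ (regular-resp (sym 1-0f₀≈1) regular-1)
    where
    open RingProperties ring using (-0#≈0#)
    1-0f₀≈1 : 1# - 0# * f 0 ≈ 1#
    1-0f₀≈1 = trans (+-congˡ (trans (-‿cong (zeroˡ (f 0))) -0#≈0#)) (+-identityʳ 1#)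

module Polynomials (A : Ring₀) where
  open CommutativeRing A hiding (isCommutativeRing)
  private module S = Series A
  open S using (conv)

  record Polynomial : Set where
    constructor poly
    field
      coeff    : ℕ → Carrier
      bound    : ℕ
      vanishes : ∀ n → bound ≤ n → coeff n ≈ 0#
  open Polynomial public

  conv-vanishes : ∀ f g b c → (∀ n → b ≤ n → f n ≈ 0#) → (∀ n → c ≤ n → g n ≈ 0#) →
                  ∀ n → b ℕ.+ c ≤ n → conv f g n ≈ 0#
  conv-vanishes f g zero    c p r n       _         = S.conv-0ˡ g (λ i → p i z≤n) n
  conv-vanishes f g (suc b) c p r (suc n) (s≤s b+c≤n) = trans (+-cong
      (trans (*-congˡ (r (suc n) (ℕ.m≤n⇒m≤1+n (ℕ.≤-trans (ℕ.m≤n+m c b) b+c≤n)))) (zeroʳ _))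
      (conv-vanishes (f ∘ suc) g b c (λ i b≤i → p (suc i) (s≤s b≤i)) r n b+c≤n))
    (+-identityˡ 0#)

  constant : Carrier → Polynomial
  constant c = poly (S.const c) 1 λ { (suc n) _ → refl }

  X : Polynomial
  X = poly S.X 2 λ { (suc (suc n)) _ → refl ; (suc zero) (s≤s ()) }

  _⊞_ _⊠_ : Polynomial → Polynomial → Polynomial
  poly f b p ⊞ poly g c r = poly (λ n → f n + g n) (b ℕ.⊔ c) λ n b⊔c≤n →
    trans (+-cong (p n (ℕ.m⊔n≤o⇒m≤o b c b⊔c≤n)) (r n (ℕ.m⊔n≤o⇒n≤o b c b⊔c≤n))) (+-identityˡ 0#)
  poly f b p ⊠ poly g c r = poly (conv f g) (b ℕ.+ c) (conv-vanishes f g b c p r)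

  ⊟_ : Polynomial → Polynomial
  ⊟ poly f b p = poly (λ n → - f n) b λ n b≤n → trans (-‿cong (p n b≤n)) -0#≈0#
    where open RingProperties ring using (-0#≈0#)

  infix 4 _≋_
  _≋_ : Polynomial → Polynomial → Set
  f ≋ g = coeff f S.≋ coeff g

  abstract
    isCommutativeRing : Algebra.Structures.IsCommutativeRing _≋_ _⊞_ _⊠_ ⊟_ (poly (λ _ → 0#) 0 λ _ _ → refl) (constant 1#)
    isCommutativeRing = mkIsCommutativeRing
      (record { refl = λ _ → refl ; sym = λ p n → sym (p n) ; trans = λ p r n → trans (p n) (r n) })
      (λ p r n → +-cong (p n) (r n))
      (λ _ _ _ _ → +-assoc _ _ _)
      (λ _ _ _ → +-comm _ _)
      (λ _ _ → +-identityˡ _)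
      (λ p n → -‿cong (p n))
      (λ _ _ → -‿inverseˡ _)
      S.conv-cong
      (λ f g h → S.conv-assoc (coeff f) (coeff g) (coeff h))
      (λ f g → S.conv-comm (coeff f) (coeff g))
      (λ f → CommutativeRing.*-identityˡ S.series (coeff f))
      (λ h f g → S.conv-distribʳ (coeff h) (coeff f) (coeff g))

  polynomials : Ring₀
  polynomials = record { isCommutativeRing = isCommutativeRing }

  constant-hom : Hom.IsHom A polynomials constant
  constant-hom = Hom.mkHom A polynomials constant C.⟦⟧-cong C.+-homo C.*-homo C.0#-homo C.1#-homo C.-‿homo
    where module C = Hom.IsHom S.const-hom

  regular-X : Units.Regular polynomials X
  regular-X = Units.mkRegular λ g → Units.annihilator-0 S.regular-X (coeff g)

  private module Pʳ = CommutativeRing polynomials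

  regular-1-X* : ∀ f → Units.Regular polynomials (Pʳ.1# Pʳ.- X Pʳ.* f)
  regular-1-X* f = Units.mkRegular λ g → Units.annihilator-0 (S.regular-1-X* (coeff f)) (coeff g)

-- The ring of fractions of A whose denominators are all the regular elements
-- (non-zero-divisors) of A; for an integral domain this is its field of fractions.
module Fractions (A : Ring₀) where
  open CommutativeRing A hiding (isCommutativeRing)
  open Units A using (Regular; regular-1; regular-*; regular-cancel)
  open SetoidReasoning setoid
  open CommutativeSemiringSolver commutativeSemiring
  open RingProperties ring using (-‿distribˡ-*)

  record Fraction : Set where
    constructor frac
    field
      num     : Carrier
      den     : Carrier
      regular : Regular den
  open Fraction public

  infix  4 _∼_
  infixl 6 _⊞_
  infixl 7 _⊠_

  _∼_ : Fraction → Fraction → Set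
  x ∼ y = num x * den y ≈ num y * den x

  _⊞_ _⊠_ : Fraction → Fraction → Fraction
  frac a b r ⊞ frac c d s = frac (a * d + c * b) (b * d) (regular-* r s)
  frac a b r ⊠ frac c d s = frac (a * c) (b * d) (regular-* r s)

  ⊟_ : Fraction → Fraction
  ⊟ frac a b r = frac (- a) b r

  ι : Carrier → Fraction
  ι a = frac a 1# regular-1

  ∼-trans : ∀ {x y z} → x ∼ y → y ∼ z → x ∼ z
  ∼-trans {frac a b _} {frac c d s} {frac e f _} p r = regular-cancel s (begin
    d * (a * f) ≈⟨ solve 3 (λ d a f → d :* (a :* f) := (a :* d) :* f) refl d a f ⟩
    (a * d) * f ≈⟨ *-congʳ p ⟩
    (c * b) * f ≈⟨ solve 3 (λ c b f → (c :* b) :* f := (c :* f) :* b) refl c b f ⟩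
    (c * f) * b ≈⟨ *-congʳ r ⟩
    (e * d) * b ≈⟨ solve 3 (λ e d b → (e :* d) :* b := d :* (e :* b)) refl e d b ⟩
    d * (e * b) ∎)

  ⊞-cong : ∀ {x y u v} → x ∼ y → u ∼ v → x ⊞ u ∼ y ⊞ v
  ⊞-cong {frac a b _} {frac a′ b′ _} {frac c d _} {frac c′ d′ _} p r = begin
    (a * d + c * b) * (b′ * d′)               ≈⟨ solve 6 (λ a b c d b′ d′ → (a :* d :+ c :* b) :* (b′ :* d′) := (a :* b′) :* (d :* d′) :+ (c :* d′) :* (b :* b′)) refl a b c d b′ d′ ⟩
    (a * b′) * (d * d′) + (c * d′) * (b * b′) ≈⟨ +-cong (*-congʳ p) (*-congʳ r) ⟩
    (a′ * b) * (d * d′) + (c′ * d) * (b * b′) ≈⟨ solve 6 (λ a′ b c′ d b′ d′ → (a′ :* b) :* (d :* d′) :+ (c′ :* d) :* (b :* b′) := (a′ :* d′ :+ c′ :* b′) :* (b :* d)) refl a′ b c′ d b′ d′ ⟩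
    (a′ * d′ + c′ * b′) * (b * d)             ∎

  ⊠-cong : ∀ {x y u v} → x ∼ y → u ∼ v → x ⊠ u ∼ y ⊠ v
  ⊠-cong {frac a b _} {frac a′ b′ _} {frac c d _} {frac c′ d′ _} p r = begin
    (a * c) * (b′ * d′)  ≈⟨ middle a c b′ d′ ⟩
    (a * b′) * (c * d′)  ≈⟨ *-cong p r ⟩
    (a′ * b) * (c′ * d)  ≈⟨ middle a′ b c′ d ⟩
    (a′ * c′) * (b * d)  ∎
    where
    middle : ∀ a b c d → (a * b) * (c * d) ≈ (a * c) * (b * d)
    middle = solve 4 (λ a b c d → (a :* b) :* (c :* d) := (a :* c) :* (b :* d)) refl

  abstract
    isCommutativeRing : Algebra.Structures.IsCommutativeRing _∼_ _⊞_ _⊠_ ⊟_ (ι 0#) (ι 1#)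
    isCommutativeRing = mkIsCommutativeRing
      (record { refl = refl ; sym = sym ; trans = λ {x} {y} {z} → ∼-trans {x} {y} {z} })
      (λ {x} {y} {u} {v} → ⊞-cong {x} {y} {u} {v})
      (λ (frac a b _) (frac c d _) (frac e f _) →
        solve 6 (λ a b c d e f → ((a :* d :+ c :* b) :* f :+ e :* (b :* d)) :* (b :* (d :* f)) :=
                                 (a :* (d :* f) :+ (c :* f :+ e :* d) :* b) :* ((b :* d) :* f)) refl a b c d e f)
      (λ (frac a b _) (frac c d _) →
        solve 4 (λ a b c d → (a :* d :+ c :* b) :* (d :* b) := (c :* b :+ a :* d) :* (b :* d)) refl a b c d)
      (λ (frac a b _) → begin
        (0# * b + a * 1#) * b ≈⟨ *-congʳ (trans (+-cong (zeroˡ b) (*-identityʳ a)) (+-identityˡ a)) ⟩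
        a * b                 ≈⟨ *-congˡ (*-identityˡ b) ⟨
        a * (1# * b)          ∎)
      (λ {(frac a b _)} {(frac c d _)} p → begin
        (- a) * d ≈⟨ -‿distribˡ-* a d ⟨
        - (a * d) ≈⟨ -‿cong p ⟩
        - (c * b) ≈⟨ -‿distribˡ-* c b ⟩
        (- c) * b ∎)
      (λ (frac a b _) → begin
        ((- a) * b + a * b) * 1# ≈⟨ *-identityʳ _ ⟩
        (- a) * b + a * b        ≈⟨ distribʳ b (- a) a ⟨
        ((- a) + a) * b          ≈⟨ *-congʳ (-‿inverseˡ a) ⟩
        0# * b                   ≈⟨ zeroˡ b ⟩
        0#                       ≈⟨ zeroˡ _ ⟨
        0# * (b * b)             ∎)
      (λ {x} {y} {u} {v} → ⊠-cong {x} {y} {u} {v})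
      (λ (frac a b _) (frac c d _) (frac e f _) →
        *-cong (*-assoc a c e) (sym (*-assoc b d f)))
      (λ (frac a b _) (frac c d _) → *-cong (*-comm a c) (*-comm d b))
      (λ (frac a b _) → *-cong (*-identityˡ a) (sym (*-identityˡ b)))
      (λ (frac a b _) (frac c d _) (frac e f _) →
        solve 6 (λ a b c d e f → ((c :* f :+ e :* d) :* a) :* ((d :* b) :* (f :* b)) :=
                                 ((c :* a) :* (f :* b) :+ (e :* a) :* (d :* b)) :* ((d :* f) :* b)) refl a b c d e f)

  fractions : Ring₀
  fractions = record { isCommutativeRing = isCommutativeRing }

  ι-hom : Hom.IsHom A fractions ι
  ι-hom = Hom.mkHom A fractions ι *-congʳ
    (λ x y → begin
      (x + y) * (1# * 1#)     ≈⟨ *-cong (sym (+-cong (*-identityʳ x) (*-identityʳ y))) (*-identityˡ 1#) ⟩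
      (x * 1# + y * 1#) * 1#  ∎)
    (λ x y → *-congˡ (*-identityˡ 1#))
    refl refl (λ _ → refl)

  regular⇒unit : ∀ {a} → Regular a → Units.Unit fractions (ι a)
  regular⇒unit {a} r = Units.mkUnit (frac 1# a r)
    (trans (*-identityʳ _) (trans (*-identityʳ a) (sym (trans (*-identityˡ _) (*-identityˡ a)))))

module QSeries (A : Ring₀) where
  open CommutativeRing A
  open Units A
  open Exp semiring using (_^_)
  open CMSum +-commutativeMonoid using (sum⁺-syntax)
  open CMSum *-commutativeMonoid using () renaming (sum to ∏)

  unit-∏ : ∀ {n} (f : Fin n → Carrier) → (∀ i → Unit (f i)) → Unit (∏ f)
  unit-∏ {zero}  f u = mkUnit 1# (*-identityˡ 1#)
  unit-∏ {suc n} f u = unit-* (u Fin.zero) (unit-∏ (f ∘ Fin.suc) (u ∘ Fin.suc))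

  module Base {q : Carrier} (q-unit : Unit q) where

    ⟨_⟩_ : Carrier → ℕ → Carrier
    ⟨ z ⟩ n = ∏ {n} λ i → 1# - z * q ^ toℕ i

    -- β is admissible when no (β;q)ₖ degenerates, i.e. β may occur as a lower parameter.
    Admissible : Carrier → Set
    Admissible β = ∀ i → Unit (1# - β * q ^ i)

    unit-⟨⟩ : ∀ {β} → Admissible β → ∀ n → Unit (⟨ β ⟩ n)
    unit-⟨⟩ adm n = unit-∏ {n} _ λ i → adm (toℕ i)

    ∏ᴸ : List Carrier → Carrier
    ∏ᴸ = List.foldr _*_ 1#

    module _ (q-adm : Admissible q) where

      bracket : ℕ → Carrier
      bracket i = (1# - q ^ i) * inv (q-adm 0)

      [_]! : ℕ → Carrier
      [ n ]! = ∏ {n} λ i → bracket (suc (toℕ i))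

      unit-! : ∀ n → Unit [ n ]!
      unit-! n = unit-∏ {n} _ λ i → unit-* (q-adm (toℕ i)) (unit-inv (q-adm 0))

      multinomial : ℕ → ℕ → List ℕ → Carrier
      multinomial n k ms = [ n ]! * inv (unit-! k) * ∏ᴸ (List.map (λ m → inv (unit-! m)) ms)

      -- ᵣφₛ(αs;βs;q,z) for a terminating series: the sum is cut after k = N, and is only used
      -- when q⁻ᴺ occurs among the αs, so that (q⁻ᴺ;q)ₖ = 0 kills all further terms.
      φ : ℕ → List Carrier → List (Σ Carrier Admissible) → Carrier → Carrier
      φ N αs βs z = ∑[ k ≤ N ] term (toℕ k)
        where
        sign : ∀ k → Unit ((- 1#) ^ k * q ^ (k C 2))
        sign k = unit-* (unit-^ (mkUnit (- 1#) -1²) k) (unit-^ q-unit (k C 2))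
          where
          open RingProperties ring using (-1*x≈-x; -‿involutive)
          -1² : (- 1#) * (- 1#) ≈ 1#
          -1² = trans (-1*x≈-x _) (-‿involutive 1#)
          unit-^ : ∀ {x} → Unit x → ∀ n → Unit (x ^ n)
          unit-^ u zero    = mkUnit 1# (*-identityˡ 1#)
          unit-^ u (suc n) = unit-* u (unit-^ u n)

        term : ℕ → Carrier
        term k = ∏ᴸ (List.map (λ α → ⟨ α ⟩ k) αs)
               * ∏ᴸ (List.map (λ (β , adm) → inv (unit-⟨⟩ {β} adm k)) ((q , q-adm) ∷ βs))
               * sign k ^ᶻ ((1 ℕ.+ length βs) ⊖ length αs)
               * z ^ k

-- Parameters for which all denominators in the formulas below are invertible.
record Parameters (A : Ring₀) : Set where
  open CommutativeRing A
  open Units A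
  open QSeries A using (module Base)
  field
    {q a b c d} : Carrier
    2-unit   : Unit (1# + 1#)
    q-unit   : Unit q
    a-unit   : Unit a
  open Base q-unit using (Admissible)
  field
    q-adm    : Admissible q
    ab-adm   : Admissible (a * b)
    ac-adm   : Admissible (a * c)
    ad-adm   : Admissible (a * d)
    abcd-adm : ∀ n → Admissible (a * b * c * d * q-unit ^ᶻ (n ⊖ 1))

module AskeyWilson {A : Ring₀} (P : Parameters A) where
  open CommutativeRing A
  open Units A
  open Exp semiring using (_^_)
  open CMSum +-commutativeMonoid using (sum⁺-syntax)
  open Parameters P
  open QSeries A using (module Base)
  open Base q-unit

  ½^_ : ℕ → Carrier
  ½^ n = inv 2-unit ^ n

  -- The polynomials are evaluated at x = cos θ = (z + z⁻¹)/2, where z is e^{𝐢θ}.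
  module _ {z : Carrier} (z-unit : Unit z) where

    abcdqⁿ⁻¹ : ℕ → Carrier
    abcdqⁿ⁻¹ n = a * b * c * d * q-unit ^ᶻ (n ⊖ 1)

    p : ℕ → Carrier
    p n = ⟨ a * b ⟩ n * ⟨ a * c ⟩ n * ⟨ a * d ⟩ n
        * ½^ n * inv a-unit ^ n * inv (unit-⟨⟩ (abcd-adm n) n)
        * φ q-adm n
            (q-unit ^ᶻ (ℤ.- + n) ∷ abcdqⁿ⁻¹ n ∷ a * z ∷ a * inv z-unit ∷ [])
            ((a * b , ab-adm) ∷ (a * c , ac-adm) ∷ (a * d , ad-adm) ∷ []) q

    H : ℕ → Carrier
    H n = z ^ n * ½^ n
        * φ q-adm n (q-unit ^ᶻ (ℤ.- + n) ∷ 0# ∷ []) [] (q ^ n * inv z-unit ^ 2)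

  -- σ is the family of connection coefficients σ^{AW,H} for the parameters P:
  -- Hₙ = ∑ₖ σₙₖ pₖ at every x = (z + z⁻¹)/2. Over the infinite field A = 𝕃 below, this is the
  -- same as an identity of polynomials in x.
  IsConnection : (ℕ → ℕ → Carrier) → Set
  IsConnection σ = ∀ n {z} (z-unit : Unit z) → H z-unit n ≈ ∑[ k ≤ n ] (σ n (toℕ k) * p z-unit (toℕ k))

-- Parameters I·a₁, …, I·a₄ in a ring L over R, with q from a ring K.
module ScaledParameters
  (K R L : Ring₀)
  {C : El K → El R} (C-hom : Hom.IsHom K R C)
  {ι : El R → El L} (ι-hom : Hom.IsHom R L ι)
  where
  private
    module K = CommutativeRing K
    module R = CommutativeRing R
    module L = CommutativeRing L
    module UK = Units K
    module UL = Units L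
    module EL = Exp L.semiring
    module ι = Hom.IsHom ι-hom
    module QK = QSeries K

    κ : El K → El L
    κ = ι ∘ C

    κ-hom : Hom.IsHom K L κ
    κ-hom = hom-∘ {K} {R} {L} C-hom ι-hom

    module κ = Hom K L

  module _
    {q : El K} (q-unit : UK.Unit q) (q-adm : QK.Base.Admissible q-unit q)
    (2-unit : UL.Unit (L.1# L.+ L.1#))
    (I a₁ a₂ a₃ a₄ : El R)
    (I-unit : UL.Unit (ι I)) (a₁-unit : UL.Unit (ι a₁))
    (1-a₁t-unit : ∀ t → UL.Unit (ι (R.1# R.- a₁ R.* t)))
    where
    private
      Integral Small : El L → Set
      Integral x = Σ[ t ∈ El R ] x L.≈ ι t
      Small    x = Σ[ t ∈ El R ] x L.≈ ι (a₁ R.* t)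

      small-* : ∀ {x y} → Small x → Integral y → Small (x L.* y)
      small-* (s , p) (t , r) = s R.* t , L.trans (L.*-cong p r)
        (L.trans (L.sym (ι.*-homo (a₁ R.* s) t)) (ι.⟦⟧-cong (R.*-assoc a₁ s t)))

      integral-qⁱ : ∀ i → Integral (κ q EL.^ i)
      integral-qⁱ i = _ , L.sym (κ.^-hom κ-hom q i)

      integral-qᶻ : ∀ n → Integral (UL._^ᶻ_ (κ.unit-hom κ-hom q-unit) n)
      integral-qᶻ n = _ , L.sym (κ.^ᶻ-hom κ-hom q-unit n)

      integral-I* : ∀ r → Integral (ι I L.* ι r)
      integral-I* r = _ , L.sym (ι.*-homo I r)

      small-Ia₁ : Small (ι I L.* ι a₁)
      small-Ia₁ = I , L.trans (L.*-comm _ _) (L.sym (ι.*-homo a₁ I))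

      1-small : ∀ {x} → Small x → UL.Unit (L.1# L.- x)
      1-small (t , p) = UL.unit-resp
        (L.trans (ι.+-homo _ _) (L.+-cong ι.1#-homo (L.trans (ι.-‿homo _) (L.-‿cong (L.sym p)))))
        (1-a₁t-unit t)

    scaledParameters : Parameters L
    scaledParameters = record
      { q        = κ q
      ; a        = ι I L.* ι a₁
      ; b        = ι I L.* ι a₂
      ; c        = ι I L.* ι a₃
      ; d        = ι I L.* ι a₄
      ; 2-unit   = 2-unit
      ; q-unit   = κ.unit-hom κ-hom q-unit
      ; a-unit   = UL.unit-* I-unit a₁-unit
      ; q-adm    = λ i → κ.1-xyⁿ-unit κ-hom q q i (κ.unit-hom κ-hom (q-adm i))
      ; ab-adm   = λ i → 1-small (small-* (small-* small-Ia₁ (integral-I* a₂)) (integral-qⁱ i))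
      ; ac-adm   = λ i → 1-small (small-* (small-* small-Ia₁ (integral-I* a₃)) (integral-qⁱ i))
      ; ad-adm   = λ i → 1-small (small-* (small-* small-Ia₁ (integral-I* a₄)) (integral-qⁱ i))
      ; abcd-adm = λ n i → 1-small (small-* (small-* (small-* (small-* (small-* small-Ia₁
          (integral-I* a₂)) (integral-I* a₃)) (integral-I* a₄)) (integral-qᶻ (n ⊖ 1))) (integral-qⁱ i))
      }

-- The rational function field A(q), for an integral domain A.
module RationalFunctions (A : Ring₀) where
  module P = Polynomials A
  module F = Fractions P.polynomials
  private module Pʳ = CommutativeRing P.polynomials

  rationals : Ring₀
  rationals = F.fractions

  q : El rationals
  q = F.ι P.X

  q-unit : Units.Unit rationals q
  q-unit = F.regular⇒unit {P.X} P.regular-X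

  q-adm : QSeries.Base.Admissible rationals q-unit q
  q-adm i = Hom.1-xyⁿ-unit P.polynomials rationals F.ι-hom P.X P.X i
    (F.regular⇒unit {Pʳ.1# Pʳ.- P.X Pʳ.* P.X ^ i} (P.regular-1-X* (P.X ^ i)))
    where open Exp Pʳ.semiring using (_^_)

  2-unit : Units.Unit A (CommutativeRing._+_ A (CommutativeRing.1# A) (CommutativeRing.1# A)) →
           Units.Unit rationals (CommutativeRing._+_ rationals (CommutativeRing.1# rationals) (CommutativeRing.1# rationals))
  2-unit u = Hom.2-hom P.polynomials rationals F.ι-hom (Hom.2-hom A P.polynomials P.constant-hom u)

-- A[[a₁,a₂,a₃,a₄]]; f e₁ e₂ e₃ e₄ is the coefficient of a₁^e₁ a₂^e₂ a₃^e₃ a₄^e₄ in f.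
module Series₄ (A : Ring₀) where
  open Series using (series; const; const-hom; X)

  series₄ : Ring₀
  series₄ = series (series (series (series A)))

  const₄ : El A → El series₄
  const₄ = const (series (series (series A))) ∘ const (series (series A)) ∘ const (series A) ∘ const A

  a₁ a₂ a₃ a₄ : El series₄
  a₁ = X (series (series (series A)))
  a₂ = const (series (series (series A))) (X (series (series A)))
  a₃ = const (series (series (series A))) (const (series (series A)) (X (series A)))
  a₄ = const (series (series (series A))) (const (series (series A)) (const (series A) (X A)))

  const₄-hom : Hom.IsHom A series₄ const₄
  const₄-hom = hom-∘ {A} {series A} {series₄} (const-hom A)
              (hom-∘ {series A} {series (series A)} {series₄} (const-hom (series A))
              (hom-∘ {series (series A)} {series (series (series A))} {series₄} (const-hom (series (series A)))
              (const-hom (series (series (series A))))))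

  regular-a₁ : Units.Regular series₄ a₁
  regular-a₁ = Series.regular-X (series (series (series A)))

  regular-1-a₁* : ∀ f → let open CommutativeRing series₄ in Units.Regular series₄ (1# - a₁ * f)
  regular-1-a₁* = Series.regular-1-X* (series (series (series A)))

ℚ-ring : Ring₀
ℚ-ring = ℚ.+-*-commutativeRing

module ℚ⟨q⟩ = RationalFunctions ℚ-ring

ℚ⟨q⟩-ring : Ring₀
ℚ⟨q⟩-ring = ℚ⟨q⟩.rationals

module ℚ⟨q,𝐢⟩ = Gaussian ℚ⟨q⟩-ring

module ℚ⟨q,𝐢⟩⟦a⟧ = Series₄ ℚ⟨q,𝐢⟩.gaussian

module Frac = Fractions ℚ⟨q,𝐢⟩⟦a⟧.series₄

-- The field of fractions of ℚ(q)[𝐢][[a₁,a₂,a₃,a₄]].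
𝕃 : Ring₀
𝕃 = Frac.fractions

module K = CommutativeRing ℚ⟨q⟩-ring
module L = CommutativeRing 𝕃

𝐢-unit : Units.Unit 𝕃 (Frac.ι (ℚ⟨q,𝐢⟩⟦a⟧.const₄ ℚ⟨q,𝐢⟩.𝐢))
𝐢-unit = Hom.unit-hom ℚ⟨q,𝐢⟩⟦a⟧.series₄ 𝕃 Frac.ι-hom
  (Hom.unit-hom ℚ⟨q,𝐢⟩.gaussian ℚ⟨q,𝐢⟩⟦a⟧.series₄ ℚ⟨q,𝐢⟩⟦a⟧.const₄-hom ℚ⟨q,𝐢⟩.𝐢-unit)

2-unit : Units.Unit 𝕃 (L.1# L.+ L.1#)
2-unit = Hom.2-hom ℚ⟨q,𝐢⟩⟦a⟧.series₄ 𝕃 Frac.ι-hom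
  (Hom.2-hom ℚ⟨q,𝐢⟩.gaussian ℚ⟨q,𝐢⟩⟦a⟧.series₄ ℚ⟨q,𝐢⟩⟦a⟧.const₄-hom
  (Hom.2-hom ℚ⟨q⟩-ring ℚ⟨q,𝐢⟩.gaussian ℚ⟨q,𝐢⟩.re-hom
  (ℚ⟨q⟩.2-unit (Units.mkUnit ½ ≡.refl))))

-- The parameters 𝐢a₁, 𝐢a₂, 𝐢a₃, 𝐢a₄, with q ∈ ℚ(q).
𝐢a : Parameters 𝕃
𝐢a = ScaledParameters.scaledParameters ℚ⟨q⟩-ring ℚ⟨q,𝐢⟩⟦a⟧.series₄ 𝕃
  (hom-∘ {ℚ⟨q⟩-ring} {ℚ⟨q,𝐢⟩.gaussian} {ℚ⟨q,𝐢⟩⟦a⟧.series₄} ℚ⟨q,𝐢⟩.re-hom ℚ⟨q,𝐢⟩⟦a⟧.const₄-hom)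
  Frac.ι-hom
  ℚ⟨q⟩.q-unit ℚ⟨q⟩.q-adm 2-unit
  (ℚ⟨q,𝐢⟩⟦a⟧.const₄ ℚ⟨q,𝐢⟩.𝐢) ℚ⟨q,𝐢⟩⟦a⟧.a₁ ℚ⟨q,𝐢⟩⟦a⟧.a₂ ℚ⟨q,𝐢⟩⟦a⟧.a₃ ℚ⟨q,𝐢⟩⟦a⟧.a₄
  𝐢-unit (Frac.regular⇒unit ℚ⟨q,𝐢⟩⟦a⟧.regular-a₁)
  (λ t → Frac.regular⇒unit (ℚ⟨q,𝐢⟩⟦a⟧.regular-1-a₁* t))

private
  module EK = Exp K.semiring
  module EL = Exp L.semiring

-- For σ = σ^{AW,H}(𝐢a₁,𝐢a₂,𝐢a₃,𝐢a₄;q), this is σ̃^{AW,H}(a₁,a₂,a₃,a₄;q).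
tilde : (ℕ → ℕ → L.Carrier) → ℕ → ℕ → L.Carrier
tilde σ n k = (L.1# L.+ L.1#) EL.^ (n ∸ k) L.* Units.inv 𝐢-unit EL.^ (n ∸ k) L.* σ n k

Quadruple : Set
Quadruple = Vec ℕ 4

infix 4 _∈𝒯 _≤𝒯_ _≥𝒯_

_∈𝒯 : Quadruple → Set
t ∈𝒯 = (Vec.sum t ℕ.% 2 ≡ 1) × (∀ i j → ∣ lookup t i - lookup t j ∣ ≤ 1)

key : Quadruple → Vec ℤ 4
key (t₁ ∷ t₂ ∷ t₃ ∷ t₄ ∷ []) = + t₄ ∷ + t₃ ∷ + t₂ ∷ ℤ.- + t₁ ∷ []

_≤𝒯_ _≥𝒯_ : Quadruple → Quadruple → Set
t ≤𝒯 s = Lex.Lex-≤ _≡_ ℤ._≤_ (key t) (key s)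
_≥𝒯_ = flip _≤𝒯_

-- A member (T_k, …, T_{n-1}) of 𝒯_{n,k} is an Is𝒯-sequence of length n ∸ k.
Is𝒯-sequence : ∀ {m} → Vec Quadruple m → Set
Is𝒯-sequence Ts = All _∈𝒯 Ts × Linked _≥𝒯_ Ts

total : ∀ {m} → Vec Quadruple m → Quadruple
total = Vec.foldr _ (zipWith ℕ._+_) (replicate 4 0)

-- The division is exact, since Vec.sum T is odd for T ∈𝒯.
‖_‖from_ : ∀ {m} → Vec Quadruple m → ℕ → ℕ
‖ []     ‖from k = 0
‖ T ∷ Ts ‖from k = (k ℕ.* (Vec.sum T ∸ 1)) ℕ./ 2 ℕ.+ ‖ Ts ‖from suc k

-- Lengths of the maximal runs of equal entries.
runs : ∀ {m} → Vec Quadruple m → List ℕ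
runs []       = []
runs (T ∷ Ts) = go 1 T Ts
  where
  go : ∀ {m} → ℕ → Quadruple → Vec Quadruple m → List ℕ
  go r T []        = r ∷ []
  go r T (T′ ∷ Ts) = if does (Vec.≡-dec ℕ._≟_ T T′) then go (suc r) T′ Ts else r ∷ go 1 T′ Ts

_∈𝒯? : Decidable _∈𝒯
t ∈𝒯? = (Vec.sum t ℕ.% 2 ℕ.≟ 1) ×-dec all? λ i → all? λ j → ∣ lookup t i - lookup t j ∣ ℕ.≤? 1

is𝒯-sequence? : ∀ {m} → Decidable (Is𝒯-sequence {m})
is𝒯-sequence? Ts = All.all? _∈𝒯? Ts ×-dec
  Linked.linked? (λ t u → Lex.≤-dec ℤ._≟_ ℤ._≤?_ (key u) (key t)) Ts

box : ∀ {m} → Vec ℕ m → List (Vec ℕ m)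
box []       = [] ∷ []
box (x ∷ xs) = cartesianProductWith _∷_ (upTo (suc x)) (box xs)

words : ∀ {A : Set} m → List A → List (Vec A m)
words zero    as = [] ∷ []
words (suc m) as = cartesianProductWith _∷_ as (words m as)

-- All T in 𝒯_{n,k} with componentwise sum e, each listed once. Since the entries are nonnegative,
-- this forces every entry of T to be componentwise at most e.
𝒯[_,_]withSum_ : (n k : ℕ) → Quadruple → List (Vec Quadruple (n ∸ k))
𝒯[ n , k ]withSum e = filter (λ Ts → is𝒯-sequence? Ts ×-dec Vec.≡-dec ℕ._≟_ (total Ts) e) (words (n ∸ k) (box e))

weight : (n k : ℕ) → Vec Quadruple (n ∸ k) → K.Carrier
weight n k Ts = (ℚ⟨q⟩.q EK.^ (‖ Ts ‖from k)) K.* QSeries.Base.multinomial ℚ⟨q⟩-ring ℚ⟨q⟩.q-unit ℚ⟨q⟩.q-adm n k (runs Ts)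

-- The formal power series ∑ a^{total T} · weight T over all T in 𝒯_{n,k}: the coefficient of
-- a₁^e₁ a₂^e₂ a₃^e₃ a₄^e₄ is the finite sum of the weights of those T with total T = e.
𝒯-series : ℕ → ℕ → (ℕ → ℕ → ℕ → ℕ → K.Carrier)
𝒯-series n k e₁ e₂ e₃ e₄ =
  List.foldr K._+_ K.0# (List.map (weight n k) (𝒯[ n , k ]withSum (e₁ ∷ e₂ ∷ e₃ ∷ e₄ ∷ [])))

-- ℚ(q)[[a₁,a₂,a₃,a₄]] → 𝕃
⌜_⌝ : (ℕ → ℕ → ℕ → ℕ → K.Carrier) → L.Carrier
⌜ f ⌝ = Frac.ι λ e₁ e₂ e₃ e₄ → ℚ⟨q,𝐢⟩.re (f e₁ e₂ e₃ e₄)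

{-# OPTIONS --safe #-}
module Submission where

-- Lower triangular matrices are normalised by [k]!/[n]! and their entries are indexed by k and
-- m = n - k.
--
-- Connection side. In the basis (az, a/z; q)ⱼ of polynomials in x = (z + z⁻¹)/2, setting the parameters
-- d, c, b to zero one after the other multiplies the matrix of the Askey–Wilson polynomials by explicit
-- matrices; each step is one and the same terminating ₆φ₅ sum. The last step, from a to the q-Hermite
-- polynomials, compares three-term recurrences. Evaluation at x = (z + z⁻¹)/2 for z = a, aq, aq², … is
-- triangular, so the connection coefficients are unique and equal to the product of these matrices.
--
-- Combinatorial side. Sorting a sequence by its runs turns the sum over sequences into an ordered product
-- of q-exponentials, one for every T in 𝒯: the factor of T has the entries 1/[m]! times the product of
-- a^T q^(t(|T|-1)/2) over k ≤ t < n. Beyond the four smallest T, the set 𝒯 consists of a block of eight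
-- consecutive members and its translates by (s,s,s,s). By the q-binomial theorem the factors of a block
-- collapse to one matrix, and Cauchy's identity shows that the explicit matrix for d is the infinite
-- product of the blocks. The four smallest T give the matrices for a, b and c.

open import Defs
open import Algebra.Bundles using (CommutativeRing)
import Algebra.Properties.AbelianGroup as AbelianGroupProperties
import Algebra.Properties.CommutativeMonoid.Sum as CMSum
import Algebra.Properties.CommutativeSemiring.Exp as CommutativeExp
import Algebra.Properties.Group as GroupProperties
import Algebra.Properties.Ring as RingProperties
import Algebra.Properties.Semiring.Mult.TCOptimised as Mult
import Algebra.Solver.Ring
open import Algebra.Solver.Ring.AlmostCommutativeRing using (fromCommutativeRing; _-Raw-AlmostCommutative⟶_)
open import Data.Bool.Base using (true; false; if_then_else_)
open import Data.Fin.Base using (Fin; zero; suc; toℕ)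
open import Data.Fin.Patterns using (0F; 1F; 2F; 3F)
open import Data.Fin.Properties using (toℕ<n)
open import Data.Integer.Base as ℤ using (ℤ; +_; -[1+_]; +≤+; _⊖_; _◃_)
import Data.Integer.Properties as ℤ
open import Data.List.Base as List using (List; []; _∷_; _++_; filter; length)
import Data.List.Membership.DecPropositional as DecMembership
open import Data.List.Membership.Propositional using (_∈_; _∉_)
open import Data.List.Membership.Propositional.Properties
  using (∈-++⁻; ∈-++⁺ˡ; ∈-++⁺ʳ; ∈-map⁻; ∈-map⁺; ∈-filter⁺; ∈-filter⁻; ∈-upTo⁺; ∈-cartesianProductWith⁺)
open import Data.List.Membership.Propositional.Properties.WithK using (unique∧set⇒bag)
open import Data.List.Relation.Binary.BagAndSetEquality using (∼bag⇒↭)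
open import Data.List.Relation.Binary.Permutation.Propositional as Permutation using (_↭_)
open import Data.List.Relation.Unary.All as ListAll using ([]; _∷_)
import Data.List.Relation.Unary.All.Properties as ListAll
open import Data.List.Relation.Unary.AllPairs using (AllPairs; []; _∷_)
open import Data.List.Relation.Unary.Any using (here; there)
open import Data.List.Relation.Unary.Linked as ListLinked using ([-]; _∷_)
open import Data.List.Relation.Unary.Linked.Properties using (Linked⇒AllPairs)
open import Data.List.Relation.Unary.Unique.Propositional using (Unique)
import Data.List.Relation.Unary.Unique.Propositional.Properties as Unique
open import Data.Maybe.Base using (Maybe; map)
open import Data.Nat.Base as ℕ using (ℕ; zero; suc; _∸_; _≤_; _<_; z≤n; s≤s; ∣_-_∣)
open import Data.Nat.Combinatorics using (_C_; nCk+nC[k+1]≡[n+1]C[k+1]; nC1≡n)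
import Data.Nat.DivMod as ℕ
open import Data.Nat.Induction using (<-rec)
import Data.Nat.Properties as ℕ
open import Data.Nat.Tactic.RingSolver using (solve-∀)
open import Data.Product.Base using (Σ; Σ-syntax; _×_; _,_; proj₁; proj₂)
import Data.Sign.Base as Sign
open import Data.Sum.Base using (inj₁; inj₂)
open import Data.Vec.Base as Vec using (Vec; []; _∷_; lookup; zipWith; replicate)
import Data.Vec.Properties as Vec
import Data.Vec.Relation.Binary.Lex.Core as LexCore
import Data.Vec.Relation.Binary.Lex.NonStrict as Lex
import Data.Vec.Relation.Binary.Pointwise.Inductive as Pointwise
open import Data.Vec.Relation.Unary.All as All using (All; []; _∷_)
open import Data.Vec.Relation.Unary.Linked as Linked using (Linked; []; [-]; _∷_)
open import Function.Base using (_∘_)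
open import Function.Bundles using (mk⇔)
open import Relation.Binary.Consequences using (dec⇒weaklyDec)
open import Relation.Binary.Definitions using (Transitive; tri<; tri≈; tri>)
open import Relation.Binary.PropositionalEquality.Core as ≡ using (_≡_; _≢_)
import Relation.Binary.Reasoning.Setoid as SetoidReasoning
open import Relation.Nullary.Decidable using (does; yes; no; dec-true; dec-false; toWitness; _→-dec_; _×-dec_)
open import Relation.Nullary.Negation.Core using (¬_; contradiction)
open import Relation.Unary using (Decidable)

-- The factor [k]!/[n]! turns the multinomial into the product of 1/[m]! over the runs, so a run of
-- equal letters is one entry of a q-exponential and a word is one term of a product of kernels. The
-- q-binomial theorem can only merge neighbouring factors, and this explains the order: the sign of
-- t₁ matters only between (s-1,s,s,s) and (s+1,s,s,s), and with it letters of ratio a₁a₂qᵗ stand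
-- side by side. The factors 1 + a₁a₂qᵗ so obtained are the 1 - abqᵗ of the connection side with a =
-- 𝐢a₁ and b = 𝐢a₂. No limit is formed: after M blocks the remaining factor has unit diagonal, and
-- its other entries are multiples of a₁^M, invisible to coefficients with a smaller exponent of a₁.
-- The Askey-Wilson basis and the evaluation points need a⁻¹, hence the ring of fractions. The final
-- matrices are free of a⁻¹, and 1 - a₁f is invertible among power series already, so they are
-- compared there, coefficient by coefficient.

-- Ring calculations and sums over antidiagonals

module IntegerSolver (A : Ring₀) where
  open CommutativeRing A
  open RingProperties ring
  open AbelianGroupProperties +-abelianGroup using (⁻¹-∙-comm)
  open Mult semiring using (×-homo-+; ×1-homo-*) renaming (_×_ to _·_)
  open SetoidReasoning setoid

  private
    -- The optimised multiple `1 · x` computes to `x`, so that `con (+ 1)` evaluates to the unit of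
    -- the ring itself and goals match without rewriting.
    ⟦_⟧ : ℤ → Carrier
    ⟦ + n ⟧      = n · 1#
    ⟦ -[1+ n ] ⟧ = - (suc n · 1#)

    ⟦⟧-neg : ∀ i → ⟦ ℤ.- i ⟧ ≈ - ⟦ i ⟧
    ⟦⟧-neg (+ zero)   = sym -0#≈0#
    ⟦⟧-neg (+ suc n)  = refl
    ⟦⟧-neg -[1+ n ]   = sym (-‿involutive _)

    ⟦⟧-⊖ : ∀ m n → ⟦ m ⊖ n ⟧ ≈ m · 1# - n · 1#
    ⟦⟧-⊖ m zero = sym (trans (+-congˡ -0#≈0#) (+-identityʳ _))
    ⟦⟧-⊖ zero (suc n) = sym (+-identityˡ _)
    ⟦⟧-⊖ (suc m) (suc n) = begin
      ⟦ suc m ⊖ suc n ⟧                     ≡⟨ ≡.cong ⟦_⟧ (ℤ.[1+m]⊖[1+n]≡m⊖n m n) ⟩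
      ⟦ m ⊖ n ⟧                             ≈⟨ ⟦⟧-⊖ m n ⟩
      m · 1# - n · 1#                       ≈⟨ +-congʳ (trans (sym (+-identityˡ _)) (+-congʳ (sym (-‿inverseʳ 1#)))) ⟩
      1# - 1# + m · 1# - n · 1#             ≈⟨ +-congʳ (trans (+-assoc _ _ _) (trans (+-congˡ (+-comm _ _)) (sym (+-assoc _ _ _)))) ⟩
      1# + m · 1# - 1# - n · 1#             ≈⟨ trans (+-assoc _ _ _) (+-congˡ (⁻¹-∙-comm _ _)) ⟩
      1# + m · 1# - (1# + n · 1#)           ≈⟨ +-cong (×-homo-+ 1# 1 m) (-‿cong (×-homo-+ 1# 1 n)) ⟨
      suc m · 1# - suc n · 1#               ∎

    ⟦⟧-+ : ∀ i j → ⟦ i ℤ.+ j ⟧ ≈ ⟦ i ⟧ + ⟦ j ⟧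
    ⟦⟧-+ (+ m)    (+ n)    = ×-homo-+ 1# m n
    ⟦⟧-+ (+ m)    -[1+ n ] = ⟦⟧-⊖ m (suc n)
    ⟦⟧-+ -[1+ m ] (+ n)    = trans (⟦⟧-⊖ n (suc m)) (+-comm _ _)
    ⟦⟧-+ -[1+ m ] -[1+ n ] = begin
      - (suc (suc (m ℕ.+ n)) · 1#)       ≡⟨ ≡.cong (λ l → - (suc l · 1#)) (ℕ.+-suc m n) ⟨
      - ((suc m ℕ.+ suc n) · 1#)         ≈⟨ -‿cong (×-homo-+ 1# (suc m) (suc n)) ⟩
      - (suc m · 1# + suc n · 1#)        ≈⟨ ⁻¹-∙-comm _ _ ⟨
      - (suc m · 1#) - (suc n · 1#)      ∎

    ⟦⟧-neg-◃ : ∀ n → ⟦ Sign.- ◃ n ⟧ ≈ - (n · 1#)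
    ⟦⟧-neg-◃ zero    = sym -0#≈0#
    ⟦⟧-neg-◃ (suc n) = refl

    ⟦⟧-pos-◃ : ∀ n → ⟦ Sign.+ ◃ n ⟧ ≈ n · 1#
    ⟦⟧-pos-◃ zero    = refl
    ⟦⟧-pos-◃ (suc n) = refl

    ⟦⟧-* : ∀ i j → ⟦ i ℤ.* j ⟧ ≈ ⟦ i ⟧ * ⟦ j ⟧
    ⟦⟧-* (+ m)    (+ n)    = trans (⟦⟧-pos-◃ (m ℕ.* n)) (×1-homo-* m n)
    ⟦⟧-* (+ m)    -[1+ n ] = trans (⟦⟧-neg-◃ (m ℕ.* suc n)) (trans (-‿cong (×1-homo-* m (suc n))) (-‿distribʳ-* _ _))
    ⟦⟧-* -[1+ m ] (+ n)    = trans (⟦⟧-neg-◃ (suc m ℕ.* n)) (trans (-‿cong (×1-homo-* (suc m) n)) (-‿distribˡ-* _ _))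
    ⟦⟧-* -[1+ m ] -[1+ n ] = trans (⟦⟧-pos-◃ (suc m ℕ.* suc n)) (trans (×1-homo-* (suc m) (suc n)) (sym (-x*-y≈xy _ _)))
      where
      -x*-y≈xy : ∀ x y → (- x) * (- y) ≈ x * y
      -x*-y≈xy x y = trans (sym (-‿distribˡ-* x (- y))) (trans (-‿cong (sym (-‿distribʳ-* x y))) (-‿involutive _))

    homomorphism : CommutativeRing.rawRing ℤ.+-*-commutativeRing -Raw-AlmostCommutative⟶ fromCommutativeRing A
    homomorphism = record
      { ⟦_⟧    = ⟦_⟧
      ; +-homo = ⟦⟧-+
      ; *-homo = ⟦⟧-*
      ; -‿homo = ⟦⟧-neg
      ; 0-homo = refl
      ; 1-homo = refl
      }

    _≟_ : ∀ i j → Maybe (⟦ i ⟧ ≈ ⟦ j ⟧)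
    i ≟ j = map (λ { ≡.refl → refl }) (dec⇒weaklyDec ℤ._≟_ i j)

  open Algebra.Solver.Ring _ _ homomorphism _≟_ public

module Antidiagonal (A : Ring₀) where
  open CommutativeRing A
  open SetoidReasoning setoid
  open IntegerSolver A using (solve; _:=_; _:+_)

  -- The sum of h i j over i + j = m.
  ∑₊ : (ℕ → ℕ → Carrier) → ℕ → Carrier
  ∑₊ h zero    = h 0 0
  ∑₊ h (suc m) = h 0 (suc m) + ∑₊ (h ∘ suc) m

  ∑₊-cong′ : ∀ {h h′} m → (∀ i j → i ℕ.+ j ≡ m → h i j ≈ h′ i j) → ∑₊ h m ≈ ∑₊ h′ m
  ∑₊-cong′ zero    p = p 0 0 ≡.refl
  ∑₊-cong′ (suc m) p = +-cong (p 0 (suc m) ≡.refl) (∑₊-cong′ m λ i j eq → p (suc i) j (≡.cong suc eq))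

  ∑₊-cong : ∀ {h h′} → (∀ i j → h i j ≈ h′ i j) → ∀ m → ∑₊ h m ≈ ∑₊ h′ m
  ∑₊-cong p m = ∑₊-cong′ m λ i j _ → p i j

  ∑₊-+ : ∀ h h′ m → ∑₊ (λ i j → h i j + h′ i j) m ≈ ∑₊ h m + ∑₊ h′ m
  ∑₊-+ h h′ zero    = refl
  ∑₊-+ h h′ (suc m) = trans (+-congˡ (∑₊-+ (h ∘ suc) (h′ ∘ suc) m))
    (solve 4 (λ a b c d → (a :+ b) :+ (c :+ d) := (a :+ c) :+ (b :+ d)) refl _ _ _ _)

  ∑₊-*ˡ : ∀ x h m → ∑₊ (λ i j → x * h i j) m ≈ x * ∑₊ h m
  ∑₊-*ˡ x h zero    = refl
  ∑₊-*ˡ x h (suc m) = trans (+-congˡ (∑₊-*ˡ x (h ∘ suc) m)) (sym (distribˡ _ _ _))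

  ∑₊-*ʳ : ∀ x h m → ∑₊ (λ i j → h i j * x) m ≈ ∑₊ h m * x
  ∑₊-*ʳ x h m = trans (∑₊-cong (λ i j → *-comm _ _) m) (trans (∑₊-*ˡ x h m) (*-comm _ _))

  ∑₊-0 : ∀ {h} m → (∀ i j → i ℕ.+ j ≡ m → h i j ≈ 0#) → ∑₊ h m ≈ 0#
  ∑₊-0 zero    p = p 0 0 ≡.refl
  ∑₊-0 (suc m) p = trans (+-cong (p 0 (suc m) ≡.refl) (∑₊-0 m λ i j eq → p (suc i) j (≡.cong suc eq))) (+-identityˡ 0#)

  ∑₊-sucʳ : ∀ h m → ∑₊ h (suc m) ≈ ∑₊ (λ i j → h i (suc j)) m + h (suc m) 0
  ∑₊-sucʳ h zero    = refl
  ∑₊-sucʳ h (suc m) = trans (+-congˡ (∑₊-sucʳ (h ∘ suc) m)) (sym (+-assoc _ _ _))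

  ∑₊-assoc : ∀ (h : ℕ → ℕ → ℕ → Carrier) m →
    ∑₊ (λ l j → ∑₊ (λ a b → h a b j) l) m ≈ ∑₊ (λ a l → ∑₊ (h a) l) m
  ∑₊-assoc h zero    = refl
  ∑₊-assoc h (suc m) = begin
    h 0 0 (suc m) + ∑₊ (λ l j → h 0 (suc l) j + ∑₊ (λ a b → h (suc a) b j) l) m
      ≈⟨ +-congˡ (∑₊-+ (λ l j → h 0 (suc l) j) (λ l j → ∑₊ (λ a b → h (suc a) b j) l) m) ⟩
    h 0 0 (suc m) + (∑₊ (λ l j → h 0 (suc l) j) m + ∑₊ (λ l j → ∑₊ (λ a b → h (suc a) b j) l) m)
      ≈⟨ +-assoc _ _ _ ⟨
    ∑₊ (h 0) (suc m) + ∑₊ (λ l j → ∑₊ (λ a b → h (suc a) b j) l) m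
      ≈⟨ +-congˡ (∑₊-assoc (h ∘ suc) m) ⟩
    ∑₊ (h 0) (suc m) + ∑₊ (λ a l → ∑₊ (h (suc a)) l) m ∎

  -- Pascal-type recursions are proved by splitting each term so that one part vanishes for
  -- i = 0 and the other for j = 0.
  ∑₊-split : ∀ {h} x y m → (∀ i j → i ℕ.+ j ≡ suc m → h i j ≈ x i j + y i j) →
    x 0 (suc m) ≈ 0# → y (suc m) 0 ≈ 0# →
    ∑₊ h (suc m) ≈ ∑₊ (λ i j → x (suc i) j) m + ∑₊ (λ i j → y i (suc j)) m
  ∑₊-split {h} x y m p x₀ y₀ = begin
    ∑₊ h (suc m)                          ≈⟨ ∑₊-cong′ (suc m) p ⟩
    ∑₊ (λ i j → x i j + y i j) (suc m)    ≈⟨ ∑₊-+ x y (suc m) ⟩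
    ∑₊ x (suc m) + ∑₊ y (suc m)           ≈⟨ +-cong (trans (+-congʳ x₀) (+-identityˡ _))
                                               (trans (∑₊-sucʳ y m) (trans (+-congˡ y₀) (+-identityʳ _))) ⟩
    ∑₊ (λ i j → x (suc i) j) m + ∑₊ (λ i j → y i (suc j)) m ∎

-- Lower triangular matrices as kernels

-- A kernel f stands for the lower triangular matrix whose entry in row k + m and column k is f k m.
module Kernels (A : Ring₀) where
  open CommutativeRing A
  open CommutativeExp commutativeSemiring using (_^_)
  open SetoidReasoning setoid
  open IntegerSolver A using (solve; _:=_; _:*_)
  open Antidiagonal A public
  open CMSum *-commutativeMonoid using () renaming (sum to ∏)

  Kernel : Set
  Kernel = ℕ → ℕ → Carrier

  infix 4 _≐_
  _≐_ : Kernel → Kernel → Set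
  f ≐ g = ∀ k m → f k m ≈ g k m

  ≐-sym : ∀ {f g} → f ≐ g → g ≐ f
  ≐-sym p k m = sym (p k m)

  infixr 4 _≐∙_
  _≐∙_ : ∀ {f g h} → f ≐ g → g ≐ h → f ≐ h
  (p ≐∙ r) k m = trans (p k m) (r k m)

  infixl 6 _⋆_
  -- For the matrices this is the product in reverse order: `f` leads from `k` to `k + i`, and `g`
  -- from there to `k + m`.
  _⋆_ : Kernel → Kernel → Kernel
  (f ⋆ g) k m = ∑₊ (λ i j → f k i * g (k ℕ.+ i) j) m

  ⋆-cong : ∀ {f f′ g g′} → f ≐ f′ → g ≐ g′ → f ⋆ g ≐ f′ ⋆ g′
  ⋆-cong p r k = ∑₊-cong λ i j → *-cong (p k i) (r (k ℕ.+ i) j)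

  ⋆-congˡ : ∀ f {g g′} → g ≐ g′ → f ⋆ g ≐ f ⋆ g′
  ⋆-congˡ f p k = ∑₊-cong λ i j → *-congˡ (p (k ℕ.+ i) j)

  ⋆-congʳ : ∀ g {f f′} → f ≐ f′ → f ⋆ g ≐ f′ ⋆ g
  ⋆-congʳ g p k = ∑₊-cong λ i j → *-congʳ (p k i)

  ⋆-assoc : ∀ f g h → (f ⋆ g) ⋆ h ≐ f ⋆ (g ⋆ h)
  ⋆-assoc f g h k m = begin
    ∑₊ (λ l j → ∑₊ (λ a b → f k a * g (k ℕ.+ a) b) l * h (k ℕ.+ l) j) m
      ≈⟨ ∑₊-cong (λ l j → sym (∑₊-*ʳ _ _ l)) m ⟩
    ∑₊ (λ l j → ∑₊ (λ a b → f k a * g (k ℕ.+ a) b * h (k ℕ.+ l) j) l) m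
      ≈⟨ ∑₊-cong (λ l j → ∑₊-cong′ l λ { a b ≡.refl → trans (*-assoc _ _ _)
           (*-congˡ (*-congˡ (reflexive (≡.cong (λ s → h s j) (≡.sym (ℕ.+-assoc k a b)))))) }) m ⟩
    ∑₊ (λ l j → ∑₊ (λ a b → f k a * (g (k ℕ.+ a) b * h (k ℕ.+ a ℕ.+ b) j)) l) m
      ≈⟨ ∑₊-assoc (λ a b j → f k a * (g (k ℕ.+ a) b * h (k ℕ.+ a ℕ.+ b) j)) m ⟩
    ∑₊ (λ a l → ∑₊ (λ b j → f k a * (g (k ℕ.+ a) b * h (k ℕ.+ a ℕ.+ b) j)) l) m
      ≈⟨ ∑₊-cong (λ a l → ∑₊-*ˡ _ _ l) m ⟩
    ∑₊ (λ a l → f k a * ∑₊ (λ b j → g (k ℕ.+ a) b * h (k ℕ.+ a ℕ.+ b) j) l) m ∎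

  𝟙 : Kernel
  𝟙 k zero    = 1#
  𝟙 k (suc m) = 0#

  ⋆-identityʳ : ∀ f → f ⋆ 𝟙 ≐ f
  ⋆-identityʳ f k zero    = *-identityʳ _
  ⋆-identityʳ f k (suc m) = begin
    ∑₊ (λ i j → f k i * 𝟙 (k ℕ.+ i) j) (suc m)
      ≈⟨ ∑₊-sucʳ (λ i j → f k i * 𝟙 (k ℕ.+ i) j) m ⟩
    ∑₊ (λ i j → f k i * 0#) m + f k (suc m) * 1#
      ≈⟨ +-cong (∑₊-0 m λ i j _ → zeroʳ _) (*-identityʳ _) ⟩
    0# + f k (suc m)
      ≈⟨ +-identityˡ _ ⟩
    f k (suc m) ∎

  -- The product of g t over k ≤ t < k + m.
  Π : (ℕ → Carrier) → ℕ → ℕ → Carrier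
  Π g k zero    = 1#
  Π g k (suc m) = g k * Π g (suc k) m

  Π-cong : ∀ {g g′} → (∀ t → g t ≈ g′ t) → ∀ k m → Π g k m ≈ Π g′ k m
  Π-cong p k zero    = refl
  Π-cong p k (suc m) = *-cong (p k) (Π-cong p (suc k) m)

  Π-* : ∀ g h k m → Π (λ t → g t * h t) k m ≈ Π g k m * Π h k m
  Π-* g h k zero    = sym (*-identityˡ 1#)
  Π-* g h k (suc m) = trans (*-congˡ (Π-* g h (suc k) m))
    (solve 4 (λ a b c d → (a :* b) :* (c :* d) := (a :* c) :* (b :* d)) refl _ _ _ _)

  Π-+ : ∀ g k i j → Π g k (i ℕ.+ j) ≈ Π g k i * Π g (k ℕ.+ i) j
  Π-+ g k zero j = trans (sym (*-identityˡ _)) (*-congˡ (reflexive (≡.cong (λ s → Π g s j) (≡.sym (ℕ.+-identityʳ k)))))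
  Π-+ g k (suc i) j = begin
    g k * Π g (suc k) (i ℕ.+ j)                    ≈⟨ *-congˡ (Π-+ g (suc k) i j) ⟩
    g k * (Π g (suc k) i * Π g (suc k ℕ.+ i) j)    ≈⟨ *-assoc _ _ _ ⟨
    g k * Π g (suc k) i * Π g (suc k ℕ.+ i) j      ≡⟨ ≡.cong (λ s → g k * Π g (suc k) i * Π g s j) (ℕ.+-suc k i) ⟨
    g k * Π g (suc k) i * Π g (k ℕ.+ suc i) j      ∎

  Π-sucʳ : ∀ g k m → Π g k (suc m) ≈ Π g k m * g (k ℕ.+ m)
  Π-sucʳ g k m = begin
    Π g k (suc m)                    ≡⟨ ≡.cong (Π g k) (ℕ.+-comm 1 m) ⟩
    Π g k (m ℕ.+ 1)                  ≈⟨ Π-+ g k m 1 ⟩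
    Π g k m * (g (k ℕ.+ m) * 1#)     ≈⟨ *-congˡ (*-identityʳ _) ⟩
    Π g k m * g (k ℕ.+ m)            ∎

  Π-1 : ∀ k m → Π (λ _ → 1#) k m ≈ 1#
  Π-1 k zero    = refl
  Π-1 k (suc m) = trans (*-identityˡ _) (Π-1 (suc k) m)

  Π-inverse : ∀ {g h} → (∀ t → g t * h t ≈ 1#) → ∀ k m → Π g k m * Π h k m ≈ 1#
  Π-inverse p k m = trans (sym (Π-* _ _ k m)) (trans (Π-cong p k m) (Π-1 k m))

  Π-const : ∀ x k m → Π (λ _ → x) k m ≈ x ^ m
  Π-const x k zero    = refl
  Π-const x k (suc m) = *-congˡ (Π-const x (suc k) m)

  ^-inverse : ∀ {x y} → x * y ≈ 1# → ∀ m → x ^ m * y ^ m ≈ 1#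
  ^-inverse {x} {y} p m = trans (*-cong (sym (Π-const x 0 m)) (sym (Π-const y 0 m))) (Π-inverse (λ _ → p) 0 m)

  Π-shift : ∀ g s k m → Π (λ t → g (s ℕ.+ t)) k m ≈ Π g (s ℕ.+ k) m
  Π-shift g s k zero    = refl
  Π-shift g s k (suc m) = *-congˡ (trans (Π-shift g s (suc k) m) (reflexive (≡.cong (λ t → Π g t m) (ℕ.+-suc s k))))

  ∏-Π : ∀ n g → ∏ {n} (λ i → g (toℕ i)) ≈ Π g 0 n
  ∏-Π zero    g = refl
  ∏-Π (suc n) g = *-congˡ (trans (∏-Π n (g ∘ suc)) (Π-shift g 1 0 n))

  Π-geometric : ∀ {g x} → (∀ t → g (suc t) ≈ x * g t) → ∀ k m → Π g (suc k) m ≈ x ^ m * Π g k m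
  Π-geometric p k zero    = sym (*-identityˡ 1#)
  Π-geometric {g} {x} p k (suc m) = trans (*-cong (p k) (Π-geometric p (suc k) m))
    (solve 4 (λ x g y z → (x :* g) :* (y :* z) := (x :* y) :* (g :* z)) refl x (g k) (x ^ m) _)

  infixr 7 _⊙_
  -- For invertible `g` this is conjugation by the diagonal matrix with entries `Π g 0 k`, which is
  -- why it distributes over `⋆`.
  _⊙_ : (ℕ → Carrier) → Kernel → Kernel
  (g ⊙ f) k m = Π g k m * f k m

  ⊙-congˡ : ∀ {g f f′} → f ≐ f′ → g ⊙ f ≐ g ⊙ f′
  ⊙-congˡ p k m = *-congˡ (p k m)

  ⊙-congʳ : ∀ {g g′ f} → (∀ t → g t ≈ g′ t) → g ⊙ f ≐ g′ ⊙ f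
  ⊙-congʳ p k m = *-congʳ (Π-cong p k m)

  ⊙-⊙ : ∀ g h f → g ⊙ (h ⊙ f) ≐ (λ t → g t * h t) ⊙ f
  ⊙-⊙ g h f k m = trans (sym (*-assoc _ _ _)) (*-congʳ (sym (Π-* g h k m)))

  ⊙-⋆ : ∀ g f h → g ⊙ (f ⋆ h) ≐ g ⊙ f ⋆ g ⊙ h
  ⊙-⋆ g f h k m = trans (sym (∑₊-*ˡ _ _ m)) (∑₊-cong′ m λ { i j ≡.refl →
    trans (*-congʳ (Π-+ g k i j))
      (solve 4 (λ a b c d → (a :* b) :* (c :* d) := (a :* c) :* (b :* d)) refl _ _ _ _) })

-- q-factorials and the three summation identities

-- Only equations and units are recorded, so the structure can be carried along any ring
-- homomorphism.
record QFactorials (A : Ring₀) (q : El A) : Set where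
  open CommutativeRing A
  open CommutativeExp commutativeSemiring using (_^_)
  open Units A
  field
    1-q⁻¹ : Carrier
    1-q-inverse : (1# - q) * 1-q⁻¹ ≈ 1#

  [_] : ℕ → Carrier
  [ i ] = (1# - q ^ i) * 1-q⁻¹

  field
    1/_!      : ℕ → Carrier
    1/0!      : 1/ 0 ! ≈ 1#
    [suc]*1/! : ∀ i → [ suc i ] * 1/ suc i ! ≈ 1/ i !
    [suc]-unit : ∀ i → Unit [ suc i ]

module Identities {A : Ring₀} {q : El A} (Q : QFactorials A q) where
  open CommutativeRing A
  open CommutativeExp commutativeSemiring using (_^_; ^-homo-*)
  open Units A using (Unit; mkUnit)
  open SetoidReasoning setoid
  open IntegerSolver A using (solve; con; _:=_; _:+_; _:*_; _:-_; :-_)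
  open Kernels A public
  open QFactorials Q public

  unit-cancel : ∀ {x y z} → Unit x → x * y ≈ x * z → y ≈ z
  unit-cancel {x} {y} {z} (mkUnit x⁻¹ p) xy≈xz = begin
    y               ≈⟨ trans (*-congʳ p) (*-identityˡ y) ⟨
    x * x⁻¹ * y     ≈⟨ solve 3 (λ x x⁻¹ y → x :* x⁻¹ :* y := x⁻¹ :* (x :* y)) refl x x⁻¹ y ⟩
    x⁻¹ * (x * y)   ≈⟨ *-congˡ xy≈xz ⟩
    x⁻¹ * (x * z)   ≈⟨ solve 3 (λ x x⁻¹ y → x :* x⁻¹ :* y := x⁻¹ :* (x :* y)) refl x x⁻¹ z ⟨
    x * x⁻¹ * z     ≈⟨ trans (*-congʳ p) (*-identityˡ z) ⟩
    z               ∎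

  [0] : [ 0 ] ≈ 0#
  [0] = solve 1 (λ c → (con (+ 1) :- con (+ 1)) :* c := con (+ 0)) refl _

  [+] : ∀ i j → [ i ℕ.+ j ] ≈ [ i ] + q ^ i * [ j ]
  [+] i j = trans (*-congʳ (+-congˡ (-‿cong (^-homo-* q i j))))
    (solve 3 (λ x y c → (con (+ 1) :- x :* y) :* c := (con (+ 1) :- x) :* c :+ x :* ((con (+ 1) :- y) :* c)) refl _ _ _)

  [+]-cong : ∀ i j {m} → i ℕ.+ j ≡ m → [ m ] ≈ [ i ] + q ^ i * [ j ]
  [+]-cong i j ≡.refl = [+] i j

  [1-q]*[] : ∀ i → (1# - q) * [ i ] ≈ 1# - q ^ i
  [1-q]*[] i = begin
    (1# - q) * ((1# - q ^ i) * 1-q⁻¹) ≈⟨ solve 3 (λ a b c → a :* (b :* c) := b :* (a :* c)) refl _ _ _ ⟩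
    (1# - q ^ i) * ((1# - q) * 1-q⁻¹) ≈⟨ trans (*-congˡ 1-q-inverse) (*-identityʳ _) ⟩
    1# - q ^ i ∎

  e : Kernel
  e k m = 1/ m !

  -- The splitting `[i + j] = [i] + qⁱ[j]` drives the inductions below: multiplied into a factorial,
  -- each part lowers one of the two indices.
  ∑₊-[] : ∀ h m → [ suc m ] * ∑₊ h (suc m) ≈
    ∑₊ (λ i j → [ suc i ] * h (suc i) j) m + ∑₊ (λ i j → q ^ i * [ suc j ] * h i (suc j)) m
  ∑₊-[] h m = trans (sym (∑₊-*ˡ _ h (suc m)))
    (∑₊-split (λ i j → [ i ] * h i j) (λ i j → q ^ i * [ j ] * h i j) m
      (λ i j eq → trans (*-congʳ ([+]-cong i j eq)) (distribʳ _ _ _))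
      (trans (*-congʳ [0]) (zeroˡ _))
      (trans (*-congʳ (trans (*-congˡ [0]) (zeroʳ _))) (zeroˡ _)))

  -- Multiplication by `[m + 1]` lowers `i` in one half of the sum and `j` in the other. The first
  -- half releases the factor `g k`; in the second, `qⁱ` moves `Π g k i` to base `k + 1`, because
  -- `g` is geometric. Both halves are then the sum for `k + 1` and `m`.
  q-binomial : ∀ {g} → (∀ t → g (suc t) ≈ q * g t) → g ⊙ e ⋆ e ≐ (λ t → 1# + g t) ⊙ e
  q-binomial {g} p k zero = *-congʳ (trans (*-congˡ 1/0!) (*-identityʳ _))
  q-binomial {g} p k (suc m) = unit-cancel ([suc]-unit m) (begin
    [ suc m ] * (g ⊙ e ⋆ e) k (suc m)
      ≈⟨ ∑₊-[] (λ i j → Π g k i * 1/ i ! * 1/ j !) m ⟩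
    ∑₊ (λ i j → [ suc i ] * (g k * Π g (suc k) i * 1/ suc i ! * 1/ j !)) m +
    ∑₊ (λ i j → q ^ i * [ suc j ] * (Π g k i * 1/ i ! * 1/ suc j !)) m
      ≈⟨ +-cong (∑₊-cong raise m) (∑₊-cong keep m) ⟩
    ∑₊ (λ i j → g k * (Π g (suc k) i * 1/ i ! * 1/ j !)) m + (g ⊙ e ⋆ e) (suc k) m
      ≈⟨ +-congʳ (∑₊-*ˡ _ _ m) ⟩
    g k * (g ⊙ e ⋆ e) (suc k) m + (g ⊙ e ⋆ e) (suc k) m
      ≈⟨ solve 2 (λ g x → g :* x :+ x := (con (+ 1) :+ g) :* x) refl _ _ ⟩
    (1# + g k) * (g ⊙ e ⋆ e) (suc k) m
      ≈⟨ *-congˡ (q-binomial p (suc k) m) ⟩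
    (1# + g k) * (Π (λ t → 1# + g t) (suc k) m * 1/ m !)
      ≈⟨ *-congˡ (*-congˡ ([suc]*1/! m)) ⟨
    (1# + g k) * (Π (λ t → 1# + g t) (suc k) m * ([ suc m ] * 1/ suc m !))
      ≈⟨ solve 4 (λ a b c d → a :* (b :* (c :* d)) := c :* (a :* b :* d)) refl _ _ _ _ ⟩
    [ suc m ] * ((1# + g k) * Π (λ t → 1# + g t) (suc k) m * 1/ suc m !) ∎)
    where
    raise : ∀ i j → [ suc i ] * (g k * Π g (suc k) i * 1/ suc i ! * 1/ j !) ≈ g k * (Π g (suc k) i * 1/ i ! * 1/ j !)
    raise i j = trans
      (solve 5 (λ a g x f y → a :* (g :* x :* f :* y) := g :* (x :* (a :* f) :* y)) refl _ _ _ _ _)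
      (*-congˡ (*-congʳ (*-congˡ ([suc]*1/! i))))
    keep : ∀ i j → q ^ i * [ suc j ] * (Π g k i * 1/ i ! * 1/ suc j !) ≈ Π g (suc k) i * 1/ i ! * 1/ j !
    keep i j = trans
      (solve 5 (λ x a y f z → x :* a :* (y :* f :* z) := (x :* y) :* f :* (a :* z)) refl _ _ _ _ _)
      (*-cong (*-congʳ (sym (Π-geometric p k i))) ([suc]*1/! j))

  -- Cauchy's identity ∑ [m i] yⁱ q^(i(i-1)) / (y;q)ᵢ = 1 / (y;q)ₘ, where α s is y and αα s i is yⁱ q^(i(i-1)).
  αα : (ℕ → Carrier) → ℕ → ℕ → Carrier
  αα α s zero    = 1#
  αα α s (suc i) = α s * αα α (suc (suc s)) i

  αα-suc : ∀ {α} → (∀ t → α (suc t) ≈ q * α t) → ∀ s i → αα α (suc s) i ≈ q ^ i * αα α s i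
  αα-suc p s zero    = sym (*-identityˡ 1#)
  αα-suc {α} p s (suc i) = trans (*-cong (p s) (αα-suc p (suc (suc s)) i))
    (solve 4 (λ x g y z → (x :* g) :* (y :* z) := (x :* y) :* (g :* z)) refl q (α s) (q ^ i) _)

  geometric : ∀ {g x} → (∀ t → g (suc t) ≈ x * g t) → ∀ s i → g (s ℕ.+ i) ≈ x ^ i * g s
  geometric {g} p s zero = trans (reflexive (≡.cong g (ℕ.+-identityʳ s))) (sym (*-identityˡ _))
  geometric {g} {x} p s (suc i) = begin
    g (s ℕ.+ suc i)       ≡⟨ ≡.cong g (ℕ.+-suc s i) ⟩
    g (suc (s ℕ.+ i))     ≈⟨ p _ ⟩
    x * g (s ℕ.+ i)       ≈⟨ *-congˡ (geometric p s i) ⟩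
    x * (x ^ i * g s)     ≈⟨ *-assoc _ _ _ ⟨
    x ^ suc i * g s       ∎

  module _ {α r : ℕ → Carrier} (α-suc : ∀ t → α (suc t) ≈ q * α t) (r-inverse : ∀ t → (1# - α t) * r t ≈ 1#) where

    -- Both halves of the split sum become the sum at base `s + 1`, term by term with weights
    -- `α (s + i)` and `1 - α (s + i)`, which add up to 1. The second weight arises when the product
    -- of the `r` is moved from base `s` to base `s + 1`.
    cauchy : ∀ s m → ∑₊ (λ i j → αα α s i * Π r s i * 1/ i ! * 1/ j !) m ≈ Π r s m * 1/ m !
    cauchy s zero = trans (*-congˡ 1/0!) (trans (*-identityʳ _) (*-congʳ (*-identityˡ _)))
    cauchy s (suc m) = unit-cancel ([suc]-unit m) (begin
      [ suc m ] * ∑₊ (λ i j → αα α s i * Π r s i * 1/ i ! * 1/ j !) (suc m)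
        ≈⟨ ∑₊-[] (λ i j → αα α s i * Π r s i * 1/ i ! * 1/ j !) m ⟩
      ∑₊ (λ i j → [ suc i ] * (α s * αα α (suc (suc s)) i * (r s * Π r (suc s) i) * 1/ suc i ! * 1/ j !)) m +
      ∑₊ (λ i j → q ^ i * [ suc j ] * (αα α s i * Π r s i * 1/ i ! * 1/ suc j !)) m
        ≈⟨ +-cong (∑₊-cong raise m) (∑₊-cong keep m) ⟩
      ∑₊ (λ i j → α (s ℕ.+ i) * (r s * t i j)) m + ∑₊ (λ i j → (1# - α (s ℕ.+ i)) * (r s * t i j)) m
        ≈⟨ ∑₊-+ _ _ m ⟨
      ∑₊ (λ i j → α (s ℕ.+ i) * (r s * t i j) + (1# - α (s ℕ.+ i)) * (r s * t i j)) m
        ≈⟨ ∑₊-cong (λ i j → solve 2 (λ a x → a :* x :+ (con (+ 1) :- a) :* x := x) refl _ _) m ⟩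
      ∑₊ (λ i j → r s * t i j) m
        ≈⟨ ∑₊-*ˡ _ _ m ⟩
      r s * ∑₊ t m
        ≈⟨ *-congˡ (trans (cauchy (suc s) m) (*-congˡ (sym ([suc]*1/! m)))) ⟩
      r s * (Π r (suc s) m * ([ suc m ] * 1/ suc m !))
        ≈⟨ solve 4 (λ a b c d → a :* (b :* (c :* d)) := c :* (a :* b :* d)) refl _ _ _ _ ⟩
      [ suc m ] * (r s * Π r (suc s) m * 1/ suc m !) ∎)
      where
      t : ℕ → ℕ → Carrier
      t i j = αα α (suc s) i * Π r (suc s) i * 1/ i ! * 1/ j !
      raise : ∀ i j → [ suc i ] * (α s * αα α (suc (suc s)) i * (r s * Π r (suc s) i) * 1/ suc i ! * 1/ j !) ≈
                      α (s ℕ.+ i) * (r s * t i j)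
      raise i j = begin
        [ suc i ] * (α s * αα α (suc (suc s)) i * (r s * Π r (suc s) i) * 1/ suc i ! * 1/ j !)
          ≈⟨ solve 7 (λ n a x r p f g → n :* (a :* x :* (r :* p) :* f :* g) := a :* (r :* (x :* p :* (n :* f) :* g)))
               refl _ _ _ _ _ _ _ ⟩
        α s * (r s * (αα α (suc (suc s)) i * Π r (suc s) i * ([ suc i ] * 1/ suc i !) * 1/ j !))
          ≈⟨ *-congˡ (*-congˡ (*-congʳ (*-cong (*-congʳ (αα-suc α-suc (suc s) i)) ([suc]*1/! i)))) ⟩
        α s * (r s * (q ^ i * αα α (suc s) i * Π r (suc s) i * 1/ i ! * 1/ j !))
          ≈⟨ solve 7 (λ a r y x p f g → a :* (r :* (y :* x :* p :* f :* g)) := (y :* a) :* (r :* (x :* p :* f :* g)))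
               refl _ _ _ _ _ _ _ ⟩
        q ^ i * α s * (r s * t i j)
          ≈⟨ *-congʳ (geometric α-suc s i) ⟨
        α (s ℕ.+ i) * (r s * t i j) ∎
      Π-r : ∀ i → Π r s i ≈ (1# - α (s ℕ.+ i)) * (r s * Π r (suc s) i)
      Π-r i = begin
        Π r s i                                          ≈⟨ trans (*-congˡ (r-inverse _)) (*-identityʳ _) ⟨
        Π r s i * ((1# - α (s ℕ.+ i)) * r (s ℕ.+ i))     ≈⟨ solve 3 (λ x y z → x :* (y :* z) := y :* (x :* z)) refl _ _ _ ⟩
        (1# - α (s ℕ.+ i)) * (Π r s i * r (s ℕ.+ i))     ≈⟨ *-congˡ (Π-sucʳ r s i) ⟨
        (1# - α (s ℕ.+ i)) * (r s * Π r (suc s) i)       ∎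
      keep : ∀ i j → q ^ i * [ suc j ] * (αα α s i * Π r s i * 1/ i ! * 1/ suc j !) ≈
                     (1# - α (s ℕ.+ i)) * (r s * t i j)
      keep i j = begin
        q ^ i * [ suc j ] * (αα α s i * Π r s i * 1/ i ! * 1/ suc j !)
          ≈⟨ *-congˡ (*-congʳ (*-congʳ (*-congˡ (Π-r i)))) ⟩
        q ^ i * [ suc j ] * (αα α s i * ((1# - α (s ℕ.+ i)) * (r s * Π r (suc s) i)) * 1/ i ! * 1/ suc j !)
          ≈⟨ solve 8 (λ y n x a r p f g → y :* n :* (x :* (a :* (r :* p)) :* f :* g) :=
                                          a :* (r :* ((y :* x) :* p :* f :* (n :* g))))
               refl _ _ _ _ _ _ _ _ ⟩
        (1# - α (s ℕ.+ i)) * (r s * (q ^ i * αα α s i * Π r (suc s) i * 1/ i ! * ([ suc j ] * 1/ suc j !)))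
          ≈⟨ *-congˡ (*-congˡ (*-cong (*-congʳ (*-congʳ (sym (αα-suc α-suc s i)))) ([suc]*1/! j))) ⟩
        (1# - α (s ℕ.+ i)) * (r s * t i j) ∎

  -- A terminating very-well-poised ₆φ₅ sum. Here U j, V j and W j are uqʲ, vqʲ and uvqʲ⁻¹.
  module _ {U V W r : ℕ → Carrier}
    (U-suc : ∀ t → U (suc t) ≈ q * U t) (V-suc : ∀ t → V (suc t) ≈ q * V t) (W-suc : ∀ t → W (suc t) ≈ q * W t)
    (U*V : ∀ i j → U i * V j ≈ W (suc (i ℕ.+ j)))
    (r-inverse : ∀ t → (1# - W t) * r t ≈ 1#) where

    private
      1-U 1-V : ℕ → Carrier
      1-U t = 1# - U t
      1-V t = 1# - V t

    -- The factor `1 - W` at `2(j + i)` is the very-well-poised part. It cancels one of the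
    -- reciprocals, which allows these to be written as one unbroken product.
    poised : ℕ → ℕ → ℕ → Carrier
    poised j i l = Π 1-U j i * Π 1-V (j ℕ.+ i) l * U j ^ l *
      ((1# - W ((j ℕ.+ i) ℕ.+ (j ℕ.+ i))) * Π r (j ℕ.+ (j ℕ.+ i)) (suc (i ℕ.+ l))) * 1/ i ! * 1/ l !

    private
      ^-scale : ∀ j l → U (suc j) ^ l ≈ q ^ l * U j ^ l
      ^-scale j zero    = sym (*-identityˡ 1#)
      ^-scale j (suc l) = trans (*-cong (U-suc j) (^-scale j l))
        (solve 4 (λ q u x y → (q :* u) :* (x :* y) := (q :* x) :* (u :* y)) refl q (U j) (q ^ l) (U j ^ l))

      -- The two weights are chosen to cancel the first and the last reciprocal in `poised`. The
      -- identity combines `[m + 1] = [l] + qˡ[i]` in the constant term with `[m + 1] = [i] + qⁱ[l]`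
      -- in the coefficient of `W`.
      weights : ∀ j i l m → i ℕ.+ l ≡ suc m →
        [ suc m ] * (1# - W (suc (j ℕ.+ (j ℕ.+ m)))) ≈
        q ^ l * [ i ] * (1# - W (j ℕ.+ (j ℕ.+ i))) + [ l ] * (1# - W (j ℕ.+ (j ℕ.+ i) ℕ.+ suc m))
      weights j i l m eq = begin
        [ suc m ] * (1# - W (suc (j ℕ.+ (j ℕ.+ m))))
          ≈⟨ solve 2 (λ n w → n :* (con (+ 1) :- w) := n :- n :* w) refl _ _ ⟩
        [ suc m ] - [ suc m ] * W (suc (j ℕ.+ (j ℕ.+ m)))
          ≈⟨ +-cong ([+]-cong l i (≡.trans (ℕ.+-comm l i) eq)) (-‿cong (*-cong ([+]-cong i l eq) (reflexive (≡.cong W idx₁)))) ⟩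
        [ l ] + q ^ l * [ i ] - ([ i ] + q ^ i * [ l ]) * W (j ℕ.+ (j ℕ.+ i) ℕ.+ l)
          ≈⟨ +-congˡ (-‿cong (trans (solve 4 (λ a x b w → (a :+ x :* b) :* w := a :* w :+ b :* (x :* w)) refl _ _ _ _)
               (+-cong (*-congˡ (geometric W-suc _ l)) (*-congˡ (sym (trans (reflexive (≡.cong W idx₂)) (geometric W-suc _ i))))))) ⟩
        [ l ] + q ^ l * [ i ] - ([ i ] * (q ^ l * W (j ℕ.+ (j ℕ.+ i))) + [ l ] * W (j ℕ.+ (j ℕ.+ i) ℕ.+ suc m))
          ≈⟨ solve 5 (λ l x i v w → l :+ x :* i :- (i :* (x :* v) :+ l :* w) :=
                                    x :* i :* (con (+ 1) :- v) :+ l :* (con (+ 1) :- w)) refl _ _ _ _ _ ⟩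
        q ^ l * [ i ] * (1# - W (j ℕ.+ (j ℕ.+ i))) + [ l ] * (1# - W (j ℕ.+ (j ℕ.+ i) ℕ.+ suc m)) ∎
        where
        idx₁ : suc (j ℕ.+ (j ℕ.+ m)) ≡ j ℕ.+ (j ℕ.+ i) ℕ.+ l
        idx₁ = ≡.trans (≡.cong suc (≡.sym (ℕ.+-assoc j j m))) (≡.trans (≡.sym (ℕ.+-suc (j ℕ.+ j) m))
          (≡.trans (≡.cong (j ℕ.+ j ℕ.+_) (≡.sym eq)) (≡.trans (≡.sym (ℕ.+-assoc (j ℕ.+ j) i l))
          (≡.cong (ℕ._+ l) (ℕ.+-assoc j j i)))))
        idx₂ : j ℕ.+ (j ℕ.+ i) ℕ.+ suc m ≡ j ℕ.+ (j ℕ.+ i) ℕ.+ l ℕ.+ i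
        idx₂ = ≡.trans (≡.cong (j ℕ.+ (j ℕ.+ i) ℕ.+_) (≡.trans (≡.sym eq) (ℕ.+-comm i l)))
          (≡.sym (ℕ.+-assoc (j ℕ.+ (j ℕ.+ i)) l i))

      raise : ∀ j i l → q ^ l * [ suc i ] * (1# - W (j ℕ.+ (j ℕ.+ suc i))) * poised j (suc i) l ≈ 1-U j * poised (suc j) i l
      raise j i l rewrite ℕ.+-suc j i | ℕ.+-suc j (j ℕ.+ i) = begin
        q ^ l * [ suc i ] * w * (1-U j * u * v * U j ^ l * (x * (ρ₀ * ρ)) * 1/ suc i ! * 1/ l !)
          ≈⟨ solve 12 (λ y n w a u v z x r p f g →
               y :* n :* w :* (a :* u :* v :* z :* (x :* (r :* p)) :* f :* g) :=
               a :* (u :* v :* (y :* z) :* (x :* (w :* r :* p)) :* (n :* f) :* g)) refl _ _ _ _ _ _ _ _ _ _ _ _ ⟩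
        1-U j * (u * v * (q ^ l * U j ^ l) * (x * (w * ρ₀ * ρ)) * ([ suc i ] * 1/ suc i !) * 1/ l !)
          ≈⟨ *-congˡ (*-congʳ (*-cong (*-cong (*-congˡ (sym (^-scale j l)))
               (*-congˡ (trans (*-congʳ (r-inverse _)) (*-identityˡ _)))) ([suc]*1/! i))) ⟩
        1-U j * (u * v * U (suc j) ^ l * (x * ρ) * 1/ i ! * 1/ l !) ∎
        where
        w = 1# - W (suc (j ℕ.+ (j ℕ.+ i)))
        u = Π 1-U (suc j) i
        v = Π 1-V (suc (j ℕ.+ i)) l
        x = 1# - W (suc (j ℕ.+ i) ℕ.+ suc (j ℕ.+ i))
        ρ₀ = r (suc (j ℕ.+ (j ℕ.+ i)))
        ρ = Π r (suc (suc (j ℕ.+ (j ℕ.+ i)))) (suc (i ℕ.+ l))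

      keep : ∀ j i l → [ suc l ] * (1# - W (j ℕ.+ (j ℕ.+ i) ℕ.+ suc (i ℕ.+ l))) * poised j i (suc l) ≈
                       U j * 1-V (j ℕ.+ (i ℕ.+ l)) * poised j i l
      keep j i l rewrite ℕ.+-suc i l | ≡.sym (ℕ.+-assoc j i l) = begin
        [ suc l ] * w * (u * Π 1-V (j ℕ.+ i) (suc l) * (U j * U j ^ l) * (x * Π r s (suc (suc (i ℕ.+ l)))) * 1/ i ! * 1/ suc l !)
          ≈⟨ *-congˡ (*-congʳ (*-congʳ (*-cong (*-congʳ (*-congˡ (Π-sucʳ 1-V (j ℕ.+ i) l)))
               (*-congˡ (Π-sucʳ r s (suc (i ℕ.+ l))))))) ⟩
        [ suc l ] * w * (u * (v * v₀) * (U j * U j ^ l) * (x * (ρ * ρ₀)) * 1/ i ! * 1/ suc l !)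
          ≈⟨ solve 12 (λ n w u v v₀ a z x p r f g →
               n :* w :* (u :* (v :* v₀) :* (a :* z) :* (x :* (p :* r)) :* f :* g) :=
               a :* v₀ :* (u :* v :* z :* (x :* (w :* r :* p)) :* f :* (n :* g))) refl _ _ _ _ _ _ _ _ _ _ _ _ ⟩
        U j * v₀ * (u * v * U j ^ l * (x * (w * ρ₀ * ρ)) * 1/ i ! * ([ suc l ] * 1/ suc l !))
          ≈⟨ *-congˡ (*-cong (*-congʳ (*-congˡ (*-congˡ (trans (*-congʳ (r-inverse _)) (*-identityˡ _))))) ([suc]*1/! l)) ⟩
        U j * v₀ * (u * v * U j ^ l * (x * ρ) * 1/ i ! * 1/ l !) ∎
        where
        s = j ℕ.+ (j ℕ.+ i)
        w = 1# - W (s ℕ.+ suc (i ℕ.+ l))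
        u = Π 1-U j i
        v = Π 1-V (j ℕ.+ i) l
        v₀ = 1-V (j ℕ.+ i ℕ.+ l)
        x = 1# - W ((j ℕ.+ i) ℕ.+ (j ℕ.+ i))
        ρ₀ = r (s ℕ.+ suc (i ℕ.+ l))
        ρ = Π r s (suc (i ℕ.+ l))

    -- With these weights one part is the sum at base `j + 1` times `1 - U j`, the other the sum at
    -- base `j` times `U j (1 - V (j + m))`, both of length `m`. The factors add up to
    -- `1 - U j V (j + m)`, which is the multiplier `1 - W (2j + m + 1)` again.
    ₆φ₅-sum : ∀ j m → ∑₊ (poised j) m ≈ 1/ m !
    ₆φ₅-sum j zero rewrite ℕ.+-identityʳ j = begin
      1# * 1# * 1# * ((1# - W (j ℕ.+ j)) * (r (j ℕ.+ j) * 1#)) * 1/ 0 ! * 1/ 0 !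
        ≈⟨ solve 3 (λ w r f → con (+ 1) :* con (+ 1) :* con (+ 1) :* (w :* (r :* con (+ 1))) :* f :* f := (w :* r) :* (f :* f))
             refl _ _ _ ⟩
      (1# - W (j ℕ.+ j)) * r (j ℕ.+ j) * (1/ 0 ! * 1/ 0 !)
        ≈⟨ trans (*-cong (r-inverse _) (*-congʳ 1/0!)) (trans (*-identityˡ _) (*-identityˡ _)) ⟩
      1/ 0 ! ∎
    ₆φ₅-sum j (suc m) = unit-cancel ([suc]-unit m) (unit-cancel (mkUnit _ (r-inverse (suc (j ℕ.+ (j ℕ.+ m))))) (begin
      w * ([ suc m ] * ∑₊ (poised j) (suc m))
        ≈⟨ trans (solve 3 (λ w n x → w :* (n :* x) := (n :* w) :* x) refl _ _ _) (sym (∑₊-*ˡ _ (poised j) (suc m))) ⟩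
      ∑₊ (λ i l → [ suc m ] * w * poised j i l) (suc m)
        ≈⟨ ∑₊-split (λ i l → q ^ l * [ i ] * (1# - W (j ℕ.+ (j ℕ.+ i))) * poised j i l)
             (λ i l → [ l ] * (1# - W (j ℕ.+ (j ℕ.+ i) ℕ.+ suc m)) * poised j i l) m (λ i l eq → trans (*-congʳ (weights j i l m eq)) (distribʳ _ _ _))
             (trans (*-congʳ (trans (*-congʳ (trans (*-congˡ [0]) (zeroʳ _))) (zeroˡ _))) (zeroˡ _))
             (trans (*-congʳ (trans (*-congʳ [0]) (zeroˡ _))) (zeroˡ _)) ⟩
      ∑₊ (λ i l → q ^ l * [ suc i ] * (1# - W (j ℕ.+ (j ℕ.+ suc i))) * poised j (suc i) l) m +
      ∑₊ (λ i l → [ suc l ] * (1# - W (j ℕ.+ (j ℕ.+ i) ℕ.+ suc m)) * poised j i (suc l)) m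
        ≈⟨ +-cong (∑₊-cong (raise j) m) (∑₊-cong′ m λ { i l ≡.refl → keep j i l }) ⟩
      ∑₊ (λ i l → 1-U j * poised (suc j) i l) m + ∑₊ (λ i l → U j * 1-V (j ℕ.+ m) * poised j i l) m
        ≈⟨ +-cong (trans (∑₊-*ˡ _ _ m) (*-congˡ (₆φ₅-sum (suc j) m))) (trans (∑₊-*ˡ _ _ m) (*-congˡ (₆φ₅-sum j m))) ⟩
      1-U j * 1/ m ! + U j * 1-V (j ℕ.+ m) * 1/ m !
        ≈⟨ solve 3 (λ u v f → (con (+ 1) :- u) :* f :+ u :* (con (+ 1) :- v) :* f := (con (+ 1) :- u :* v) :* f) refl _ _ _ ⟩
      (1# - U j * V (j ℕ.+ m)) * 1/ m !
        ≈⟨ *-cong (+-congˡ (-‿cong (U*V j (j ℕ.+ m)))) (sym ([suc]*1/! m)) ⟩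
      w * ([ suc m ] * 1/ suc m !) ∎))
      where
      w = 1# - W (suc (j ℕ.+ (j ℕ.+ m)))

  factorial : ℕ → Carrier
  factorial zero    = 1#
  factorial (suc n) = [ suc n ] * factorial n

  factorial-inverse : ∀ n → factorial n * 1/ n ! ≈ 1#
  factorial-inverse zero    = trans (*-identityˡ _) 1/0!
  factorial-inverse (suc n) = trans (solve 3 (λ a b c → a :* b :* c := b :* (a :* c)) refl _ _ _)
    (trans (*-congˡ ([suc]*1/! n)) (factorial-inverse n))

  1/!-unit : ∀ n → Unit (1/ n !)
  1/!-unit n = mkUnit (factorial n) (trans (*-comm _ _) (factorial-inverse n))

-- Connection matrices and three-term recurrences

module Connection {A : Ring₀} {q : El A} (Q : QFactorials A q) where
  open CommutativeRing A
  open RingProperties ring using (-0#≈0#)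
  open CommutativeExp commutativeSemiring using (_^_; ^-homo-*; ^-distrib-*)
  open Units A using (Unit)
  open SetoidReasoning setoid
  open IntegerSolver A using (solve; con; _:=_; _:+_; _:*_; _:-_; :-_)
  open Identities Q

  0s 1s : ℕ → Carrier
  0s _ = 0#
  1s _ = 1#

  1-_ : (ℕ → Carrier) → ℕ → Carrier
  (1- g) t = 1# - g t

  -- With AB t = abqᵗ, AC t = acqᵗ, AD t = adqᵗ, ξ t = a⁻¹q⁻ᵗ and r t = 1 / (1 - abcdqᵗ⁻¹), this is the
  -- coefficient of (az, a/z; q)ⱼ in the polynomial p of degree j + i, up to one factor depending
  -- only on j and one depending only on j + i.
  AW : (ξ AB AC AD r : ℕ → Carrier) → Kernel
  AW ξ AB AC AD r j i = ξ j ^ i * (Π (1- AB) j i * Π (1- AC) j i * Π (1- AD) j i) * Π r (i ℕ.+ (j ℕ.+ j)) i * 1/ i !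

  -- This is `AW` at `d = 0`, where `AD` vanishes and every `r` is 1.
  AW₀ : (ξ AB AC : ℕ → Carrier) → Kernel
  AW₀ ξ AB AC j i = ξ j ^ i * (Π (1- AB) j i * Π (1- AC) j i) * 1/ i !

  factor : Carrier → (AB AC BC : ℕ → Carrier) → ℕ → Carrier
  factor d AB AC BC t = d * ((1# - AB t) * (1# - AC t) * (1# - BC t))

  -- The connection coefficients from (a,b,c,0) to (a,b,c,d).
  transition : Carrier → (AB AC BC r : ℕ → Carrier) → Kernel
  transition d AB AC BC r k l = Π (factor d AB AC BC) k l * Π r (suc (k ℕ.+ k)) l * 1/ l !

  module _ {d : Carrier} {ξ AB AC AD BC W r : ℕ → Carrier}
    (AD-suc : ∀ t → AD (suc t) ≈ q * AD t) (BC-suc : ∀ t → BC (suc t) ≈ q * BC t) (W-suc : ∀ t → W (suc t) ≈ q * W t)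
    (AD*BC : ∀ i j → AD i * BC j ≈ W (suc (i ℕ.+ j)))
    (r-inverse : ∀ t → (1# - W t) * r t ≈ 1#)
    (ξ*AD : ∀ t → ξ t * AD t ≈ d) where

    -- The products of `1 - AB` and of `1 - AC` join into factors that depend on `m` only, and
    -- `d = ξ j * AD j` does the same for the powers of `ξ j`. What remains is the ₆φ₅ sum with `AD`
    -- and `BC` as `U` and `V`.
    AW⋆transition : AW ξ AB AC AD r ⋆ transition d AB AC BC r ≐ AW₀ ξ AB AC
    AW⋆transition j m = begin
      (AW ξ AB AC AD r ⋆ transition d AB AC BC r) j m
        ≈⟨ ∑₊-cong′ m (λ { i l ≡.refl → term i l }) ⟩
      ∑₊ (λ i l → ξ j ^ m * (Π (1- AB) j m * Π (1- AC) j m) * poised′ j i l) m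
        ≈⟨ ∑₊-*ˡ _ (poised′ j) m ⟩
      ξ j ^ m * (Π (1- AB) j m * Π (1- AC) j m) * ∑₊ (poised′ j) m
        ≈⟨ *-congˡ (₆φ₅-sum AD-suc BC-suc W-suc AD*BC r-inverse j m) ⟩
      AW₀ ξ AB AC j m ∎
      where
      poised′ = poised AD-suc BC-suc W-suc AD*BC r-inverse

      Π-r : ∀ i l → Π r (i ℕ.+ (j ℕ.+ j)) i * Π r (suc ((j ℕ.+ i) ℕ.+ (j ℕ.+ i))) l ≈
        (1# - W ((j ℕ.+ i) ℕ.+ (j ℕ.+ i))) * Π r (j ℕ.+ (j ℕ.+ i)) (suc (i ℕ.+ l))
      Π-r i l = begin
        Π r (i ℕ.+ (j ℕ.+ j)) i * Π r (suc s) l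
          ≡⟨ ≡.cong (λ x → Π r x i * Π r (suc s) l) idx₁ ⟩
        Π r x i * Π r (suc s) l
          -- The two products of reciprocals miss exactly the index `s` between them; inserting
          -- `(1 - W s) * r s` closes the gap.
          ≈⟨ trans (*-congʳ (r-inverse s)) (*-identityˡ _) ⟨
        (1# - W s) * r s * (Π r x i * Π r (suc s) l)
          ≈⟨ solve 4 (λ a b c d → a :* b :* (c :* d) := a :* (c :* (b :* d))) refl _ _ _ _ ⟩
        (1# - W s) * (Π r x i * Π r s (suc l))
          ≡⟨ ≡.cong (λ y → (1# - W s) * (Π r x i * Π r y (suc l))) idx₂ ⟩
        (1# - W s) * (Π r x i * Π r (x ℕ.+ i) (suc l))
          ≈⟨ *-congˡ (sym (Π-+ r x i (suc l))) ⟩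
        (1# - W s) * Π r x (i ℕ.+ suc l)
          ≡⟨ ≡.cong (λ y → (1# - W s) * Π r x y) (ℕ.+-suc i l) ⟩
        (1# - W s) * Π r x (suc (i ℕ.+ l)) ∎
        where
        x = j ℕ.+ (j ℕ.+ i)
        s = (j ℕ.+ i) ℕ.+ (j ℕ.+ i)
        idx₁ : i ℕ.+ (j ℕ.+ j) ≡ x
        idx₁ = ≡.trans (ℕ.+-comm i (j ℕ.+ j)) (ℕ.+-assoc j j i)
        idx₂ : s ≡ x ℕ.+ i
        idx₂ = ≡.trans (≡.cong (ℕ._+ (j ℕ.+ i)) (ℕ.+-comm j i)) (≡.trans (ℕ.+-assoc i j (j ℕ.+ i)) (ℕ.+-comm i x))

      term : ∀ i l → AW ξ AB AC AD r j i * transition d AB AC BC r (j ℕ.+ i) l ≈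
        ξ j ^ (i ℕ.+ l) * (Π (1- AB) j (i ℕ.+ l) * Π (1- AC) j (i ℕ.+ l)) * poised′ j i l
      term i l = begin
        ξ j ^ i * (ab * ac * ad) * R * 1/ i ! * (Π (factor d AB AC BC) (j ℕ.+ i) l * R′ * 1/ l !)
          ≈⟨ *-congˡ (*-congʳ (*-congʳ (trans (Π-* _ _ (j ℕ.+ i) l) (*-cong (trans (Π-const d _ l) d^l)
               (trans (Π-* _ _ (j ℕ.+ i) l) (*-congʳ (Π-* _ _ (j ℕ.+ i) l))))))) ⟩
        ξ j ^ i * (ab * ac * ad) * R * 1/ i ! * (ξ j ^ l * AD j ^ l * (ab′ * ac′ * bc′) * R′ * 1/ l !)
          ≈⟨ solve 13 (λ x a b c r f x′ y a′ b′ c′ r′ f′ →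
               x :* (a :* b :* c) :* r :* f :* (x′ :* y :* (a′ :* b′ :* c′) :* r′ :* f′) :=
               (x :* x′) :* ((a :* a′) :* (b :* b′)) :* (c :* c′ :* y :* (r :* r′) :* f :* f′))
               refl _ _ _ _ _ _ _ _ _ _ _ _ _ ⟩
        ξ j ^ i * ξ j ^ l * (ab * ab′ * (ac * ac′)) * (ad * bc′ * AD j ^ l * (R * R′) * 1/ i ! * 1/ l !)
          ≈⟨ *-cong (*-cong (^-homo-* (ξ j) i l) (*-cong (Π-+ _ j i l) (Π-+ _ j i l)))
               (*-congʳ (*-congʳ (*-congˡ (sym (Π-r i l))))) ⟨
        ξ j ^ (i ℕ.+ l) * (Π (1- AB) j (i ℕ.+ l) * Π (1- AC) j (i ℕ.+ l)) * poised′ j i l ∎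
        where
        ab = Π (1- AB) j i
        ac = Π (1- AC) j i
        ad = Π (1- AD) j i
        ab′ = Π (1- AB) (j ℕ.+ i) l
        ac′ = Π (1- AC) (j ℕ.+ i) l
        bc′ = Π (1- BC) (j ℕ.+ i) l
        R = Π r (i ℕ.+ (j ℕ.+ j)) i
        R′ = Π r (suc ((j ℕ.+ i) ℕ.+ (j ℕ.+ i))) l
        d^l : d ^ l ≈ ξ j ^ l * AD j ^ l
        d^l = trans (^-congˡ′ l (sym (ξ*AD j))) (^-distrib-* (ξ j) (AD j) l)
          where
          ^-congˡ′ : ∀ {x y} n → x ≈ y → x ^ n ≈ y ^ n
          ^-congˡ′ zero    p = refl
          ^-congˡ′ (suc n) p = *-cong p (^-congˡ′ n p)

  private
    0s-suc : ∀ t → 0s (suc t) ≈ q * 0s t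
    0s-suc t = sym (zeroʳ q)

    0s-inverse : ∀ t → (1# - 0s t) * 1s t ≈ 1#
    0s-inverse t = trans (*-identityʳ _) (trans (+-congˡ -0#≈0#) (+-identityʳ _))

    Π-0s : ∀ k m → Π (1- 0s) k m ≈ 1#
    Π-0s k m = trans (Π-cong (λ _ → trans (+-congˡ -0#≈0#) (+-identityʳ _)) k m) (Π-1 k m)

  module _ {d : Carrier} {ξ AB AC : ℕ → Carrier} (AC-suc : ∀ t → AC (suc t) ≈ q * AC t) (ξ*AC : ∀ t → ξ t * AC t ≈ d) where

    -- The same sum with one more parameter equal to zero: `AC` takes the place of `AD`, while `W`
    -- is 0 and `r` is 1.
    AW₀⋆transition : AW₀ ξ AB AC ⋆ transition d AB 0s 0s 1s ≐ AW₀ ξ AB 0s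
    AW₀⋆transition = ⋆-congʳ (transition d AB 0s 0s 1s) (λ j i → *-congʳ (begin
        ξ j ^ i * (Π (1- AB) j i * Π (1- AC) j i)
          ≈⟨ *-congˡ (*-congʳ (trans (sym (*-identityʳ _)) (*-congˡ (sym (Π-0s j i))))) ⟩
        ξ j ^ i * (Π (1- AB) j i * Π (1- 0s) j i * Π (1- AC) j i)
          ≈⟨ trans (sym (*-identityʳ _)) (*-congˡ (sym (Π-1 _ i))) ⟩
        ξ j ^ i * (Π (1- AB) j i * Π (1- 0s) j i * Π (1- AC) j i) * Π 1s (i ℕ.+ (j ℕ.+ j)) i ∎))
      ≐∙ AW⋆transition AC-suc 0s-suc 0s-suc (λ i j → zeroʳ _) 0s-inverse ξ*AC

  AW₀-comm : ∀ ξ AB AC → AW₀ ξ AB AC ≐ AW₀ ξ AC AB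
  AW₀-comm ξ AB AC j i = *-congʳ (*-congˡ (*-comm _ _))

  previous : (ℕ → Carrier) → ℕ → Carrier
  previous x zero    = 0#
  previous x (suc n) = x n

  -- The recurrence `h (n + 1) = b n * h n - (1 - qⁿ) * h (n - 1)` after division by q-factorials,
  -- which leaves a constant last coefficient. `previous` lets it cover `n = 0`.
  ThreeTerm : (ℕ → Carrier) → (ℕ → Carrier) → Set
  ThreeTerm b x = ∀ n → [ suc n ] * x (suc n) ≈ b n * x n - (1# - q) * previous x n

  threeTerm-unique : ∀ {b x y} → ThreeTerm b x → ThreeTerm b y → x 0 ≈ y 0 → ∀ n → x n ≈ y n
  threeTerm-unique {b} {x} {y} X Y p n = proj₁ (both n)
    where
    both : ∀ n → (x n ≈ y n) × (previous x n ≈ previous y n)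
    both zero    = p , refl
    both (suc n) with r , r′ ← both n = unit-cancel ([suc]-unit n)
      (trans (X n) (trans (+-cong (*-congˡ r) (-‿cong (*-congˡ r′))) (sym (Y n)))) , r

  ∑₊-[]ʳ : ∀ (h : ℕ → ℕ → Carrier) n → ∑₊ (λ i j → [ j ] * h i j) n ≈ previous (∑₊ (λ i j → [ suc j ] * h i (suc j))) n
  ∑₊-[]ʳ h zero    = trans (*-congʳ [0]) (zeroˡ _)
  ∑₊-[]ʳ h (suc n) = trans (∑₊-sucʳ (λ i j → [ j ] * h i j) n) (trans (+-congˡ (trans (*-congʳ [0]) (zeroˡ _))) (+-identityʳ _))

  ∑₊-[]ˡ : ∀ (h : ℕ → ℕ → Carrier) n → ∑₊ (λ i j → [ i ] * h i j) n ≈ previous (∑₊ (λ i j → [ suc i ] * h (suc i) j)) n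
  ∑₊-[]ˡ h zero    = trans (*-congʳ [0]) (zeroˡ _)
  ∑₊-[]ˡ h (suc n) = trans (+-congʳ (trans (*-congʳ [0]) (zeroˡ _))) (+-identityˡ _)

  previous-cong : ∀ {x y} → (∀ n → x n ≈ y n) → ∀ n → previous x n ≈ previous y n
  previous-cong p zero    = refl
  previous-cong p (suc n) = p n

  previous-* : ∀ c (x : ℕ → Carrier) n → previous (λ n → c * x n) n ≈ c * previous x n
  previous-* c x zero    = sym (zeroʳ c)
  previous-* c x (suc n) = refl

  -- For `zy = 1` this is `2ⁿ Hₙ / [n]!` at `x = (z + y)/2`.
  rogersSzegő : Carrier → Carrier → ℕ → Carrier
  rogersSzegő z y = ∑₊ λ i j → z ^ i * 1/ i ! * (y ^ j * 1/ j !)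

  module _ {z y : Carrier} (zy≈1 : z * y ≈ 1#) where

    -- In the half where `j` drops, `qⁱ = 1 - (1 - q)[i]` splits off a term in which `i` drops as
    -- well; with `zy = 1` this is the sum for `n - 1`.
    rogersSzegő-threeTerm : ThreeTerm (λ _ → z + y) (rogersSzegő z y)
    rogersSzegő-threeTerm n = begin
      [ suc n ] * rogersSzegő z y (suc n)
        ≈⟨ ∑₊-[] h n ⟩
      ∑₊ (λ i j → [ suc i ] * (z * z ^ i * 1/ suc i ! * (y ^ j * 1/ j !))) n +
      ∑₊ (λ i j → q ^ i * [ suc j ] * (z ^ i * 1/ i ! * (y * y ^ j * 1/ suc j !))) n
        ≈⟨ +-cong (trans (∑₊-cong raise n) (∑₊-*ˡ z h n)) (∑₊-cong keep n) ⟩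
      z * x n + ∑₊ (λ i j → y * h i j + - (y * (1# - q)) * ([ i ] * h i j)) n
        ≈⟨ +-congˡ (trans (∑₊-+ _ _ n) (+-cong (∑₊-*ˡ _ h n) (trans (∑₊-*ˡ _ _ n) (*-congˡ (∑₊-[]ˡ h n))))) ⟩
      z * x n + (y * x n + - (y * (1# - q)) * previous (∑₊ (λ i j → [ suc i ] * h (suc i) j)) n)
        ≈⟨ +-congˡ (+-congˡ (*-congˡ (trans (previous-cong (λ n → trans (∑₊-cong raise n) (∑₊-*ˡ z h n)) n) (previous-* z x n)))) ⟩
      z * x n + (y * x n + - (y * (1# - q)) * (z * previous x n))
        ≈⟨ solve 5 (λ z y c x p → z :* x :+ (y :* x :+ (:- (y :* c)) :* (z :* p)) := (z :+ y) :* x :- (z :* y) :* (c :* p)) refl _ _ _ _ _ ⟩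
      (z + y) * x n - (z * y) * ((1# - q) * previous x n)
        ≈⟨ +-congˡ (-‿cong (trans (*-congʳ zy≈1) (*-identityˡ _))) ⟩
      (z + y) * x n - (1# - q) * previous x n ∎
      where
      x = rogersSzegő z y
      h : ℕ → ℕ → Carrier
      h i j = z ^ i * 1/ i ! * (y ^ j * 1/ j !)
      raise : ∀ i j → [ suc i ] * (z * z ^ i * 1/ suc i ! * (y ^ j * 1/ j !)) ≈ z * h i j
      raise i j = trans (solve 5 (λ n z x f g → n :* (z :* x :* f :* g) := z :* (x :* (n :* f) :* g)) refl _ _ _ _ _)
        (*-congˡ (*-congʳ (*-congˡ ([suc]*1/! i))))
      keep : ∀ i j → q ^ i * [ suc j ] * (z ^ i * 1/ i ! * (y * y ^ j * 1/ suc j !)) ≈ y * h i j + - (y * (1# - q)) * ([ i ] * h i j)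
      keep i j = begin
        q ^ i * [ suc j ] * (z ^ i * 1/ i ! * (y * y ^ j * 1/ suc j !))
          ≈⟨ solve 6 (λ x n w y v f → x :* n :* (w :* (y :* v :* f)) := x :* (y :* (w :* (v :* (n :* f))))) refl _ _ _ _ _ _ ⟩
        q ^ i * (y * (z ^ i * 1/ i ! * (y ^ j * ([ suc j ] * 1/ suc j !))))
          ≈⟨ *-congˡ (*-congˡ (*-congˡ (*-congˡ ([suc]*1/! j)))) ⟩
        q ^ i * (y * h i j)
          ≈⟨ solve 3 (λ x y h → x :* (y :* h) := y :* h :- y :* (con (+ 1) :- x) :* h) refl _ _ _ ⟩
        y * h i j - y * (1# - q ^ i) * h i j
          ≈⟨ +-congˡ (-‿cong (*-congʳ (*-congˡ ([1-q]*[] i)))) ⟨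
        y * h i j - y * ((1# - q) * [ i ]) * h i j
          ≈⟨ +-congˡ (solve 4 (λ y c n h → :- (y :* (c :* n) :* h) := (:- (y :* c)) :* (n :* h)) refl _ _ _ _) ⟩
        y * h i j + - (y * (1# - q)) * ([ i ] * h i j) ∎

    module _ {α ξ : ℕ → Carrier} (α-suc : ∀ t → α (suc t) ≈ q * α t)
      (ξ-suc : ∀ t → q * ξ (suc t) ≈ ξ t) (ξ*α : ∀ t → ξ t * α t ≈ 1#) where

      -- (az, a/z; q)ⱼ is Π θ 0 j up to the factor (-a)ʲ q^(j(j-1)/2).
      θ : ℕ → Carrier
      θ t = - ξ t * ((1# - α t * z) * (1# - α t * y))

      θ-expand : ∀ t → θ t ≈ z + y - α t - ξ t
      θ-expand t = begin
        - ξ t * ((1# - α t * z) * (1# - α t * y))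
          ≈⟨ solve 4 (λ x a z y → (:- x) :* ((con (+ 1) :- a :* z) :* (con (+ 1) :- a :* y)) :=
               (x :* a) :* (z :+ y) :- (x :* a) :* a :* (z :* y) :- x) refl _ _ _ _ ⟩
        ξ t * α t * (z + y) - ξ t * α t * α t * (z * y) - ξ t
          ≈⟨ +-congʳ (+-cong (trans (*-congʳ (ξ*α t)) (*-identityˡ _))
               (-‿cong (trans (*-cong (trans (*-congʳ (ξ*α t)) (*-identityˡ _)) zy≈1) (*-identityʳ _)))) ⟩
        z + y - α t - ξ t ∎

      -- The continuous big q-Hermite polynomials, that is the Askey-Wilson polynomials with
      -- `b = c = d = 0`, in the normalisation `2ⁿ pₙ / [n]!`.
      bigHermite : ℕ → Carrier
      bigHermite n = (θ ⊙ e ⋆ AW₀ ξ 0s 0s) 0 n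

      private
        h : ℕ → ℕ → Carrier
        h j i = Π θ 0 j * 1/ j ! * (ξ j ^ i * 1/ i !)

        bigHermite-h : ∀ n → bigHermite n ≈ ∑₊ h n
        bigHermite-h = ∑₊-cong λ j i → *-congˡ (*-congʳ (trans (*-congˡ (trans (*-cong (Π-0s j i) (Π-0s j i)) (*-identityˡ _))) (*-identityʳ _)))

        lower : ∀ j i → [ suc i ] * h j (suc i) ≈ ξ j * h j i
        lower j i = trans (solve 5 (λ n p x v f → n :* (p :* (x :* v :* f)) := x :* (p :* (v :* (n :* f)))) refl _ _ _ _ _)
          (*-congˡ (*-congˡ (*-congˡ ([suc]*1/! i))))

        ξ^ : ∀ j i → q ^ i * ξ (suc j) ^ i ≈ ξ j ^ i
        ξ^ j zero    = *-identityˡ 1#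
        ξ^ j (suc i) = trans (solve 4 (λ a b c d → a :* b :* (c :* d) := (a :* c) :* (b :* d)) refl _ _ _ _)
          (*-cong (ξ-suc j) (ξ^ j i))

        raise : ∀ j i → q ^ i * [ suc j ] * h (suc j) i ≈ θ j * h j i
        raise j i = begin
          q ^ i * [ suc j ] * (Π θ 0 (suc j) * 1/ suc j ! * (ξ (suc j) ^ i * 1/ i !))
            ≈⟨ *-congˡ (*-congʳ (*-congʳ (Π-sucʳ θ 0 j))) ⟩
          q ^ i * [ suc j ] * (Π θ 0 j * θ j * 1/ suc j ! * (ξ (suc j) ^ i * 1/ i !))
            ≈⟨ solve 7 (λ x n p t f y g → x :* n :* (p :* t :* f :* (y :* g)) := t :* (p :* (n :* f) :* ((x :* y) :* g))) refl _ _ _ _ _ _ _ ⟩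
          θ j * (Π θ 0 j * ([ suc j ] * 1/ suc j !) * ((q ^ i * ξ (suc j) ^ i) * 1/ i !))
            ≈⟨ *-congˡ (*-cong (*-congˡ ([suc]*1/! j)) (*-congʳ (ξ^ j i))) ⟩
          θ j * h j i ∎

        αn : ∀ j i → α j ≈ α (j ℕ.+ i) + (1# - q) * (α j * [ i ])
        αn j i = begin
          α j                                         ≈⟨ solve 2 (λ a x → a := x :* a :+ a :* (con (+ 1) :- x)) refl (α j) (q ^ i) ⟩
          q ^ i * α j + α j * (1# - q ^ i)            ≈⟨ +-cong (geometric α-suc j i) (*-congˡ ([1-q]*[] i)) ⟨
          α (j ℕ.+ i) + α j * ((1# - q) * [ i ])      ≈⟨ +-congˡ (solve 3 (λ a c n → a :* (c :* n) := c :* (a :* n)) refl _ _ _) ⟩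
          α (j ℕ.+ i) + (1# - q) * (α j * [ i ])      ∎

        -- Of the two parts of `[n + 1]`, one raises the basis element at the cost of `θ j`, the
        -- other yields `ξ j`. Since `θ j + ξ j = z + y - α j`, it only remains to replace `α j` by
        -- `α n`, and the difference `(1 - q) α j [i]` gives the term for `n - 1`.
        h-threeTerm : ThreeTerm (λ n → z + y - α n) (∑₊ h)
        h-threeTerm n = begin
          [ suc n ] * ∑₊ h (suc n)
            ≈⟨ ∑₊-*ˡ _ h (suc n) ⟨
          ∑₊ (λ j i → [ suc n ] * h j i) (suc n)
            ≈⟨ ∑₊-split (λ j i → q ^ i * [ j ] * h j i) (λ j i → [ i ] * h j i) n
                 (λ j i eq → trans (*-congʳ (trans ([+]-cong i j (≡.trans (ℕ.+-comm i j) eq)) (+-comm _ _))) (distribʳ _ _ _))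
                 (trans (*-congʳ (trans (*-congˡ [0]) (zeroʳ _))) (zeroˡ _)) (trans (*-congʳ [0]) (zeroˡ _)) ⟩
          ∑₊ (λ j i → q ^ i * [ suc j ] * h (suc j) i) n + ∑₊ (λ j i → [ suc i ] * h j (suc i)) n
            ≈⟨ +-cong (∑₊-cong raise n) (∑₊-cong lower n) ⟩
          ∑₊ (λ j i → θ j * h j i) n + ∑₊ (λ j i → ξ j * h j i) n
            ≈⟨ ∑₊-+ _ _ n ⟨
          ∑₊ (λ j i → θ j * h j i + ξ j * h j i) n
            ≈⟨ ∑₊-cong′ n (λ { j i ≡.refl → combine j i }) ⟩
          ∑₊ (λ j i → (z + y - α n) * h j i + - (1# - q) * ([ i ] * (α j * h j i))) n
            ≈⟨ trans (∑₊-+ _ _ n) (+-cong (∑₊-*ˡ _ h n) (trans (∑₊-*ˡ _ _ n) (*-congˡ (trans (∑₊-[]ʳ (λ j i → α j * h j i) n) (previous-cong (∑₊-cong αξ) n))))) ⟩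
          (z + y - α n) * ∑₊ h n + - (1# - q) * previous (∑₊ h) n
            ≈⟨ +-congˡ (solve 2 (λ c p → (:- c) :* p := :- (c :* p)) refl _ _) ⟩
          (z + y - α n) * ∑₊ h n - (1# - q) * previous (∑₊ h) n ∎
          where
          αξ : ∀ j i → [ suc i ] * (α j * h j (suc i)) ≈ h j i
          αξ j i = begin
            [ suc i ] * (α j * h j (suc i))   ≈⟨ solve 3 (λ n a h → n :* (a :* h) := a :* (n :* h)) refl _ _ _ ⟩
            α j * ([ suc i ] * h j (suc i))   ≈⟨ *-congˡ (lower j i) ⟩
            α j * (ξ j * h j i)               ≈⟨ solve 3 (λ a x h → a :* (x :* h) := x :* a :* h) refl _ _ _ ⟩
            ξ j * α j * h j i                 ≈⟨ trans (*-congʳ (ξ*α j)) (*-identityˡ _) ⟩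
            h j i                             ∎
          combine : ∀ j i → θ j * h j i + ξ j * h j i ≈
            (z + y - α (j ℕ.+ i)) * h j i + - (1# - q) * ([ i ] * (α j * h j i))
          combine j i = begin
            θ j * h j i + ξ j * h j i
              ≈⟨ +-congʳ (*-congʳ (θ-expand j)) ⟩
            (z + y - α j - ξ j) * h j i + ξ j * h j i
              ≈⟨ solve 4 (λ s a x h → (s :- a :- x) :* h :+ x :* h := (s :- a) :* h) refl _ _ _ _ ⟩
            (z + y - α j) * h j i
              ≈⟨ *-congʳ (+-congˡ (-‿cong (αn j i))) ⟩
            (z + y - (α (j ℕ.+ i) + (1# - q) * (α j * [ i ]))) * h j i
              ≈⟨ solve 6 (λ s b c a n h → (s :- (b :+ c :* (a :* n))) :* h := (s :- b) :* h :+ (:- c) :* (n :* (a :* h))) refl _ _ _ _ _ _ ⟩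
            (z + y - α (j ℕ.+ i)) * h j i + - (1# - q) * ([ i ] * (α j * h j i)) ∎

      -- Both sides satisfy the q-Hermite recurrence: on the right, the term `- α k` of the big
      -- q-Hermite recurrence cancels against `qᵏ α 0`, which comes from the split of `[k + l + 1]`.
      rogersSzegő-expand : ∀ n → rogersSzegő z y n ≈ (θ ⊙ e ⋆ AW₀ ξ 0s 0s ⋆ (λ _ → α 0) ⊙ e) 0 n
      rogersSzegő-expand n = trans
        (threeTerm-unique rogersSzegő-threeTerm x-threeTerm (sym (trans (*-cong p0≈1 (*-identityˡ _)) (trans (*-identityˡ _) rs0))) n)
        (∑₊-cong (λ k l → *-cong (sym (bigHermite-h k)) (*-congʳ (sym (Π-const (α 0) k l)))) n)
        where
        p = ∑₊ h
        p0≈1 : p 0 ≈ 1#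
        p0≈1 = trans (*-cong (trans (*-identityˡ _) 1/0!) (trans (*-identityˡ _) 1/0!)) (*-identityˡ 1#)
        rs0 : 1/ 0 ! ≈ 1# * 1/ 0 ! * (1# * 1/ 0 !)
        rs0 = sym (trans (*-cong (*-identityˡ _) (trans (*-identityˡ _) 1/0!)) (*-identityʳ _))
        g : ℕ → ℕ → Carrier
        g k l = p k * (α 0 ^ l * 1/ l !)
        x = ∑₊ g
        x-threeTerm : ThreeTerm (λ _ → z + y) x
        x-threeTerm n = begin
          [ suc n ] * x (suc n)
            ≈⟨ ∑₊-[] g n ⟩
          ∑₊ (λ k l → [ suc k ] * g (suc k) l) n + ∑₊ (λ k l → q ^ k * [ suc l ] * g k (suc l)) n
            ≈⟨ ∑₊-+ _ _ n ⟨
          ∑₊ (λ k l → [ suc k ] * g (suc k) l + q ^ k * [ suc l ] * g k (suc l)) n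
            ≈⟨ ∑₊-cong step n ⟩
          ∑₊ (λ k l → (z + y) * g k l + - (1# - q) * (previous p k * (α 0 ^ l * 1/ l !))) n
            ≈⟨ trans (∑₊-+ _ _ n) (+-cong (∑₊-*ˡ _ g n) (trans (∑₊-*ˡ _ _ n) (*-congˡ (prev n)))) ⟩
          (z + y) * x n + - (1# - q) * previous x n
            ≈⟨ +-congˡ (solve 2 (λ c p → (:- c) :* p := :- (c :* p)) refl _ _) ⟩
          (z + y) * x n - (1# - q) * previous x n ∎
          where
          prev : ∀ n → ∑₊ (λ k l → previous p k * (α 0 ^ l * 1/ l !)) n ≈ previous x n
          prev zero    = zeroˡ _
          prev (suc n) = trans (+-congʳ (zeroˡ _)) (+-identityˡ _)
          step : ∀ k l → [ suc k ] * g (suc k) l + q ^ k * [ suc l ] * g k (suc l) ≈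
            (z + y) * g k l + - (1# - q) * (previous p k * (α 0 ^ l * 1/ l !))
          step k l = begin
            [ suc k ] * (p (suc k) * (α 0 ^ l * 1/ l !)) + q ^ k * [ suc l ] * (p k * (α 0 * α 0 ^ l * 1/ suc l !))
              ≈⟨ solve 9 (λ n p f v x m p′ a g → n :* (p :* (v :* f)) :+ x :* m :* (p′ :* (a :* v :* g)) :=
                   (n :* p) :* (v :* f) :+ (x :* a) :* p′ :* (v :* (m :* g))) refl _ _ _ _ _ _ _ _ _ ⟩
            [ suc k ] * p (suc k) * (α 0 ^ l * 1/ l !) + q ^ k * α 0 * p k * (α 0 ^ l * ([ suc l ] * 1/ suc l !))
              ≈⟨ +-cong (*-congʳ (h-threeTerm k)) (*-cong (*-congʳ (sym (geometric α-suc 0 k))) (*-congˡ ([suc]*1/! l))) ⟩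
            ((z + y - α k) * p k - (1# - q) * previous p k) * (α 0 ^ l * 1/ l !) + α k * p k * (α 0 ^ l * 1/ l !)
              ≈⟨ solve 6 (λ s a p c p′ v → ((s :- a) :* p :- c :* p′) :* v :+ a :* p :* v := s :* (p :* v) :+ (:- c) :* (p′ :* v)) refl _ _ _ _ _ _ ⟩
            (z + y) * g k l + - (1# - q) * (previous p k * (α 0 ^ l * 1/ l !)) ∎

  ∑₊-single : ∀ h l i → (∀ j i′ → j ℕ.+ i′ ≡ l ℕ.+ i → j ≢ l → h j i′ ≈ 0#) → ∑₊ h (l ℕ.+ i) ≈ h l i
  ∑₊-single h zero zero    p = refl
  ∑₊-single h zero (suc i) p = trans (+-congˡ (∑₊-0 i λ j i′ eq → p (suc j) i′ (≡.cong suc eq) λ ())) (+-identityʳ _)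
  ∑₊-single h (suc l) i    p = trans (+-cong (p 0 (suc (l ℕ.+ i)) ≡.refl λ ())
    (∑₊-single (h ∘ suc) l i λ j i′ eq j≢l → p (suc j) i′ (≡.cong suc eq) (j≢l ∘ ℕ.suc-injective))) (+-identityˡ _)

  -- If Π (ϑ l) 0 j vanishes for j > l and is invertible for j = l, the expansions at the points
  -- l = 0, 1, 2, … determine the coefficients successively.
  triangular-cancel : (ϑ : ℕ → ℕ → Carrier) → (∀ l j → l < j → Π (ϑ l) 0 j ≈ 0#) → (∀ l → Unit (Π (ϑ l) 0 l)) →
    (∀ l → Unit (1/ l !)) →
    ∀ f g → (∀ l n → (ϑ l ⊙ e ⋆ f) 0 n ≈ (ϑ l ⊙ e ⋆ g) 0 n) → f ≐ g
  triangular-cancel ϑ vanish unit 1/!-unit f g p = <-rec _ step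
    where
    step : ∀ l → (∀ {j} → j < l → ∀ m → f j m ≈ g j m) → ∀ m → f l m ≈ g l m
    step l rec m = unit-cancel (1/!-unit l) (unit-cancel (unit l) (begin
      Π (ϑ l) 0 l * (1/ l ! * f l m)
        ≈⟨ solve 3 (λ a b c → a :* (b :* c) := c :+ a :* b :* c :- c) refl _ _ _ ⟩
      f l m + Π (ϑ l) 0 l * 1/ l ! * f l m - f l m
        ≈⟨ solve 4 (λ a x y f → f :+ a :* x :- f := a :* x :- a :* y :+ a :* y) refl (Π (ϑ l) 0 l * 1/ l !) (f l m) (g l m) (f l m) ⟩
      c l * f l m - c l * g l m + c l * g l m
        -- Below `l` the coefficients agree by induction, above `l` the basis products vanish, so
        -- the difference of the two expansions is its term at `l`.
        ≈⟨ +-congʳ (∑₊-single (λ j i → c j * f j i - c j * g j i) l m others) ⟨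
      ∑₊ (λ j i → c j * f j i - c j * g j i) (l ℕ.+ m) + c l * g l m
        ≈⟨ +-congʳ (∑₊-cong (λ j i → +-congˡ (solve 2 (λ a b → :- (a :* b) := (:- con (+ 1)) :* (a :* b)) refl _ _)) (l ℕ.+ m)) ⟩
      ∑₊ (λ j i → c j * f j i + (- 1#) * (c j * g j i)) (l ℕ.+ m) + c l * g l m
        ≈⟨ +-congʳ (trans (∑₊-+ _ _ (l ℕ.+ m)) (+-cong (p l (l ℕ.+ m)) (∑₊-*ˡ _ _ (l ℕ.+ m)))) ⟩
      ∑₊ (λ j i → c j * g j i) (l ℕ.+ m) + (- 1#) * ∑₊ (λ j i → c j * g j i) (l ℕ.+ m) + c l * g l m
        ≈⟨ solve 3 (λ s c g → s :+ (:- con (+ 1)) :* s :+ c :* g := c :* g) refl _ _ _ ⟩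
      c l * g l m
        ≈⟨ *-assoc _ _ _ ⟩
      Π (ϑ l) 0 l * (1/ l ! * g l m) ∎))
      where
      c : ℕ → Carrier
      c j = Π (ϑ l) 0 j * 1/ j !
      others : ∀ j i → j ℕ.+ i ≡ l ℕ.+ m → j ≢ l → c j * f j i - c j * g j i ≈ 0#
      others j i eq j≢l with ℕ.<-cmp j l
      ... | tri< j<l _ _ = trans (+-congʳ (*-congˡ (rec j<l i))) (-‿inverseʳ _)
      ... | tri≈ _ j≡l _ = contradiction j≡l j≢l
      ... | tri> _ _ l<j = trans (+-cong (*-congʳ c≈0) (-‿cong (*-congʳ c≈0))) (solve 2 (λ x y → con (+ 0) :* x :- con (+ 0) :* y := con (+ 0)) refl _ _)
        where
        c≈0 : c j ≈ 0#
        c≈0 = trans (*-congʳ (vanish l j l<j)) (zeroˡ _)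

  ⋆-cancelˡ : ∀ h {f g} → (∀ k → h k 0 ≈ 1#) → h ⋆ f ≐ h ⋆ g → f ≐ g
  ⋆-cancelˡ h {f} {g} h₀ p k m = <-rec (λ m → ∀ k → f k m ≈ g k m) step m k
    where
    step : ∀ m → (∀ {i} → i < m → ∀ k → f k i ≈ g k i) → ∀ k → f k m ≈ g k m
    step zero    rec k = trans (sym (head f k 0)) (trans (p k 0) (head g k 0))
      where
      head : ∀ f k m → h k 0 * f (k ℕ.+ 0) m ≈ f k m
      head f k m = trans (*-cong (h₀ k) (reflexive (≡.cong (λ s → f s m) (ℕ.+-identityʳ k)))) (*-identityˡ _)
    step (suc m) rec k = trans (sym (head f k (suc m))) (trans
        (+-cancelʳ _ _ _ (trans (p k (suc m)) (+-congˡ (∑₊-cong′ m λ i j eq →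
          *-congˡ (sym (rec (s≤s (≡.subst (j ≤_) eq (ℕ.m≤n+m j i))) (k ℕ.+ suc i)))))))
        (head g k (suc m)))
      where
      open GroupProperties +-group using () renaming (∙-cancelʳ to +-cancelʳ)
      head : ∀ f k m → h k 0 * f (k ℕ.+ 0) m ≈ f k m
      head f k m = trans (*-cong (h₀ k) (reflexive (≡.cong (λ s → f s m) (ℕ.+-identityʳ k)))) (*-identityˡ _)

-- Hypergeometric series as kernels, and uniqueness of the connection coefficients

module Expansion {A : Ring₀} (P : Parameters A) (Q : QFactorials A (Parameters.q P)) where
  open CommutativeRing A
  open CMSum +-commutativeMonoid using (sum; sum-cong-≋)
  open RingProperties ring using (-0#≈0#)
  open CommutativeExp commutativeSemiring using (_^_; ^-homo-*; ^-distrib-*; ^-congˡ)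
  open Units A
  open SetoidReasoning setoid
  open IntegerSolver A using (solve; con; _:=_; _:*_; _:-_; :-_)
  open Parameters P
  open QSeries A using (module Base)
  open Base q-unit
  open Identities Q hiding ([_])
  open QFactorials Q using ([_])
  open Connection Q

  q⁻¹ a⁻¹ : Carrier
  q⁻¹ = inv q-unit
  a⁻¹ = inv a-unit

  unit-^ : ∀ {x} → Unit x → ∀ n → Unit (x ^ n)
  unit-^ u zero    = mkUnit 1# (*-identityˡ 1#)
  unit-^ u (suc n) = unit-* u (unit-^ u n)

  sum-toℕ : ∀ n (g : ℕ → Carrier) (h : ℕ → ℕ → Carrier) → (∀ k i → k ℕ.+ i ≡ n → g k ≈ h k i) →
            sum {suc n} (λ k → g (toℕ k)) ≈ ∑₊ h n
  sum-toℕ zero    g h p = trans (+-identityʳ _) (p 0 0 ≡.refl)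
  sum-toℕ (suc n) g h p = +-cong (p 0 (suc n) ≡.refl) (sum-toℕ n (g ∘ suc) (h ∘ suc) λ k i eq → p (suc k) i (≡.cong suc eq))

  sum-*ˡ : ∀ {n} x (f : Fin n → Carrier) → x * sum f ≈ sum (λ i → x * f i)
  sum-*ˡ {zero}  x f = zeroʳ x
  sum-*ˡ {suc n} x f = trans (distribˡ _ _ _) (+-congˡ (sum-*ˡ x (f ∘ Fin.suc)))

  -- The hypothesis is for all inverses s of (-1)ᵏ q^(k(k-1)/2): the one used by φ has no name outside of φ.
  φ-∑₊ : ∀ N αs βs z x (t : ℕ → ℕ → Carrier) →
    (∀ k i → k ℕ.+ i ≡ N → (s : Unit ((- 1#) ^ k * q ^ (k C 2))) →
      x * (∏ᴸ (List.map (λ α → ⟨ α ⟩ k) αs)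
           * ∏ᴸ (List.map (λ (β , adm) → inv (unit-⟨⟩ {β} adm k)) ((q , q-adm) ∷ βs))
           * s ^ᶻ ((1 ℕ.+ length βs) ⊖ length αs)
           * z ^ k) ≈ t k i) →
    x * φ q-adm N αs βs z ≈ ∑₊ t N
  φ-∑₊ N αs βs z x t p = sum-suc _ _ (p 0 N ≡.refl _)
    λ k → p (suc (toℕ k)) (N ∸ suc (toℕ k)) (ℕ.m+[n∸m]≡n (toℕ<n k)) _
    where
    sum-suc : ∀ y (f : Fin N → Carrier) → x * y ≈ t 0 N →
              (∀ k → x * f k ≈ t (suc (toℕ k)) (N ∸ suc (toℕ k))) → x * (y + sum f) ≈ ∑₊ t N
    sum-suc y f p r = trans (trans (distribˡ _ _ _) (+-cong p (trans (sum-*ˡ x f) (sum-cong-≋ r))))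
      (sum-toℕ N (λ k → t k (N ∸ k)) t λ { k i ≡.refl → reflexive (≡.cong (t k) (ℕ.m+n∸m≡n k i)) })

  geo : Carrier → ℕ → Carrier
  geo x t = x * q ^ t

  geo-suc : ∀ x t → geo x (suc t) ≈ q * geo x t
  geo-suc x t = solve 3 (λ x q y → x :* (q :* y) := q :* (x :* y)) refl x q (q ^ t)

  ⟨⟩-Π : ∀ x n → ⟨ x ⟩ n ≈ Π (1- geo x) 0 n
  ⟨⟩-Π x n = ∏-Π n (1- geo x)

  unit-ratio : ∀ {x} (adm : Admissible x) k i → ⟨ x ⟩ (k ℕ.+ i) * inv (unit-⟨⟩ {x} adm k) ≈ Π (1- geo x) k i
  unit-ratio {x} adm k i = begin
    ⟨ x ⟩ (k ℕ.+ i) * u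
      ≈⟨ *-congʳ (trans (⟨⟩-Π x (k ℕ.+ i)) (trans (Π-+ _ 0 k i) (*-congʳ (sym (⟨⟩-Π x k))))) ⟩
    ⟨ x ⟩ k * Π (1- geo x) k i * u
      ≈⟨ solve 3 (λ a b c → a :* b :* c := a :* c :* b) refl _ _ _ ⟩
    ⟨ x ⟩ k * u * Π (1- geo x) k i
      ≈⟨ trans (*-congʳ (Unit.inverse (unit-⟨⟩ {x} adm k))) (*-identityˡ _) ⟩
    Π (1- geo x) k i ∎
    where u = inv (unit-⟨⟩ {x} adm k)

  q*q⁻¹ : q * q⁻¹ ≈ 1#
  q*q⁻¹ = Unit.inverse q-unit

  q^*q⁻¹^ : ∀ n → q ^ n * q⁻¹ ^ n ≈ 1#
  q^*q⁻¹^ = ^-inverse q*q⁻¹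

  -q⁻ : ℕ → Carrier
  -q⁻ s = - q⁻¹ ^ s

  -- (q⁻ⁿ;q)ₖ qᵏ / (q;q)ₖ in terms of q-factorials.
  lowerFactorial : ∀ k i → 1/ (k ℕ.+ i) ! * ⟨ q⁻¹ ^ (k ℕ.+ i) ⟩ k * q ^ k * inv (unit-⟨⟩ {q} q-adm k) ≈
                   Π -q⁻ i k * (1/ k ! * 1/ i !)
  lowerFactorial k i = begin
    1/ (k ℕ.+ i) ! * ⟨ q⁻¹ ^ (k ℕ.+ i) ⟩ k * q ^ k * u
      ≈⟨ *-congʳ (falling k) ⟩
    Π (λ s → -q⁻ s * (1# - q)) i k * 1/ i ! * u
      ≈⟨ *-congʳ (*-congʳ (trans (Π-* -q⁻ (λ _ → 1# - q) i k) (*-congˡ (trans (Π-const _ i k) (sym (Π-const _ 0 k)))))) ⟩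
    Π -q⁻ i k * Π (λ _ → 1# - q) 0 k * 1/ i ! * u
      ≈⟨ solve 4 (λ a b c d → a :* b :* c :* d := a :* (b :* d :* c)) refl _ _ _ _ ⟩
    Π -q⁻ i k * (Π (λ _ → 1# - q) 0 k * u * 1/ i !)
      ≈⟨ *-congˡ (*-congʳ (begin
           Π (λ _ → 1# - q) 0 k * u      ≈⟨ *-congʳ (sym (rising k)) ⟩
           ⟨ q ⟩ k * 1/ k ! * u          ≈⟨ solve 3 (λ a b c → a :* b :* c := a :* c :* b) refl _ _ _ ⟩
           ⟨ q ⟩ k * u * 1/ k !          ≈⟨ trans (*-congʳ (Unit.inverse (unit-⟨⟩ {q} q-adm k))) (*-identityˡ _) ⟩
           1/ k !                        ∎)) ⟩
    Π -q⁻ i k * (1/ k ! * 1/ i !) ∎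
    where
    u = inv (unit-⟨⟩ {q} q-adm k)
    rising : ∀ k → ⟨ q ⟩ k * 1/ k ! ≈ Π (λ _ → 1# - q) 0 k
    rising k = trans (*-congʳ (⟨⟩-Π q k)) (go k)
      where
      go : ∀ k → Π (1- geo q) 0 k * 1/ k ! ≈ Π (λ _ → 1# - q) 0 k
      go zero    = trans (*-identityˡ _) 1/0!
      go (suc k) = begin
        Π (1- geo q) 0 (suc k) * 1/ suc k !                     ≈⟨ *-congʳ (Π-sucʳ (1- geo q) 0 k) ⟩
        Π (1- geo q) 0 k * (1# - q ^ suc k) * 1/ suc k !        ≈⟨ *-congʳ (*-congˡ ([1-q]*[] (suc k))) ⟨
        Π (1- geo q) 0 k * ((1# - q) * [ suc k ]) * 1/ suc k !  ≈⟨ solve 4 (λ p c n f → p :* (c :* n) :* f := p :* (n :* f) :* c) refl _ _ _ _ ⟩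
        Π (1- geo q) 0 k * ([ suc k ] * 1/ suc k !) * (1# - q)  ≈⟨ *-congʳ (trans (*-congˡ ([suc]*1/! k)) (go k)) ⟩
        Π (λ _ → 1# - q) 0 k * (1# - q)                         ≈⟨ Π-sucʳ (λ _ → 1# - q) 0 k ⟨
        Π (λ _ → 1# - q) 0 (suc k)                              ∎
    falling : ∀ k → 1/ (k ℕ.+ i) ! * ⟨ q⁻¹ ^ (k ℕ.+ i) ⟩ k * q ^ k ≈ Π (λ s → -q⁻ s * (1# - q)) i k * 1/ i !
    falling zero    = trans (*-identityʳ _) (trans (*-identityʳ _) (sym (*-identityˡ _)))
    falling (suc k) = begin
      1/ suc n ! * ⟨ q⁻¹ ^ suc n ⟩ (suc k) * q ^ suc k
        ≈⟨ *-congʳ (*-congˡ (trans (⟨⟩-Π _ (suc k)) (*-congˡ (trans (sym (Π-shift _ 1 0 k))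
             (trans (Π-cong shift 0 k) (sym (⟨⟩-Π _ k))))))) ⟩
      1/ suc n ! * ((1# - q⁻¹ ^ suc n * 1#) * ⟨ q⁻¹ ^ n ⟩ k) * q ^ suc k
        ≈⟨ solve 6 (λ f y x q p z → f :* ((con (+ 1) :- (y :* x) :* con (+ 1)) :* p) :* (q :* z) := (q :- (q :* y) :* x) :* f :* (p :* z)) refl _ q⁻¹ (q⁻¹ ^ n) q _ (q ^ k) ⟩
      (q - q * q⁻¹ * q⁻¹ ^ n) * 1/ suc n ! * (⟨ q⁻¹ ^ n ⟩ k * q ^ k)
        -- The new factor is `q - q⁻ⁿ = - q⁻ⁿ (1 - q) [n + 1]`, and its `[n + 1]` lowers the
        -- factorial.
        ≈⟨ *-congʳ (*-congʳ (begin
             q - q * q⁻¹ * q⁻¹ ^ n            ≈⟨ +-cong (sym (trans (*-congˡ (q^*q⁻¹^ n)) (*-identityʳ q))) (-‿cong (trans (*-congʳ q*q⁻¹) (*-identityˡ _))) ⟩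
             q * (q ^ n * q⁻¹ ^ n) - q⁻¹ ^ n  ≈⟨ solve 3 (λ q x y → q :* (x :* y) :- y := (:- y) :* (con (+ 1) :- q :* x)) refl _ _ _ ⟩
             -q⁻ n * (1# - q ^ suc n)         ≈⟨ *-congˡ ([1-q]*[] (suc n)) ⟨
             -q⁻ n * ((1# - q) * [ suc n ])   ∎)) ⟩
      -q⁻ n * ((1# - q) * [ suc n ]) * 1/ suc n ! * (⟨ q⁻¹ ^ n ⟩ k * q ^ k)
        ≈⟨ solve 6 (λ y c n f p x → y :* (c :* n) :* f :* (p :* x) := (n :* f) :* p :* x :* (y :* c)) refl _ _ _ _ _ _ ⟩
      [ suc n ] * 1/ suc n ! * ⟨ q⁻¹ ^ n ⟩ k * q ^ k * (-q⁻ n * (1# - q))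
        ≈⟨ *-congʳ (trans (*-congʳ (*-congʳ ([suc]*1/! n))) (falling k)) ⟩
      Π (λ s → -q⁻ s * (1# - q)) i k * 1/ i ! * (-q⁻ n * (1# - q))
        ≈⟨ solve 3 (λ a b c → a :* b :* c := a :* c :* b) refl _ _ _ ⟩
      Π (λ s → -q⁻ s * (1# - q)) i k * (-q⁻ n * (1# - q)) * 1/ i !
        ≈⟨ *-congʳ (*-congˡ (reflexive (≡.cong (λ s → -q⁻ s * (1# - q)) (ℕ.+-comm k i)))) ⟩
      Π (λ s → -q⁻ s * (1# - q)) i k * (-q⁻ (i ℕ.+ k) * (1# - q)) * 1/ i !
        ≈⟨ *-congʳ (Π-sucʳ (λ s → -q⁻ s * (1# - q)) i k) ⟨
      Π (λ s → -q⁻ s * (1# - q)) i (suc k) * 1/ i ! ∎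
      where
      n = k ℕ.+ i
      shift : ∀ t → 1# - q⁻¹ ^ suc n * q ^ suc t ≈ 1# - q⁻¹ ^ n * q ^ t
      shift t = +-congˡ (-‿cong (trans (solve 4 (λ a b c d → (a :* b) :* (c :* d) := (c :* a) :* (b :* d)) refl _ _ _ _)
        (trans (*-congʳ q*q⁻¹) (*-identityˡ _))))

  Π-q⁻ : ∀ k i → Π -q⁻ i k ≈ (q⁻¹ ^ k) ^ i * Π -q⁻ 0 k
  Π-q⁻ k zero    = sym (*-identityˡ _)
  Π-q⁻ k (suc i) = begin
    Π -q⁻ (suc i) k                          ≈⟨ Π-geometric (λ t → solve 2 (λ y x → :- (y :* x) := y :* (:- x)) refl _ _) i k ⟩
    q⁻¹ ^ k * Π -q⁻ i k                      ≈⟨ *-congˡ (Π-q⁻ k i) ⟩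
    q⁻¹ ^ k * ((q⁻¹ ^ k) ^ i * Π -q⁻ 0 k)    ≈⟨ *-assoc _ _ _ ⟨
    (q⁻¹ ^ k) ^ suc i * Π -q⁻ 0 k            ∎

  -- `q-unit ^ᶻ (0 ⊖ 1)` is `q⁻¹`. Hence `W t` is `abcdqᵗ⁻¹`, and this one sequence serves the
  -- denominators of all degrees.
  ξ α AB AC AD BC W r : ℕ → Carrier
  ξ t = a⁻¹ * q⁻¹ ^ t
  α = geo a
  AB = geo (a * b)
  AC = geo (a * c)
  AD = geo (a * d)
  BC = geo (b * c)
  W = geo (a * b * c * d * q-unit ^ᶻ (0 ⊖ 1))
  r t = inv (abcd-adm 0 t)

  q^ᶻ[n-1] : ∀ n → q-unit ^ᶻ (n ⊖ 1) ≈ q-unit ^ᶻ (0 ⊖ 1) * q ^ n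
  q^ᶻ[n-1] zero    = sym (*-identityʳ _)
  q^ᶻ[n-1] (suc n) = begin
    q ^ n                     ≈⟨ trans (*-congʳ q*q⁻¹) (*-identityˡ _) ⟨
    q * q⁻¹ * q ^ n           ≈⟨ solve 3 (λ q y x → q :* y :* x := y :* con (+ 1) :* (q :* x)) refl _ _ _ ⟩
    q⁻¹ * 1# * (q * q ^ n)    ∎

  module _ {z : Carrier} (z-unit : Unit z) where
    open AskeyWilson P using (½^_)

    y : Carrier
    y = inv z-unit

    zy≈1 : z * y ≈ 1#
    zy≈1 = Unit.inverse z-unit

    α-suc : ∀ t → α (suc t) ≈ q * α t
    α-suc = geo-suc a

    ξ-suc : ∀ t → q * ξ (suc t) ≈ ξ t
    ξ-suc t = trans (solve 4 (λ q a y x → q :* (a :* (y :* x)) := (q :* y) :* (a :* x)) refl q a⁻¹ q⁻¹ (q⁻¹ ^ t))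
      (trans (*-congʳ q*q⁻¹) (*-identityˡ _))

    ξ*α : ∀ t → ξ t * α t ≈ 1#
    ξ*α t = trans (solve 4 (λ a y b x → (a :* y) :* (b :* x) := (b :* a) :* (x :* y)) refl a⁻¹ (q⁻¹ ^ t) a (q ^ t))
      (trans (*-cong (Unit.inverse a-unit) (q^*q⁻¹^ t)) (*-identityˡ _))

    ϑ : ℕ → Carrier
    ϑ = θ zy≈1 α-suc ξ-suc ξ*α

    poly : ℕ → Carrier
    poly n = (ϑ ⊙ e ⋆ AW ξ AB AC AD r) 0 n

    -- Each quotient of shifted factorials of lengths `n` and `k` becomes a product over
    -- `k ≤ t < n`, as in the entries of `AW`. The factor `(az, a/z; q)ₖ` goes with `a⁻ᵏ` and the
    -- signs into `Π ϑ 0 k`.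
    1/!*p : ∀ n → 1/ n ! * AskeyWilson.p P z-unit n ≈ ½^ n * poly n
    1/!*p n = trans (sym (*-assoc _ _ _)) (trans
      (φ-∑₊ n (q-unit ^ᶻ (ℤ.- + n) ∷ A_ n ∷ a * z ∷ a * y ∷ []) ((a * b , ab-adm) ∷ (a * c , ac-adm) ∷ (a * d , ad-adm) ∷ []) q _
        (λ k i → ½^ n * (Π ϑ 0 k * 1/ k ! * AW ξ AB AC AD r k i)) term)
      (∑₊-*ˡ _ (λ k i → Π ϑ 0 k * 1/ k ! * AW ξ AB AC AD r k i) n))
      where
      A_ : ℕ → Carrier
      A_ = AskeyWilson.abcdqⁿ⁻¹ P z-unit
      geo-A : ∀ n t → geo (A_ n) t ≈ W (n ℕ.+ t)
      geo-A n t = trans (*-congʳ (*-congˡ (q^ᶻ[n-1] n)))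
        (trans (solve 4 (λ a b x y → a :* (b :* x) :* y := a :* b :* (x :* y)) refl _ _ _ _) (*-congˡ (sym (^-homo-* q n t))))
      term : ∀ k i → k ℕ.+ i ≡ n → (s : Unit ((- 1#) ^ k * q ^ (k C 2))) → _ ≈ _
      term k i ≡.refl s = begin
        1/ n ! * (⟨ a * b ⟩ n * ⟨ a * c ⟩ n * ⟨ a * d ⟩ n * ½^ n * a⁻¹ ^ n * inv uA) *
          (⟨ q-unit ^ᶻ (ℤ.- + n) ⟩ k * (⟨ A_ n ⟩ k * (⟨ a * z ⟩ k * (⟨ a * y ⟩ k * 1#)))
            * (iq * (iab * (iac * (iad * 1#)))) * 1# * q ^ k)
          ≈⟨ *-congˡ (*-congʳ (*-congʳ (*-congʳ (*-congʳ (reflexive (≡.cong (λ x → ⟨ x ⟩ k) (q^ᶻ- n))))))) ⟩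
        1/ n ! * (⟨ a * b ⟩ n * ⟨ a * c ⟩ n * ⟨ a * d ⟩ n * ½^ n * a⁻¹ ^ n * inv uA) *
          (⟨ q⁻¹ ^ n ⟩ k * (⟨ A_ n ⟩ k * (⟨ a * z ⟩ k * (⟨ a * y ⟩ k * 1#)))
            * (iq * (iab * (iac * (iad * 1#)))) * 1# * q ^ k)
          ≈⟨ solve 16 (λ f ab ac ad h x A q B u v iq iab iac iad Q →
               f :* (ab :* ac :* ad :* h :* x :* A) :* (q :* (B :* (u :* (v :* con (+ 1)))) :*
                 (iq :* (iab :* (iac :* (iad :* con (+ 1))))) :* con (+ 1) :* Q) :=
               h :* ((f :* q :* Q :* iq) :* ((ab :* iab) :* (ac :* iac) :* (ad :* iad)) :* (B :* A) :* (x :* (u :* v))))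
               refl _ _ _ _ _ _ _ _ _ _ _ _ _ _ _ _ ⟩
        ½^ n * ((1/ n ! * ⟨ q⁻¹ ^ n ⟩ k * q ^ k * iq) * (⟨ a * b ⟩ n * iab * (⟨ a * c ⟩ n * iac) * (⟨ a * d ⟩ n * iad))
               * (⟨ A_ n ⟩ k * inv uA) * (a⁻¹ ^ n * (⟨ a * z ⟩ k * ⟨ a * y ⟩ k)))
          ≈⟨ *-congˡ (*-cong (*-cong (*-cong (trans (lowerFactorial k i) (*-congʳ (Π-q⁻ k i)))
               (*-cong (*-cong (unit-ratio ab-adm k i) (unit-ratio ac-adm k i)) (unit-ratio ad-adm k i))) upper)
               (*-cong (^-homo-* a⁻¹ k i) (*-cong (az z) (az y)))) ⟩
        ½^ n * ((q⁻¹ ^ k) ^ i * Π -q⁻ 0 k * (1/ k ! * 1/ i !) * (Π (1- AB) k i * Π (1- AC) k i * Π (1- AD) k i)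
               * Π r (i ℕ.+ (k ℕ.+ k)) i * (a⁻¹ ^ k * a⁻¹ ^ i * (Π (λ t → 1# - α t * z) 0 k * Π (λ t → 1# - α t * y) 0 k)))
          ≈⟨ *-congˡ (solve 10 (λ y p f g X R x w u v →
               y :* p :* (f :* g) :* X :* R :* (x :* w :* (u :* v)) := p :* x :* (u :* v) :* f :* (w :* y :* X :* R :* g))
               refl _ _ _ _ _ _ _ _ _ _) ⟩
        ½^ n * (Π -q⁻ 0 k * a⁻¹ ^ k * (Π (λ t → 1# - α t * z) 0 k * Π (λ t → 1# - α t * y) 0 k) * 1/ k ! *
               (a⁻¹ ^ i * (q⁻¹ ^ k) ^ i * (Π (1- AB) k i * Π (1- AC) k i * Π (1- AD) k i) * Π r (i ℕ.+ (k ℕ.+ k)) i * 1/ i !))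
          ≈⟨ *-congˡ (*-cong (*-congʳ Π-ϑ) (*-congʳ (*-congʳ (*-congʳ (^-distrib-* a⁻¹ (q⁻¹ ^ k) i))))) ⟨
        ½^ n * (Π ϑ 0 k * 1/ k ! * AW ξ AB AC AD r k i) ∎
        where
        uA = unit-⟨⟩ {A_ n} (abcd-adm n) n
        iq = inv (unit-⟨⟩ {q} q-adm k)
        iab = inv (unit-⟨⟩ {a * b} ab-adm k)
        iac = inv (unit-⟨⟩ {a * c} ac-adm k)
        iad = inv (unit-⟨⟩ {a * d} ad-adm k)
        q^ᶻ- : ∀ n → q-unit ^ᶻ (ℤ.- + n) ≡ q⁻¹ ^ n
        q^ᶻ- zero    = ≡.refl
        q^ᶻ- (suc n) = ≡.refl
        az : ∀ x → ⟨ a * x ⟩ k ≈ Π (λ t → 1# - α t * x) 0 k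
        az x = trans (⟨⟩-Π (a * x) k) (Π-cong (λ t → +-congˡ (-‿cong
          (solve 3 (λ a x y → a :* x :* y := a :* y :* x) refl a x (q ^ t)))) 0 k)
        Π-ϑ : Π ϑ 0 k ≈ Π -q⁻ 0 k * a⁻¹ ^ k * (Π (λ t → 1# - α t * z) 0 k * Π (λ t → 1# - α t * y) 0 k)
        Π-ϑ = trans (Π-* _ _ 0 k) (*-cong
          (trans (Π-cong (λ t → solve 2 (λ a x → :- (a :* x) := (:- x) :* a) refl a⁻¹ (q⁻¹ ^ t)) 0 k)
            (trans (Π-* -q⁻ (λ _ → a⁻¹) 0 k) (*-congˡ (Π-const a⁻¹ 0 k))))
          (Π-* _ _ 0 k))
        -- For `A = abcdqⁿ⁻¹`, the quotient of `(A;q)ₖ` by `(A;q)ₙ` leaves the reciprocals of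
        -- `1 - W t` for `n + k ≤ t < 2n`.
        upper : ⟨ A_ n ⟩ k * inv uA ≈ Π r (i ℕ.+ (k ℕ.+ k)) i
        upper = begin
          ⟨ A_ n ⟩ k * inv uA
            ≈⟨ trans (*-congˡ (trans (*-congʳ (Π-inverse (λ t → Unit.inverse (abcd-adm 0 t)) s′ i)) (*-identityˡ _))) refl ⟨
          ⟨ A_ n ⟩ k * (Π (1- W) s′ i * Π r s′ i * inv uA)
            ≈⟨ solve 4 (λ x w r u → x :* (w :* r :* u) := x :* w :* u :* r) refl _ _ _ _ ⟩
          ⟨ A_ n ⟩ k * Π (1- W) s′ i * inv uA * Π r s′ i
            ≈⟨ *-congʳ (*-congʳ (begin
                 ⟨ A_ n ⟩ k * Π (1- W) s′ i
                   ≈⟨ *-cong (A-Π k) (reflexive (≡.cong (λ x → Π (1- W) x i) s′≡)) ⟩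
                 Π (1- W) (n ℕ.+ 0) k * Π (1- W) (n ℕ.+ 0 ℕ.+ k) i
                   ≈⟨ Π-+ (1- W) (n ℕ.+ 0) k i ⟨
                 Π (1- W) (n ℕ.+ 0) n
                   ≈⟨ A-Π n ⟨
                 ⟨ A_ n ⟩ n ∎)) ⟩
          ⟨ A_ n ⟩ n * inv uA * Π r s′ i
            ≈⟨ trans (*-congʳ (Unit.inverse uA)) (*-identityˡ _) ⟩
          Π r s′ i ∎
          where
          s′ = i ℕ.+ (k ℕ.+ k)
          s′≡ : s′ ≡ n ℕ.+ 0 ℕ.+ k
          s′≡ = ≡.trans (≡.sym (ℕ.+-assoc i k k)) (≡.cong (ℕ._+ k) (≡.trans (ℕ.+-comm i k) (≡.sym (ℕ.+-identityʳ n))))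
          A-Π : ∀ m → ⟨ A_ n ⟩ m ≈ Π (1- W) (n ℕ.+ 0) m
          A-Π m = trans (⟨⟩-Π _ m) (trans (Π-cong (λ t → +-congˡ (-‿cong (geo-A n t))) 0 m) (Π-shift (1- W) n 0 m))

    1/!*H : ∀ n → 1/ n ! * AskeyWilson.H P z-unit n ≈ ½^ n * rogersSzegő y z n
    1/!*H n = trans (sym (*-assoc _ _ _)) (trans
      (φ-∑₊ n (q-unit ^ᶻ (ℤ.- + n) ∷ 0# ∷ []) [] _ _ (λ k i → ½^ n * (y ^ k * 1/ k ! * (z ^ i * 1/ i !))) term)
      (∑₊-*ˡ _ (λ k i → y ^ k * 1/ k ! * (z ^ i * 1/ i !)) n))
      where
      C-suc : ∀ k → suc k C 2 ≡ k ℕ.+ k C 2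
      C-suc k = ≡.trans (≡.sym (nCk+nC[k+1]≡[n+1]C[k+1] k 1)) (≡.cong (ℕ._+ k C 2) (nC1≡n k))
      -- The exponent `(1 + 0) ⊖ 2` in `φ` is -1, so the series is divided by `(-1)ᵏ q^(k(k-1)/2)`.
      -- The powers of `q` from `(q⁻ⁿ;q)ₖ` and from the argument compensate exactly this.
      signs : ∀ k i → (q ^ (k ℕ.+ i)) ^ k * Π -q⁻ i k ≈ q ^ k * ((- 1#) ^ k * q ^ (k C 2))
      signs zero    i = solve 0 (con (+ 1) :* con (+ 1) := con (+ 1) :* (con (+ 1) :* con (+ 1))) refl
      signs (suc k) i = begin
        q * q ^ n′ * (q * q ^ n′) ^ k * Π -q⁻ i (suc k)
          ≈⟨ *-cong (*-congˡ (^-distrib-* q (q ^ n′) k)) (Π-sucʳ -q⁻ i k) ⟩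
        q * q ^ n′ * (q ^ k * (q ^ n′) ^ k) * (Π -q⁻ i k * -q⁻ (i ℕ.+ k))
          ≡⟨ ≡.cong (λ x → q * q ^ n′ * (q ^ k * (q ^ n′) ^ k) * (Π -q⁻ i k * -q⁻ x)) (ℕ.+-comm i k) ⟩
        q * q ^ n′ * (q ^ k * (q ^ n′) ^ k) * (Π -q⁻ i k * -q⁻ n′)
          ≈⟨ solve 6 (λ q x y z p w → q :* x :* (y :* z) :* (p :* (:- w)) := (:- (q :* y)) :* (x :* w) :* (z :* p)) refl q (q ^ n′) _ _ _ _ ⟩
        - (q * q ^ k) * (q ^ n′ * q⁻¹ ^ n′) * ((q ^ n′) ^ k * Π -q⁻ i k)
          ≈⟨ *-cong (trans (*-congˡ (q^*q⁻¹^ n′)) (*-identityʳ _)) (signs k i) ⟩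
        - (q * q ^ k) * (q ^ k * ((- 1#) ^ k * q ^ (k C 2)))
          ≈⟨ solve 4 (λ q x s c → (:- (q :* x)) :* (x :* (s :* c)) := q :* x :* ((:- con (+ 1)) :* s :* (x :* c))) refl q (q ^ k) _ _ ⟩
        q ^ suc k * ((- 1#) ^ suc k * (q ^ k * q ^ (k C 2)))
          ≈⟨ *-congˡ (*-congˡ (trans (sym (^-homo-* q k (k C 2))) (reflexive (≡.cong (q ^_) (≡.sym (C-suc k)))))) ⟩
        q ^ suc k * ((- 1#) ^ suc k * q ^ (suc k C 2)) ∎
        where n′ = k ℕ.+ i
      term : ∀ k i → k ℕ.+ i ≡ n → (s : Unit ((- 1#) ^ k * q ^ (k C 2))) → _ ≈ _
      -- The factor `qᵏ` is borrowed because `lowerFactorial` includes the argument `q` of the ₄φ₃,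
      -- which this series lacks.
      term k i ≡.refl s = unit-cancel (unit-^ q-unit k) (begin
        q ^ k * (1/ n ! * (z ^ n * ½^ n) *
          (⟨ q-unit ^ᶻ (ℤ.- + n) ⟩ k * (⟨ 0# ⟩ k * 1#) * (iq * 1#) * (inv s * 1#) * (q ^ n * y ^ 2) ^ k))
          ≈⟨ *-congˡ (*-cong (*-congˡ (*-congʳ (^-homo-* z k i))) (*-cong (*-congʳ (*-congʳ (*-cong
               (reflexive (≡.cong (λ x → ⟨ x ⟩ k) (q^ᶻ- n))) (trans (*-identityʳ _) ⟨0⟩))))
               (trans (^-distrib-* (q ^ n) (y ^ 2) k) (*-congˡ y²)))) ⟩
        q ^ k * (1/ n ! * (z ^ k * z ^ i * ½^ n) *
          (⟨ q⁻¹ ^ n ⟩ k * 1# * (iq * 1#) * (inv s * 1#) * ((q ^ n) ^ k * (y ^ k * y ^ k))))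
          ≈⟨ solve 10 (λ x f u v h p iq s w y → x :* (f :* (u :* v :* h) :* (p :* con (+ 1) :* (iq :* con (+ 1)) :* (s :* con (+ 1)) :* (w :* (y :* y)))) :=
               (f :* p :* x :* iq) :* ((u :* y) :* h :* v :* y :* (w :* s))) refl _ _ _ _ _ _ _ _ _ _ ⟩
        1/ n ! * ⟨ q⁻¹ ^ n ⟩ k * q ^ k * iq * (z ^ k * y ^ k * ½^ n * z ^ i * y ^ k * ((q ^ n) ^ k * inv s))
          ≈⟨ *-cong (lowerFactorial k i) (*-congʳ (*-congʳ (*-congʳ (trans (*-congʳ (^-inverse zy≈1 k)) (*-identityˡ _))))) ⟩
        Π -q⁻ i k * (1/ k ! * 1/ i !) * (½^ n * z ^ i * y ^ k * ((q ^ n) ^ k * inv s))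
          ≈⟨ solve 8 (λ p f g h u v w s → p :* (f :* g) :* (h :* u :* v :* (w :* s)) := (w :* p) :* s :* (h :* (v :* f :* (u :* g)))) refl _ _ _ _ _ _ _ _ ⟩
        (q ^ n) ^ k * Π -q⁻ i k * inv s * (½^ n * (y ^ k * 1/ k ! * (z ^ i * 1/ i !)))
          ≈⟨ *-congʳ (trans (*-congʳ (signs k i)) (trans (*-assoc _ _ _) (trans (*-congˡ (Unit.inverse s)) (*-identityʳ _)))) ⟩
        q ^ k * (½^ n * (y ^ k * 1/ k ! * (z ^ i * 1/ i !))) ∎)
        where
        iq = inv (unit-⟨⟩ {q} q-adm k)
        q^ᶻ- : ∀ n → q-unit ^ᶻ (ℤ.- + n) ≡ q⁻¹ ^ n
        q^ᶻ- zero    = ≡.refl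
        q^ᶻ- (suc n) = ≡.refl
        y² : (y ^ 2) ^ k ≈ y ^ k * y ^ k
        y² = trans (^-congˡ k (*-congˡ (*-identityʳ y))) (^-distrib-* y y k)
        ⟨0⟩ : ⟨ 0# ⟩ k ≈ 1#
        ⟨0⟩ = trans (⟨⟩-Π 0# k) (trans (Π-cong (λ t → trans (+-congˡ (trans (-‿cong (zeroˡ _)) -0#≈0#)) (+-identityʳ _)) 0 k) (Π-1 0 k))

  chain : Kernel
  chain = transition d AB AC BC r ⋆ (transition c AB 0s 0s 1s ⋆ (transition b 0s 0s 0s 1s ⋆ (λ _ → a) ⊙ e))

  AW⋆chain : AW ξ AB AC AD r ⋆ chain ≐ AW₀ ξ 0s 0s ⋆ (λ _ → a) ⊙ e
  AW⋆chain =
    ≐-sym (⋆-assoc (AW ξ AB AC AD r) T₄ (T₃ ⋆ (T₂ ⋆ T₁))) ≐∙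
    ⋆-congʳ (T₃ ⋆ (T₂ ⋆ T₁)) (AW⋆transition (geo-suc (a * d)) (geo-suc (b * c)) (geo-suc _) AD*BC
      (λ t → Unit.inverse (abcd-adm 0 t)) (ξ*geo d)) ≐∙
    ≐-sym (⋆-assoc (AW₀ ξ AB AC) T₃ (T₂ ⋆ T₁)) ≐∙
    -- The next transition removes the parameter in the second place, so `AB` is moved there.
    ⋆-congʳ (T₂ ⋆ T₁) (AW₀⋆transition (geo-suc (a * c)) (ξ*geo c) ≐∙ AW₀-comm ξ AB 0s) ≐∙
    ≐-sym (⋆-assoc (AW₀ ξ 0s AB) T₂ T₁) ≐∙
    ⋆-congʳ T₁ (AW₀⋆transition (geo-suc (a * b)) (ξ*geo b))
    where
    T₄ = transition d AB AC BC r
    T₃ = transition c AB 0s 0s 1s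
    T₂ = transition b 0s 0s 0s 1s
    T₁ = (λ _ → a) ⊙ e
    ξ*geo : ∀ x t → ξ t * geo (a * x) t ≈ x
    ξ*geo x t = trans (solve 5 (λ i y a x q → (i :* y) :* (a :* x :* q) := (a :* i) :* (q :* y) :* x) refl a⁻¹ (q⁻¹ ^ t) a x (q ^ t))
      (trans (*-congʳ (trans (*-cong (Unit.inverse a-unit) (q^*q⁻¹^ t)) (*-identityˡ _))) (*-identityˡ x))
    AD*BC : ∀ i j → AD i * BC j ≈ W (suc (i ℕ.+ j))
    AD*BC i j = begin
      a * d * q ^ i * (b * c * q ^ j)
        ≈⟨ trans (*-congʳ q*q⁻¹) (*-identityˡ _) ⟨
      q * q⁻¹ * (a * d * q ^ i * (b * c * q ^ j))
        ≈⟨ solve 8 (λ a b c d x y q i → q :* i :* (a :* d :* x :* (b :* c :* y)) := a :* b :* c :* d :* (i :* con (+ 1)) :* (q :* (x :* y)))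
             refl a b c d (q ^ i) (q ^ j) q q⁻¹ ⟩
      a * b * c * d * (q⁻¹ * 1#) * (q * (q ^ i * q ^ j))
        ≈⟨ *-congˡ (*-congˡ (^-homo-* q i j)) ⟨
      W (suc (i ℕ.+ j)) ∎

  Π-vanishes : ∀ {g} l j → g l ≈ 0# → l < j → Π g 0 j ≈ 0#
  Π-vanishes {g} l (suc j) p l<1+j with ℕ.m≤n⇒m<n∨m≡n (ℕ.s≤s⁻¹ l<1+j)
  ... | inj₁ l<j    = trans (Π-sucʳ g 0 j) (trans (*-congʳ (Π-vanishes l j p l<j)) (zeroˡ _))
  ... | inj₂ ≡.refl = trans (Π-sucʳ g 0 j) (trans (*-congˡ p) (zeroʳ _))

  Π-unit : ∀ {g} l → (∀ t → t < l → Unit (g t)) → Unit (Π g 0 l)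
  Π-unit zero    u = mkUnit 1# (*-identityˡ 1#)
  Π-unit {g} (suc l) u = unit-resp (sym (Π-sucʳ g 0 l))
    (unit-* (Π-unit l λ t t<l → u t (ℕ.m<n⇒m<1+n t<l)) (u l ℕ.≤-refl))

  module _ (aa-adm : Admissible (a * a)) where

    -- At `z = aqˡ` the factor of `(a/z;q)ⱼ` with index `l` is zero and the earlier ones are
    -- `1 - q⁻ˢ` with `s > 0`. The factors of `(az;q)ⱼ` are of the form `1 - a²qⁱ`, which `aa-adm`
    -- makes invertible.
    point : ∀ l → Unit (a * q ^ l)
    point l = unit-* a-unit (unit-^ q-unit l)

    unit-neg : ∀ {x} → Unit x → Unit (- x)
    unit-neg {x} (mkUnit x⁻¹ p) = mkUnit (- x⁻¹) (trans (solve 2 (λ x y → (:- x) :* (:- y) := x :* y) refl x x⁻¹) p)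

    inv-point : ∀ l t s → t ℕ.+ s ≡ l → α t * inv (point l) ≈ inv (unit-^ q-unit s)
    inv-point l t s ≡.refl = unit-cancel (unit-^ q-unit s) (unit-cancel (point t) (begin
      α t * (q ^ s * (α t * inv (point l)))       ≈⟨ solve 4 (λ a x y z → a :* x :* (y :* (a :* x :* z)) := a :* x :* (a :* (x :* y) :* z)) refl a (q ^ t) (q ^ s) _ ⟩
      α t * (a * (q ^ t * q ^ s) * inv (point l)) ≈⟨ *-congˡ (*-congʳ (*-congˡ (^-homo-* q t s))) ⟨
      α t * (α l * inv (point l))                 ≈⟨ *-congˡ (trans (Unit.inverse (point l)) (sym (Unit.inverse (unit-^ q-unit s)))) ⟩
      α t * (q ^ s * inv (unit-^ q-unit s))       ∎))

    ϑ-vanishes : ∀ l → ϑ (point l) l ≈ 0#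
    ϑ-vanishes l = trans (*-congˡ (trans (*-congˡ (trans (+-congˡ (-‿cong (Unit.inverse (point l)))) (-‿inverseʳ 1#))) (zeroʳ _))) (zeroʳ _)

    ϑ-unit : ∀ l t → t < l → Unit (ϑ (point l) t)
    ϑ-unit l t t<l with s , ≡.refl ← ℕ.m≤n⇒∃[o]m+o≡n t<l = unit-*
      (unit-neg (unit-* (unit-inv a-unit) (unit-^ (unit-inv q-unit) t)))
      (unit-*
        (unit-resp (+-congˡ (-‿cong (trans (*-congˡ (^-homo-* q t l))
          (solve 3 (λ a x y → a :* a :* (x :* y) := a :* x :* (a :* y)) refl a (q ^ t) (q ^ l))))) (aa-adm (t ℕ.+ l)))
        (unit-resp (+-congˡ (-‿cong (sym (inv-point l t (suc s) (ℕ.+-suc t s))))) 1-q⁻ˢ))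
      where
      v = unit-^ q-unit (suc s)
      1-q⁻ˢ : Unit (1# - inv v)
      1-q⁻ˢ = unit-resp (begin
        - inv v * (1# - q * q ^ s)        ≈⟨ solve 2 (λ v x → (:- v) :* (con (+ 1) :- x) := x :* v :- v) refl _ _ ⟩
        q ^ suc s * inv v - inv v         ≈⟨ +-congʳ (Unit.inverse v) ⟩
        1# - inv v                        ∎) (unit-* (unit-neg (unit-inv v)) (q-adm s))

    -- Two expansions of the q-Hermite polynomials in the basis `Π ϑ 0 j` are compared. The
    -- evaluation points separate the coefficients, and then `AW` is cancelled by its unit diagonal.
    connection-chain : ∀ σ → AskeyWilson.IsConnection P σ →
      ∀ k m → (1# + 1#) ^ m * σ (k ℕ.+ m) k * (1/ (k ℕ.+ m) ! * factorial k) ≈ chain k m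
    connection-chain σ σ-connection = ⋆-cancelˡ (AW ξ AB AC AD r) AW-diagonal
      (triangular-cancel (λ l → ϑ (point l)) (λ l j → Π-vanishes l j (ϑ-vanishes l)) (λ l → Π-unit l (ϑ-unit l)) 1/!-unit _ _ same)
      where
      open AskeyWilson P using (½^_; IsConnection)
      σ̂ : Kernel
      σ̂ k m = (1# + 1#) ^ m * σ (k ℕ.+ m) k * (1/ (k ℕ.+ m) ! * factorial k)
      AW-diagonal : ∀ k → AW ξ AB AC AD r k 0 ≈ 1#
      AW-diagonal k = trans (*-congˡ 1/0!) (solve 0 (con (+ 1) :* (con (+ 1) :* con (+ 1) :* con (+ 1)) :* con (+ 1) :* con (+ 1) := con (+ 1)) refl)
      2½ : ∀ n → (1# + 1#) ^ n * ½^ n ≈ 1#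
      2½ = ^-inverse (Unit.inverse (Parameters.2-unit P))
      ½-unit : ∀ n → Unit (½^ n)
      ½-unit n = mkUnit _ (trans (*-comm _ _) (2½ n))
      expand : ∀ {z} (z-unit : Unit z) n → rogersSzegő (inv z-unit) z n ≈ ∑₊ (λ k i → poly z-unit k * σ̂ k i) n
      expand {z} z-unit n = unit-cancel (½-unit n) (begin
        ½^ n * rogersSzegő (inv z-unit) z n
          ≈⟨ 1/!*H z-unit n ⟨
        1/ n ! * AskeyWilson.H P z-unit n
          ≈⟨ *-congˡ (trans (σ-connection n z-unit) (sum-toℕ n (λ k → σ n k * AskeyWilson.p P z-unit k) (λ k i → σ n k * AskeyWilson.p P z-unit k) λ _ _ _ → refl)) ⟩
        1/ n ! * ∑₊ (λ k i → σ n k * AskeyWilson.p P z-unit k) n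
          ≈⟨ ∑₊-*ˡ _ _ n ⟨
        ∑₊ (λ k i → 1/ n ! * (σ n k * AskeyWilson.p P z-unit k)) n
          ≈⟨ ∑₊-cong′ n (λ { k i ≡.refl → term k i }) ⟩
        ∑₊ (λ k i → ½^ n * (poly z-unit k * σ̂ k i)) n
          ≈⟨ ∑₊-*ˡ _ (λ k i → poly z-unit k * σ̂ k i) n ⟩
        ½^ n * ∑₊ (λ k i → poly z-unit k * σ̂ k i) n ∎)
        where
        term : ∀ k i → 1/ (k ℕ.+ i) ! * (σ (k ℕ.+ i) k * AskeyWilson.p P z-unit k) ≈ ½^ (k ℕ.+ i) * (poly z-unit k * σ̂ k i)
        term k i = begin
          1/ (k ℕ.+ i) ! * (σ (k ℕ.+ i) k * AskeyWilson.p P z-unit k)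
            ≈⟨ *-congˡ (*-congˡ (trans (*-congʳ (factorial-inverse k)) (*-identityˡ _))) ⟨
          1/ (k ℕ.+ i) ! * (σ (k ℕ.+ i) k * (factorial k * 1/ k ! * AskeyWilson.p P z-unit k))
            ≈⟨ solve 5 (λ f s g h p → f :* (s :* (g :* h :* p)) := s :* (f :* g) :* (h :* p)) refl _ _ _ _ _ ⟩
          σ (k ℕ.+ i) k * (1/ (k ℕ.+ i) ! * factorial k) * (1/ k ! * AskeyWilson.p P z-unit k)
            ≈⟨ *-congˡ (1/!*p z-unit k) ⟩
          σ (k ℕ.+ i) k * (1/ (k ℕ.+ i) ! * factorial k) * (½^ k * poly z-unit k)
            ≈⟨ trans (*-congʳ (2½ i)) (*-identityˡ _) ⟨
          (1# + 1#) ^ i * ½^ i * (σ (k ℕ.+ i) k * (1/ (k ℕ.+ i) ! * factorial k) * (½^ k * poly z-unit k))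
            ≈⟨ solve 6 (λ t h s f u p → t :* h :* (s :* f :* (u :* p)) := (u :* h) :* (p :* (t :* s :* f))) refl _ _ _ _ _ _ ⟩
          ½^ k * ½^ i * (poly z-unit k * σ̂ k i)
            ≈⟨ *-congʳ (^-homo-* (inv (Parameters.2-unit P)) k i) ⟨
          ½^ (k ℕ.+ i) * (poly z-unit k * σ̂ k i) ∎
      same : ∀ l n → (ϑ (point l) ⊙ e ⋆ (AW ξ AB AC AD r ⋆ σ̂)) 0 n ≈ (ϑ (point l) ⊙ e ⋆ (AW ξ AB AC AD r ⋆ chain)) 0 n
      same l n = begin
        (ϑ (point l) ⊙ e ⋆ (AW ξ AB AC AD r ⋆ σ̂)) 0 n
          ≈⟨ ⋆-assoc (ϑ (point l) ⊙ e) (AW ξ AB AC AD r) σ̂ 0 n ⟨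
        (ϑ (point l) ⊙ e ⋆ AW ξ AB AC AD r ⋆ σ̂) 0 n
          ≈⟨ expand (point l) n ⟨
        rogersSzegő (inv (point l)) (a * q ^ l) n
          ≈⟨ rogersSzegő-comm n ⟩
        rogersSzegő (a * q ^ l) (inv (point l)) n
          ≈⟨ rogersSzegő-expand (zy≈1 (point l)) (α-suc (point l)) (ξ-suc (point l)) (ξ*α (point l)) n ⟩
        (ϑ (point l) ⊙ e ⋆ AW₀ ξ 0s 0s ⋆ (λ _ → α 0) ⊙ e) 0 n
          ≈⟨ ⋆-assoc (ϑ (point l) ⊙ e) (AW₀ ξ 0s 0s) ((λ _ → α 0) ⊙ e) 0 n ⟩
        (ϑ (point l) ⊙ e ⋆ (AW₀ ξ 0s 0s ⋆ (λ _ → α 0) ⊙ e)) 0 n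
          ≈⟨ ⋆-congˡ (ϑ (point l) ⊙ e) (⋆-congˡ (AW₀ ξ 0s 0s) (⊙-congʳ {f = e} (λ _ → *-identityʳ a))
               ≐∙ ≐-sym AW⋆chain) 0 n ⟩
        (ϑ (point l) ⊙ e ⋆ (AW ξ AB AC AD r ⋆ chain)) 0 n ∎
        where
        rogersSzegő-comm : ∀ n → rogersSzegő (inv (point l)) (a * q ^ l) n ≈ rogersSzegő (a * q ^ l) (inv (point l)) n
        rogersSzegő-comm n = threeTerm-unique
          (λ n → rogersSzegő-threeTerm (trans (*-comm _ _) (zy≈1 (point l))) n)
          (λ n → trans (rogersSzegő-threeTerm (zy≈1 (point l)) n) (+-congʳ (*-congʳ (+-comm _ _)))) refl n

-- Runs and sums over sorted words

runsFrom : ∀ {m} → ℕ → Quadruple → Vec Quadruple m → List ℕ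
runsFrom r T []        = r ∷ []
runsFrom r T (T′ ∷ Ts) = if does (Vec.≡-dec ℕ._≟_ T T′) then runsFrom (suc r) T′ Ts else r ∷ runsFrom 1 T′ Ts

-- The two equations determine the function. They hold by `refl` for the local function of `runs`,
-- which can thus be identified by its behaviour.
runsFrom-unique : (g : ∀ {m} → ℕ → Quadruple → Vec Quadruple m → List ℕ) → (∀ r T → g r T [] ≡ r ∷ []) →
  (∀ {m} r T T′ (Ts : Vec Quadruple m) →
    g r T (T′ ∷ Ts) ≡ (if does (Vec.≡-dec ℕ._≟_ T T′) then g (suc r) T′ Ts else r ∷ g 1 T′ Ts)) →
  ∀ {m} r T (Ts : Vec Quadruple m) → g r T Ts ≡ runsFrom r T Ts
runsFrom-unique g p s r T [] = p r T
runsFrom-unique g p s r T (T′ ∷ Ts) rewrite s r T T′ Ts with does (Vec.≡-dec ℕ._≟_ T T′)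
... | true  = runsFrom-unique g p s (suc r) T′ Ts
... | false = ≡.cong (r ∷_) (runsFrom-unique g p s 1 T′ Ts)

mutual
  -- The local function of runs has no name outside of runs: Agda finds it by unification in the
  -- proof below, once its arguments have been abstracted to distinct variables.
  runs-go : ∀ {s} → Quadruple → Vec Quadruple s → ∀ {m} → ℕ → Quadruple → Vec Quadruple m → List ℕ
  runs-go T₀ Ts₀ r T Ts = _

  runs-runsFrom : ∀ {m} T (Ts : Vec Quadruple m) → runs (T ∷ Ts) ≡ runsFrom 1 T Ts
  runs-runsFrom T [] = ≡.refl
  runs-runsFrom {suc m} T (T₁ ∷ Ts) with does (Vec.≡-dec ℕ._≟_ T T₁)
  ... | true with suc m | T₁ ∷ Ts | 2
  ...   | s | S | r = runsFrom-unique (runs-go T S) (λ _ _ → ≡.refl) (λ _ _ _ _ → ≡.refl) r T₁ Ts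
  runs-runsFrom {suc m} T (T₁ ∷ Ts) | false with suc m | T₁ ∷ Ts | 1
  ...   | s | S | r = ≡.cong (r ∷_) (runsFrom-unique (runs-go T S) (λ _ _ → ≡.refl) (λ _ _ _ _ → ≡.refl) r T₁ Ts)

runsFrom-≡ : ∀ {m} r T (Ts : Vec Quadruple m) → runsFrom r T (T ∷ Ts) ≡ runsFrom (suc r) T Ts
runsFrom-≡ r T Ts rewrite dec-true (Vec.≡-dec ℕ._≟_ T T) ≡.refl = ≡.refl

runsFrom-≢ : ∀ {m} r {T T′} (Ts : Vec Quadruple m) → T ≢ T′ → runsFrom r T (T′ ∷ Ts) ≡ r ∷ runs (T′ ∷ Ts)
runsFrom-≢ r {T} {T′} Ts T≢T′ rewrite dec-false (Vec.≡-dec ℕ._≟_ T T′) T≢T′ | runs-runsFrom T′ Ts = ≡.refl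

-- The words that list their letters in the order in which these occur in the given list.
sortedWords : ∀ {X : Set} m → List X → List (Vec X m)
sortedWords zero    xs       = [] ∷ []
sortedWords (suc m) []       = []
sortedWords (suc m) (x ∷ xs) = List.map (x ∷_) (sortedWords m (x ∷ xs)) ++ sortedWords (suc m) xs

sortedWords-head : ∀ {X : Set} {m} (xs : List X) {y} {w : Vec X m} → y ∷ w ∈ sortedWords (suc m) xs → y ∈ xs
sortedWords-head {m = m} (x ∷ xs) p with ∈-++⁻ (List.map (x ∷_) (sortedWords m (x ∷ xs))) p
... | inj₁ q with _ , _ , ≡.refl ← ∈-map⁻ (x ∷_) q = here ≡.refl
... | inj₂ q = there (sortedWords-head xs q)

module ListSum (A : Ring₀) where
  open CommutativeRing A

  ∑ᴸ : ∀ {X : Set} → (X → Carrier) → List X → Carrier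
  ∑ᴸ f xs = List.foldr _+_ 0# (List.map f xs)

  ∑ᴸ-cong : ∀ {X : Set} {f g : X → Carrier} xs → (∀ {x} → x ∈ xs → f x ≈ g x) → ∑ᴸ f xs ≈ ∑ᴸ g xs
  ∑ᴸ-cong []       p = refl
  ∑ᴸ-cong (x ∷ xs) p = +-cong (p (here ≡.refl)) (∑ᴸ-cong xs (p ∘ there))

  ∑ᴸ-++ : ∀ {X : Set} (f : X → Carrier) xs ys → ∑ᴸ f (xs ++ ys) ≈ ∑ᴸ f xs + ∑ᴸ f ys
  ∑ᴸ-++ f []       ys = sym (+-identityˡ _)
  ∑ᴸ-++ f (x ∷ xs) ys = trans (+-congˡ (∑ᴸ-++ f xs ys)) (sym (+-assoc _ _ _))

  ∑ᴸ-map : ∀ {X Y : Set} (f : Y → Carrier) (g : X → Y) xs → ∑ᴸ f (List.map g xs) ≡ ∑ᴸ (f ∘ g) xs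
  ∑ᴸ-map f g []       = ≡.refl
  ∑ᴸ-map f g (x ∷ xs) = ≡.cong (λ s → f (g x) + s) (∑ᴸ-map f g xs)

  ∑ᴸ-*ˡ : ∀ {X : Set} c (f : X → Carrier) xs → ∑ᴸ (λ x → c * f x) xs ≈ c * ∑ᴸ f xs
  ∑ᴸ-*ˡ c f []       = sym (zeroʳ c)
  ∑ᴸ-*ˡ c f (x ∷ xs) = trans (+-congˡ (∑ᴸ-*ˡ c f xs)) (sym (distribˡ _ _ _))

exponent : Quadruple → ℕ → ℕ
exponent T t = (t ℕ.* (Vec.sum T ∸ 1)) ℕ./ 2

module SortedSums {A : Ring₀} {q : El A} (Q : QFactorials A q) (a₁ a₂ a₃ a₄ : El A) where
  open CommutativeRing A
  open CommutativeExp commutativeSemiring using (_^_; ^-homo-*)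
  open SetoidReasoning setoid
  open IntegerSolver A using (solve; con; _:=_; _:*_)
  open Identities Q
  open ListSum A

  monomial : Quadruple → Carrier
  monomial (t₁ ∷ t₂ ∷ t₃ ∷ t₄ ∷ []) = a₁ ^ t₁ * (a₂ ^ t₂ * (a₃ ^ t₃ * a₄ ^ t₄))

  monomial-+ : ∀ T S → monomial (zipWith ℕ._+_ T S) ≈ monomial T * monomial S
  monomial-+ (t₁ ∷ t₂ ∷ t₃ ∷ t₄ ∷ []) (s₁ ∷ s₂ ∷ s₃ ∷ s₄ ∷ []) = trans
    (*-cong (^-homo-* a₁ t₁ s₁) (*-cong (^-homo-* a₂ t₂ s₂) (*-cong (^-homo-* a₃ t₃ s₃) (^-homo-* a₄ t₄ s₄))))
    (solve 8 (λ a b c d e f g h → (a :* b) :* ((c :* d) :* ((e :* f) :* (g :* h))) :=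
                                  (a :* (c :* (e :* g))) :* (b :* (d :* (f :* h)))) refl _ _ _ _ _ _ _ _)

  runWeight : List ℕ → Carrier
  runWeight ms = List.foldr _*_ 1# (List.map 1/_! ms)

  powers : ∀ {m} → ℕ → Vec Quadruple m → Carrier
  powers k Ts = monomial (total Ts) * q ^ (‖ Ts ‖from k)

  -- The sum of the theorem without the factor `[n]!/[k]!`, restricted to sequences with entries in
  -- `L`.
  sortedSum : List Quadruple → Kernel
  sortedSum L k m = ∑ᴸ (λ w → powers k w * runWeight (runs w)) (sortedWords m L)

  letter : Quadruple → ℕ → Carrier
  letter T t = monomial T * q ^ exponent T t

  powers-∷ : ∀ {m} k T (w : Vec Quadruple m) → powers k (T ∷ w) ≈ letter T k * powers (suc k) w
  powers-∷ k T w = trans (*-cong (monomial-+ T (total w)) (^-homo-* q (exponent T k) (‖ w ‖from suc k)))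
    (solve 4 (λ a b c d → (a :* b) :* (c :* d) := (a :* c) :* (b :* d)) refl _ _ _ _)

  powers-[] : ∀ k → powers k [] ≈ 1#
  powers-[] k = solve 0 (con (+ 1) :* (con (+ 1) :* (con (+ 1) :* con (+ 1))) :* con (+ 1) := con (+ 1)) refl

  sortedSum-zero : ∀ L k → sortedSum L k 0 ≈ 1#
  sortedSum-zero L k = trans (+-identityʳ _) (trans (*-identityʳ _) (powers-[] k))

  module _ {T : Quadruple} {L : List Quadruple} (T∉L : T ∉ L) where

    -- A run of `r` copies of `T` has been read and may still grow, so its factor `1/[r]!` is not
    -- yet fixed.
    pending : ℕ → Kernel
    pending r k m = ∑ᴸ (λ w → powers k w * runWeight (runsFrom r T w)) (sortedWords m (T ∷ L))

    others : ∀ r k m → ∑ᴸ (λ w → powers k w * runWeight (runsFrom r T w)) (sortedWords (suc m) L) ≈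
                       1/ r ! * sortedSum L k (suc m)
    others r k m = trans (∑ᴸ-cong (sortedWords (suc m) L) λ { {y ∷ w} p →
        trans (*-congˡ (reflexive (≡.cong runWeight (runsFrom-≢ r {T} w λ { ≡.refl → T∉L (sortedWords-head L p) }))))
          (solve 3 (λ a b c → a :* (b :* c) := b :* (a :* c)) refl _ _ _) })
      (∑ᴸ-*ˡ (1/ r !) (λ w → powers k w * runWeight (runs w)) (sortedWords (suc m) L))

    -- A sorted word either starts with `T` and lengthens the run, or contains no `T` and closes it.
    -- The index `i` counts the further copies.
    pending-sum : ∀ r k m → pending r k m ≈ ∑₊ (λ i j → Π (letter T) k i * 1/ (r ℕ.+ i) ! * sortedSum L (k ℕ.+ i) j) m
    pending-sum r k zero = begin
      powers k [] * (1/ r ! * 1#) + 0#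
        ≈⟨ trans (+-identityʳ _) (trans (*-cong (powers-[] k) (*-identityʳ _)) (trans (sym (*-identityʳ _)) (*-congˡ (sym (sortedSum-zero L (k ℕ.+ 0)))))) ⟩
      1# * 1/ r ! * sortedSum L (k ℕ.+ 0) 0
        ≡⟨ ≡.cong (λ x → 1# * 1/ x ! * sortedSum L (k ℕ.+ 0) 0) (ℕ.+-identityʳ r) ⟨
      1# * 1/ (r ℕ.+ 0) ! * sortedSum L (k ℕ.+ 0) 0 ∎
    pending-sum r k (suc m) = begin
      pending r k (suc m)
        ≈⟨ ∑ᴸ-++ _ (List.map (T ∷_) (sortedWords m (T ∷ L))) (sortedWords (suc m) L) ⟩
      ∑ᴸ (λ w → powers k w * runWeight (runsFrom r T w)) (List.map (T ∷_) (sortedWords m (T ∷ L))) +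
      ∑ᴸ (λ w → powers k w * runWeight (runsFrom r T w)) (sortedWords (suc m) L)
        ≈⟨ +-cong (begin
             ∑ᴸ (λ w → powers k w * runWeight (runsFrom r T w)) (List.map (T ∷_) (sortedWords m (T ∷ L)))
               ≡⟨ ∑ᴸ-map _ (T ∷_) (sortedWords m (T ∷ L)) ⟩
             ∑ᴸ (λ w → powers k (T ∷ w) * runWeight (runsFrom r T (T ∷ w))) (sortedWords m (T ∷ L))
               ≈⟨ ∑ᴸ-cong (sortedWords m (T ∷ L)) (λ {w} _ → trans (*-cong (powers-∷ k T w)
                    (reflexive (≡.cong runWeight (runsFrom-≡ r T w)))) (*-assoc _ _ _)) ⟩
             ∑ᴸ (λ w → letter T k * (powers (suc k) w * runWeight (runsFrom (suc r) T w))) (sortedWords m (T ∷ L))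
               ≈⟨ ∑ᴸ-*ˡ (letter T k) _ (sortedWords m (T ∷ L)) ⟩
             letter T k * pending (suc r) (suc k) m
               ≈⟨ *-congˡ (pending-sum (suc r) (suc k) m) ⟩
             letter T k * ∑₊ (λ i j → Π (letter T) (suc k) i * 1/ (suc r ℕ.+ i) ! * sortedSum L (suc k ℕ.+ i) j) m
               ≈⟨ ∑₊-*ˡ _ _ m ⟨
             ∑₊ (λ i j → letter T k * (Π (letter T) (suc k) i * 1/ (suc r ℕ.+ i) ! * sortedSum L (suc k ℕ.+ i) j)) m
               ≈⟨ ∑₊-cong shift m ⟩
             ∑₊ (λ i j → Π (letter T) k (suc i) * 1/ (r ℕ.+ suc i) ! * sortedSum L (k ℕ.+ suc i) j) m ∎)
           (others r k m) ⟩
      ∑₊ (λ i j → Π (letter T) k (suc i) * 1/ (r ℕ.+ suc i) ! * sortedSum L (k ℕ.+ suc i) j) m + 1/ r ! * sortedSum L k (suc m)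
        ≈⟨ +-comm _ _ ⟩
      1/ r ! * sortedSum L k (suc m) + ∑₊ (λ i j → Π (letter T) k (suc i) * 1/ (r ℕ.+ suc i) ! * sortedSum L (k ℕ.+ suc i) j) m
        ≈⟨ +-congʳ (*-cong (sym (*-identityˡ _)) refl) ⟩
      1# * 1/ r ! * sortedSum L k (suc m) + ∑₊ (λ i j → Π (letter T) k (suc i) * 1/ (r ℕ.+ suc i) ! * sortedSum L (k ℕ.+ suc i) j) m
        ≡⟨ ≡.cong₂ (λ x y → 1# * 1/ x ! * sortedSum L y (suc m) + ∑₊ (λ i j → Π (letter T) k (suc i) * 1/ (r ℕ.+ suc i) ! * sortedSum L (k ℕ.+ suc i) j) m)
             (≡.sym (ℕ.+-identityʳ r)) (≡.sym (ℕ.+-identityʳ k)) ⟩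
      ∑₊ (λ i j → Π (letter T) k i * 1/ (r ℕ.+ i) ! * sortedSum L (k ℕ.+ i) j) (suc m) ∎
      where
      shift : ∀ i j → letter T k * (Π (letter T) (suc k) i * 1/ (suc r ℕ.+ i) ! * sortedSum L (suc k ℕ.+ i) j) ≈
                      Π (letter T) k (suc i) * 1/ (r ℕ.+ suc i) ! * sortedSum L (k ℕ.+ suc i) j
      shift i j rewrite ℕ.+-suc r i | ℕ.+-suc k i =
        solve 4 (λ a b c d → a :* (b :* c :* d) := a :* b :* c :* d) refl _ _ _ _

    -- An empty pending run costs `1/[0]! = 1`, so the case `r = 0` of the pending sum applies.
    sortedSum-∷ : sortedSum (T ∷ L) ≐ letter T ⊙ e ⋆ sortedSum L
    sortedSum-∷ k m = trans (runs-pending m) (pending-sum 0 k m)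
      where
      runs-pending : ∀ m → sortedSum (T ∷ L) k m ≈ pending 0 k m
      runs-pending zero    = +-congʳ (*-congˡ (trans (sym 1/0!) (sym (*-identityʳ _))))
      runs-pending (suc m) = begin
        sortedSum (T ∷ L) k (suc m)
          ≈⟨ ∑ᴸ-++ _ (List.map (T ∷_) (sortedWords m (T ∷ L))) (sortedWords (suc m) L) ⟩
        ∑ᴸ (λ w → powers k w * runWeight (runs w)) (List.map (T ∷_) (sortedWords m (T ∷ L))) + sortedSum L k (suc m)
          ≈⟨ +-cong
               (trans (reflexive (∑ᴸ-map _ (T ∷_) (sortedWords m (T ∷ L))))
                 (trans (∑ᴸ-cong (sortedWords m (T ∷ L)) λ {w} _ → *-congˡ (reflexive (≡.cong runWeight
                   (≡.trans (runs-runsFrom T w) (≡.sym (runsFrom-≡ 0 T w))))))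
                 (reflexive (≡.sym (∑ᴸ-map _ (T ∷_) (sortedWords m (T ∷ L)))))))
               (trans (sym (trans (*-congʳ 1/0!) (*-identityˡ _))) (sym (others 0 k m))) ⟩
        ∑ᴸ (λ w → powers k w * runWeight (runsFrom 0 T w)) (List.map (T ∷_) (sortedWords m (T ∷ L))) +
        ∑ᴸ (λ w → powers k w * runWeight (runsFrom 0 T w)) (sortedWords (suc m) L)
          ≈⟨ ∑ᴸ-++ _ (List.map (T ∷_) (sortedWords m (T ∷ L))) (sortedWords (suc m) L) ⟨
        pending 0 k (suc m) ∎

-- The set 𝒯 in decreasing order

open DecMembership (Vec.≡-dec {n = 4} ℕ._≟_) using () renaming (_∈?_ to _∈Q?_)

infix 4 _≻_
_≻_ : Quadruple → Quadruple → Set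
T ≻ S = Lex.Lex-< _≡_ ℤ._≤_ (key S) (key T)

≻-trans : Transitive _≻_
≻-trans p r = Lex.<-trans ℤ.≤-isPartialOrder r p

≻-irrefl : ∀ {T} → ¬ T ≻ T
≻-irrefl = Lex.<-irrefl {_≼_ = ℤ._≤_} (Pointwise.refl ≡.refl)

≻⇒≥ : ∀ {T S} → T ≻ S → T ≥𝒯 S
≻⇒≥ = LexCore.map-P λ ()

≥-refl : ∀ {T} → T ≥𝒯 T
≥-refl = Lex.≤-refl (Pointwise.refl ≡.refl)

≥-trans : Transitive _≥𝒯_
≥-trans p r = Lex.≤-trans ℤ.≤-isPartialOrder r p

≻⇒≱ : ∀ {T S} → T ≻ S → ¬ S ≥𝒯 T
≻⇒≱ T≻S S≥T = Lex.<-irrefl {_≼_ = ℤ._≤_} (Lex.≤-antisym ≡.sym ℤ.≤-antisym (≻⇒≥ T≻S) S≥T) T≻S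

shift : Quadruple → Quadruple
shift = Vec.map suc

shiftBy : ℕ → Quadruple → Quadruple
shiftBy s T = zipWith ℕ._+_ T (replicate 4 s)

shift-shiftBy : ∀ s T → shift (shiftBy s T) ≡ shiftBy (suc s) T
shift-shiftBy s (a ∷ b ∷ c ∷ d ∷ []) rewrite ℕ.+-suc a s | ℕ.+-suc b s | ℕ.+-suc c s | ℕ.+-suc d s = ≡.refl

-- The members of 𝒯 with `t₄ = 0` and with `t₄ = 1`. Translation by (s,s,s,s) takes the latter to
-- those with `t₄ = s + 1`.
lowest block₀ : List Quadruple
lowest = (1 ∷ 1 ∷ 1 ∷ 0 ∷ []) ∷ (0 ∷ 0 ∷ 1 ∷ 0 ∷ []) ∷ (0 ∷ 1 ∷ 0 ∷ 0 ∷ []) ∷ (1 ∷ 0 ∷ 0 ∷ 0 ∷ []) ∷ []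
block₀ = (2 ∷ 2 ∷ 2 ∷ 1 ∷ []) ∷ (1 ∷ 1 ∷ 2 ∷ 1 ∷ []) ∷ (1 ∷ 2 ∷ 1 ∷ 1 ∷ []) ∷ (0 ∷ 1 ∷ 1 ∷ 1 ∷ []) ∷
         (2 ∷ 1 ∷ 1 ∷ 1 ∷ []) ∷ (1 ∷ 0 ∷ 1 ∷ 1 ∷ []) ∷ (1 ∷ 1 ∷ 0 ∷ 1 ∷ []) ∷ (0 ∷ 0 ∷ 0 ∷ 1 ∷ []) ∷ []

block : ℕ → List Quadruple
block s = List.map (shiftBy s) block₀

-- The members T of 𝒯 with t₄ ≤ M, in decreasing order.
letters : ℕ → List Quadruple
letters zero    = lowest
letters (suc M) = block M ++ letters M

private
  ⊹<⊹ : ∀ {m n} → m < n → (+ m) ℤ.≤ (+ n) × (+ m) ≢ (+ n)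
  ⊹<⊹ m<n = +≤+ (ℕ.<⇒≤ m<n) , ℕ.<⇒≢ m<n ∘ ℤ.+-injective

  ≻₄ : ∀ {a b c d a′ b′ c′ d′} → d′ < d → (a ∷ b ∷ c ∷ d ∷ []) ≻ (a′ ∷ b′ ∷ c′ ∷ d′ ∷ [])
  ≻₄ p = Lex.this (⊹<⊹ p) ≡.refl

  ≻₃ : ∀ {a b c d a′ b′ c′} → c′ < c → (a ∷ b ∷ c ∷ d ∷ []) ≻ (a′ ∷ b′ ∷ c′ ∷ d ∷ [])
  ≻₃ p = Lex.next ≡.refl (Lex.this (⊹<⊹ p) ≡.refl)

  ≻₂ : ∀ {a b c d a′ b′} → b′ < b → (a ∷ b ∷ c ∷ d ∷ []) ≻ (a′ ∷ b′ ∷ c ∷ d ∷ [])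
  ≻₂ p = Lex.next ≡.refl (Lex.next ≡.refl (Lex.this (⊹<⊹ p) ≡.refl))

  ≻₁ : ∀ {a b c d a′} → a < a′ → (a ∷ b ∷ c ∷ d ∷ []) ≻ (a′ ∷ b ∷ c ∷ d ∷ [])
  ≻₁ p = Lex.next ≡.refl (Lex.next ≡.refl (Lex.next ≡.refl
    (Lex.this (ℤ.neg-mono-≤ (+≤+ (ℕ.<⇒≤ p)) , ℕ.<⇒≢ p ∘ ≡.sym ∘ ℤ.+-injective ∘ ℤ.neg-injective) ≡.refl)))

letters-linked : ∀ M → ListLinked.Linked _≻_ (letters M)
letters-linked zero = ≻₂ {1} {a′ = 0} (s≤s z≤n) ∷ ≻₃ {0} {a′ = 0} (s≤s z≤n) ∷ ≻₂ {0} {a′ = 1} (s≤s z≤n) ∷ [-]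
letters-linked (suc M) =
  ≻₂ ℕ.≤-refl ∷ ≻₃ ℕ.≤-refl ∷ ≻₂ ℕ.≤-refl ∷ ≻₁ (ℕ.n≤1+n _) ∷ ≻₂ ℕ.≤-refl ∷ ≻₃ ℕ.≤-refl ∷ ≻₂ ℕ.≤-refl ∷ next-block M
  where
  next-block : ∀ M → ListLinked.Linked _≻_ (shiftBy M (0 ∷ 0 ∷ 0 ∷ 1 ∷ []) ∷ letters M)
  next-block zero    = ≻₄ {0} {a′ = 1} (s≤s z≤n) ∷ letters-linked zero
  next-block (suc M) = ≻₄ ℕ.≤-refl ∷ letters-linked (suc M)

letters-sorted : ∀ M → AllPairs _≻_ (letters M)
letters-sorted M = Linked⇒AllPairs (λ {i} {j} {k} → ≻-trans {i} {j} {k}) (letters-linked M)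

sum-shift : ∀ T → Vec.sum (shift T) ℕ.% 2 ≡ Vec.sum T ℕ.% 2
sum-shift (a ∷ b ∷ c ∷ d ∷ []) = ≡.trans (≡.cong (ℕ._% 2) (rearrange a b c d)) (ℕ.[m+kn]%n≡m%n (Vec.sum (a ∷ b ∷ c ∷ d ∷ [])) 2 2)
  where
  rearrange : ∀ a b c d → suc a ℕ.+ (suc b ℕ.+ (suc c ℕ.+ (suc d ℕ.+ 0))) ≡ a ℕ.+ (b ℕ.+ (c ℕ.+ (d ℕ.+ 0))) ℕ.+ 4
  rearrange = solve-∀

shift-𝒯 : ∀ T → T ∈𝒯 → shift T ∈𝒯
shift-𝒯 T (odd , close) = ≡.trans (sum-shift T) odd , λ i j →
  ≡.subst₂ (λ x y → ∣ x - y ∣ ≤ 1) (≡.sym (Vec.lookup-map i suc T)) (≡.sym (Vec.lookup-map j suc T)) (close i j)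

shift-𝒯⁻ : ∀ T → shift T ∈𝒯 → T ∈𝒯
shift-𝒯⁻ T (odd , close) = ≡.trans (≡.sym (sum-shift T)) odd , λ i j →
  ≡.subst₂ (λ x y → ∣ x - y ∣ ≤ 1) (Vec.lookup-map i suc T) (Vec.lookup-map j suc T) (close i j)

shiftBy-𝒯 : ∀ s T → T ∈𝒯 → shiftBy s T ∈𝒯
shiftBy-𝒯 zero T p = ≡.subst _∈𝒯 (≡.sym (Vec.zipWith-identityʳ ℕ.+-identityʳ T)) p
shiftBy-𝒯 (suc s) T p = ≡.subst _∈𝒯 (shift-shiftBy s T) (shift-𝒯 (shiftBy s T) (shiftBy-𝒯 s T p))

letters-𝒯 : ∀ M → ListAll.All _∈𝒯 (letters M)
letters-𝒯 zero    = toWitness {a? = ListAll.all? _∈𝒯? lowest} _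
letters-𝒯 (suc M) = ListAll.++⁺ (ListAll.map⁺ {P = _∈𝒯} {f = shiftBy M} (ListAll.map (λ {T} → shiftBy-𝒯 M T) (toWitness {a? = ListAll.all? _∈𝒯? block₀} _))) (letters-𝒯 M)

∈-box : ∀ {m} (v e : Vec ℕ m) → (∀ i → lookup v i ≤ lookup e i) → v ∈ box e
∈-box []      []      p = here ≡.refl
∈-box (x ∷ v) (y ∷ e) p = ∈-cartesianProductWith⁺ _∷_ (∈-upTo⁺ (s≤s (p zero))) (∈-box v e (p ∘ suc))

letters₁⊆letters : ∀ M {T} → T ∈ letters 1 → T ∈ letters (suc M)
letters₁⊆letters zero    p = p
letters₁⊆letters (suc M) p = ∈-++⁺ʳ (block (suc M)) (letters₁⊆letters M p)

shift-letters : ∀ M {T} → T ∈ letters M → shift T ∈ letters (suc M)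
shift-letters zero    p = ListAll.lookup (toWitness {a? = ListAll.all? {P = λ T → shift T ∈ letters 1} (λ T → shift T ∈Q? letters 1) lowest} _) p
shift-letters (suc M) {T} p with ∈-++⁻ (block M) p
... | inj₂ q = ∈-++⁺ʳ (block (suc M)) (shift-letters M q)
... | inj₁ q with S , r , ≡.refl ← ∈-map⁻ (shiftBy M) q =
  ∈-++⁺ˡ (≡.subst (_∈ block (suc M)) (≡.sym (shift-shiftBy M S)) (∈-map⁺ (shiftBy (suc M)) r))

-- Once an entry is 0, all entries are at most 1: these are sixteen candidates, checked by
-- evaluation.
binary-letters : ListAll.All (λ T → T ∈𝒯 → T ∈ letters 1) (box (replicate 4 1))
binary-letters = toWitness {a? = ListAll.all? {P = λ T → T ∈𝒯 → T ∈ letters 1} (λ T → (T ∈𝒯?) →-dec (T ∈Q? letters 1)) (box (replicate 4 1))} _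

zero-letters : ∀ T → T ∈𝒯 → ∀ i → lookup T i ≡ 0 → T ∈ letters 1
zero-letters T p i Tᵢ≡0 = ListAll.lookup binary-letters (∈-box T (replicate 4 1) T≤1) p
  where
  T≤1 : ∀ j → lookup T j ≤ lookup (replicate 4 1) j
  T≤1 j = ≡.subst (lookup T j ≤_) (≡.sym (Vec.lookup-replicate j 1)) (≡.subst (λ x → ∣ x - lookup T j ∣ ≤ 1) Tᵢ≡0 (proj₂ p i j))

-- (1,1,1,1) is subtracted until some entry is 0. The bound concerns `t₁` because remainders will be
-- controlled by powers of `a₁`; the `suc` is there since `t₄` may exceed `t₁` by 1.
𝒯-letters : ∀ M T → T ∈𝒯 → lookup T 0F ≤ M → T ∈ letters (suc M)
𝒯-letters M T@(zero ∷ _ ∷ _ ∷ _ ∷ []) p _ = letters₁⊆letters M (zero-letters T p 0F ≡.refl)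
𝒯-letters M T@(suc _ ∷ zero ∷ _ ∷ _ ∷ []) p _ = letters₁⊆letters M (zero-letters T p 1F ≡.refl)
𝒯-letters M T@(suc _ ∷ suc _ ∷ zero ∷ _ ∷ []) p _ = letters₁⊆letters M (zero-letters T p 2F ≡.refl)
𝒯-letters M T@(suc _ ∷ suc _ ∷ suc _ ∷ zero ∷ []) p _ = letters₁⊆letters M (zero-letters T p 3F ≡.refl)
𝒯-letters (suc M) (suc a ∷ suc b ∷ suc c ∷ suc d ∷ []) p (s≤s a≤M) =
  shift-letters (suc M) (𝒯-letters M (a ∷ b ∷ c ∷ d ∷ []) (shift-𝒯⁻ (a ∷ b ∷ c ∷ d ∷ []) p) a≤M)

sortedWords-sound : ∀ m {L} → AllPairs _≻_ L → ∀ {w : Vec Quadruple m} → w ∈ sortedWords m L → All (_∈ L) w × Linked _≥𝒯_ w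
sortedWords-sound zero    _ (here ≡.refl) = [] , []
sortedWords-sound (suc m) {T ∷ L} sorted@(T≻L ∷ L-sorted) p with ∈-++⁻ (List.map (T ∷_) (sortedWords m (T ∷ L))) p
... | inj₂ q with in-L , linked ← sortedWords-sound (suc m) L-sorted q = All.map there in-L , linked
... | inj₁ q with w , r , ≡.refl ← ∈-map⁻ (T ∷_) q with in-L , linked ← sortedWords-sound m sorted r =
  here ≡.refl ∷ in-L , T≥ w in-L linked
  where
  T≥ : ∀ {m} (w : Vec Quadruple m) → All (_∈ T ∷ L) w → Linked _≥𝒯_ w → Linked _≥𝒯_ (T ∷ w)
  T≥ []      _                 _      = [-]
  T≥ (S ∷ w) (here ≡.refl ∷ _) linked = ≥-refl {T} ∷ linked
  T≥ (S ∷ w) (there S∈L ∷ _)   linked = ≻⇒≥ {T} {S} (ListAll.lookup T≻L S∈L) ∷ linked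

linked⇒all : ∀ {m T} {w : Vec Quadruple m} → Linked _≥𝒯_ (T ∷ w) → All (T ≥𝒯_) w
linked⇒all [-] = []
linked⇒all {T = T} {S ∷ w} (T≥S ∷ linked) = T≥S ∷ All.map (λ {U} → ≥-trans {T} {S} {U} T≥S) (linked⇒all linked)

sortedWords-complete : ∀ m {L} → AllPairs _≻_ L → ∀ {w : Vec Quadruple m} → All (_∈ L) w → Linked _≥𝒯_ w → w ∈ sortedWords m L
sortedWords-complete zero _ {[]} _ _ = here ≡.refl
sortedWords-complete (suc m) {T ∷ L} sorted {S ∷ w} (here ≡.refl ∷ in-L) linked =
  ∈-++⁺ˡ (∈-map⁺ (T ∷_) (sortedWords-complete m sorted in-L (Linked.tail linked)))
sortedWords-complete (suc m) {T ∷ L} (T≻L ∷ L-sorted) {S ∷ w} (there S∈L ∷ in-L) linked =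
  ∈-++⁺ʳ (List.map (T ∷_) (sortedWords m (T ∷ L)))
    (sortedWords-complete (suc m) L-sorted (S∈L ∷ All.map below (All.zip (in-L , linked⇒all linked))) linked)
  where
  -- Every later letter is at most the head `S`, which is already smaller than `T`.
  below : ∀ {U} → U ∈ T ∷ L × S ≥𝒯 U → U ∈ L
  below (here ≡.refl , S≥T) = contradiction S≥T (≻⇒≱ {T} {S} (ListAll.lookup T≻L S∈L))
  below (there U∈L   , _)   = U∈L

sortedWords-unique : ∀ m {L} → AllPairs _≻_ L → Unique (sortedWords m L)
sortedWords-unique zero _ = [] ∷ []
sortedWords-unique (suc m) [] = []
sortedWords-unique (suc m) {T ∷ L} sorted@(T≻L ∷ L-sorted) = Unique.++⁺
  (Unique.map⁺ Vec.∷-injectiveʳ (sortedWords-unique m sorted))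
  (sortedWords-unique (suc m) L-sorted)
  λ (p , r) → disjoint (∈-map⁻ (T ∷_) p) r
  where
  disjoint : ∀ {w} → Σ _ (λ v → v ∈ sortedWords m (T ∷ L) × w ≡ T ∷ v) → ¬ w ∈ sortedWords (suc m) L
  disjoint (v , _ , ≡.refl) r = ≻-irrefl {T} (ListAll.lookup T≻L (sortedWords-head L r))

box-unique : ∀ {m} (e : Vec ℕ m) → Unique (box e)
box-unique []      = [] ∷ []
box-unique (x ∷ e) = Unique.cartesianProductWith⁺ _∷_ Vec.∷-injective (Unique.upTo⁺ (suc x)) (box-unique e)

words-unique : ∀ {X : Set} m {xs : List X} → Unique xs → Unique (words m xs)
words-unique zero    u = [] ∷ []
words-unique (suc m) u = Unique.cartesianProductWith⁺ _∷_ Vec.∷-injective u (words-unique m u)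

∈-words : ∀ {X : Set} {m} {xs : List X} {w : Vec X m} → All (_∈ xs) w → w ∈ words m xs
∈-words []       = here ≡.refl
∈-words (p ∷ ps) = ∈-cartesianProductWith⁺ _∷_ p (∈-words ps)

≤-total : ∀ {m} (w : Vec Quadruple m) i → All (λ T → lookup T i ≤ lookup (total w) i) w
≤-total []      i = []
≤-total (T ∷ w) i = ≡.subst (λ x → All (λ S → lookup S i ≤ x) (T ∷ w)) (≡.sym (Vec.lookup-zipWith ℕ._+_ i T (total w)))
  (ℕ.m≤m+n _ _ ∷ All.map (λ S≤ → ℕ.≤-trans S≤ (ℕ.m≤n+m _ (lookup T i))) (≤-total w i))

≤-total′ : ∀ {m} (w : Vec Quadruple m) → All (λ T → ∀ i → lookup T i ≤ lookup (total w) i) w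
≤-total′ w = All.map (λ { (p₀ , p₁ , p₂ , p₃) 0F → p₀ ; (p₀ , p₁ , p₂ , p₃) 1F → p₁ ; (p₀ , p₁ , p₂ , p₃) 2F → p₂ ; (p₀ , p₁ , p₂ , p₃) 3F → p₃ })
  (All.zip (≤-total w 0F , All.zip (≤-total w 1F , All.zip (≤-total w 2F , ≤-total w 3F))))

-- Both lists are free of repetitions and have the same members, so one is a permutation of the
-- other. The box bound comes from the nonnegative entries, the letter bound from the first entry of
-- `e`.
𝒯-words↭sortedWords : ∀ m e M → lookup e 0F ≤ M →
  filter (λ w → is𝒯-sequence? w ×-dec Vec.≡-dec ℕ._≟_ (total w) e) (words m (box e)) ↭
  filter (λ w → Vec.≡-dec ℕ._≟_ (total w) e) (sortedWords m (letters (suc M)))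
𝒯-words↭sortedWords m e M e₁≤M = ∼bag⇒↭ (unique∧set⇒bag
  (Unique.filter⁺ _ (words-unique m (box-unique e)))
  (Unique.filter⁺ _ (sortedWords-unique m (letters-sorted (suc M))))
  (mk⇔ to from))
  where
  to : ∀ {w} → w ∈ filter (λ w → is𝒯-sequence? w ×-dec Vec.≡-dec ℕ._≟_ (total w) e) (words m (box e)) →
       w ∈ filter (λ w → Vec.≡-dec ℕ._≟_ (total w) e) (sortedWords m (letters (suc M)))
  to {w} p with _ , (in-𝒯 , linked) , ≡.refl ← ∈-filter⁻ (λ w → is𝒯-sequence? w ×-dec Vec.≡-dec ℕ._≟_ (total w) e) {xs = words m (box e)} p =
    ∈-filter⁺ (λ w → Vec.≡-dec ℕ._≟_ (total w) e)
      (sortedWords-complete m (letters-sorted (suc M))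
        (All.map (λ {T} (T∈𝒯 , T≤e) → 𝒯-letters M T T∈𝒯 (ℕ.≤-trans (T≤e 0F) e₁≤M)) (All.zip (in-𝒯 , ≤-total′ w))) linked)
      ≡.refl
  from : ∀ {w} → w ∈ filter (λ w → Vec.≡-dec ℕ._≟_ (total w) e) (sortedWords m (letters (suc M))) →
         w ∈ filter (λ w → is𝒯-sequence? w ×-dec Vec.≡-dec ℕ._≟_ (total w) e) (words m (box e))
  from {w} p with q , ≡.refl ← ∈-filter⁻ (λ w → Vec.≡-dec ℕ._≟_ (total w) e) {xs = sortedWords m (letters (suc M))} p
    with in-L , linked ← sortedWords-sound m (letters-sorted (suc M)) q =
    ∈-filter⁺ (λ w → is𝒯-sequence? w ×-dec Vec.≡-dec ℕ._≟_ (total w) e)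
      (∈-words (All.map (∈-box _ (total w)) (≤-total′ w)))
      ((All.map (ListAll.lookup (letters-𝒯 (suc M))) in-L , linked) , ≡.refl)

-- Here the oddness of `|T|` enters: it makes the halved exponent linear in `t`, so that letters are
-- geometric sequences.
exponent-odd : ∀ T {c} → Vec.sum T ≡ suc (c ℕ.* 2) → ∀ t → exponent T t ≡ t ℕ.* c
exponent-odd T {c} eq t rewrite eq = ≡.trans (≡.cong (ℕ._/ 2) (≡.sym (ℕ.*-assoc t c 2))) (ℕ.m*n/n≡m (t ℕ.* c) 2)

sum-shiftBy : ∀ s T {c} → Vec.sum T ≡ suc (c ℕ.* 2) → Vec.sum (shiftBy s T) ≡ suc ((c ℕ.+ s ℕ.* 2) ℕ.* 2)
sum-shiftBy s (t₁ ∷ t₂ ∷ t₃ ∷ t₄ ∷ []) {c} eq = ≡.trans (rearrange t₁ t₂ t₃ t₄ s)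
  (≡.trans (≡.cong (ℕ._+ s ℕ.* 4) eq) (collect c s))
  where
  rearrange : ∀ a b c d s → a ℕ.+ s ℕ.+ (b ℕ.+ s ℕ.+ (c ℕ.+ s ℕ.+ (d ℕ.+ s ℕ.+ 0))) ≡ a ℕ.+ (b ℕ.+ (c ℕ.+ (d ℕ.+ 0))) ℕ.+ s ℕ.* 4
  rearrange = solve-∀
  collect : ∀ c s → suc (c ℕ.* 2) ℕ.+ s ℕ.* 4 ≡ suc ((c ℕ.+ s ℕ.* 2) ℕ.* 2)
  collect = solve-∀

-- The product of the blocks

module InfiniteProduct {A : Ring₀} {q : El A} (Q : QFactorials A q) (a₁ a₂ a₃ a₄ : El A) where
  open CommutativeRing A
  open CommutativeExp commutativeSemiring using (_^_; ^-homo-*; ^-assocʳ; ^-distrib-*; ^-congˡ)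
  open SetoidReasoning setoid
  open IntegerSolver A using (solve; _:=_; _:*_; _:^_)
  open Identities Q
  open ListSum A
  open SortedSums Q a₁ a₂ a₃ a₄ public

  a₁₂₃₄ : Carrier
  a₁₂₃₄ = a₁ * (a₂ * (a₃ * a₄))

  -- `B`, `C` and `D` are the ratios used for merging, `γ` is the factor that a letter gains under
  -- translation by (1,1,1,1), and `κ` belongs to the collapsed block `s = 0`.
  B C D α γ κ : ℕ → Carrier
  B t = a₁ * a₂ * q ^ t
  C t = a₁ * a₃ * q ^ t
  D t = a₂ * a₃ * q ^ t
  α t = a₁₂₃₄ * q ^ t
  γ t = α (t ℕ.+ t)
  κ t = a₄ * (1# + B t) * (1# + C t) * (1# + D t)

  letter-odd : ∀ T c → Vec.sum T ≡ suc (c ℕ.* 2) → ∀ t → letter T t ≈ monomial T * (q ^ t) ^ c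
  letter-odd T c eq t = *-congˡ (trans (reflexive (≡.cong (q ^_) (exponent-odd T eq t))) (sym (^-assocʳ q t c)))

  -- Adding `s` to every entry raises `(|T| - 1)/2` by `2s`, and `a₁a₂a₃a₄` together with `q²ᵗ` is
  -- `γ t`.
  letter-shiftBy : ∀ s T c → Vec.sum T ≡ suc (c ℕ.* 2) → ∀ t → letter (shiftBy s T) t ≈ γ t ^ s * (monomial T * (q ^ t) ^ c)
  letter-shiftBy s T c eq t = begin
    letter (shiftBy s T) t
      ≈⟨ letter-odd (shiftBy s T) (c ℕ.+ s ℕ.* 2) (sum-shiftBy s T {c} eq) t ⟩
    monomial (shiftBy s T) * (q ^ t) ^ (c ℕ.+ s ℕ.* 2)
      ≈⟨ *-cong (monomial-+ T (replicate 4 s)) (trans (^-homo-* (q ^ t) c (s ℕ.* 2))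
           (*-congˡ (trans (reflexive (≡.cong ((q ^ t) ^_) (ℕ.*-comm s 2))) (sym (^-assocʳ (q ^ t) 2 s))))) ⟩
    monomial T * monomial (replicate 4 s) * ((q ^ t) ^ c * ((q ^ t) ^ 2) ^ s)
      ≈⟨ *-cong (*-congˡ diagonal) (*-congˡ (^-congˡ s (trans (*-congˡ (*-identityʳ _)) (sym (^-homo-* q t t))))) ⟩
    monomial T * a₁₂₃₄ ^ s * ((q ^ t) ^ c * (q ^ (t ℕ.+ t)) ^ s)
      ≈⟨ solve 4 (λ a b c d → a :* b :* (c :* d) := (b :* d) :* (a :* c)) refl _ _ _ _ ⟩
    a₁₂₃₄ ^ s * (q ^ (t ℕ.+ t)) ^ s * (monomial T * (q ^ t) ^ c)
      ≈⟨ *-congʳ (^-distrib-* a₁₂₃₄ _ s) ⟨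
    γ t ^ s * (monomial T * (q ^ t) ^ c) ∎
    where
    diagonal : monomial (replicate 4 s) ≈ a₁₂₃₄ ^ s
    diagonal = sym (trans (^-distrib-* a₁ _ s) (*-congˡ (trans (^-distrib-* a₂ _ s) (*-congˡ (^-distrib-* a₃ a₄ s)))))

  sortedSum-head : ∀ {T L} → AllPairs _≻_ (T ∷ L) → sortedSum (T ∷ L) ≐ letter T ⊙ e ⋆ sortedSum L
  sortedSum-head {T} (T≻L ∷ _) = sortedSum-∷ λ T∈L → ≻-irrefl {T} (ListAll.lookup T≻L T∈L)

  -- The q-binomial theorem for the ratio `g`, with the common factor `w` pulled through by `⊙-⋆`;
  -- `S` is the rest of the product.
  merge : ∀ {u v g : ℕ → Carrier} (w : ℕ → Carrier) (S : Kernel) → (∀ t → g (suc t) ≈ q * g t) → (∀ t → u t ≈ w t * g t) → (∀ t → v t ≈ w t) →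
          u ⊙ e ⋆ (v ⊙ e ⋆ S) ≐ (λ t → w t * (1# + g t)) ⊙ e ⋆ S
  merge {u} {v} {g} w S g-suc u≈ v≈ = ≐-sym (⋆-assoc (u ⊙ e) (v ⊙ e) S) ≐∙ ⋆-congʳ S
    (⋆-cong (⊙-congʳ {f = e} u≈ ≐∙ ≐-sym (⊙-⊙ w g e)) (⊙-congʳ {f = e} v≈) ≐∙
     ≐-sym (⊙-⋆ w (g ⊙ e) e) ≐∙ ⊙-congˡ (q-binomial g-suc) ≐∙ ⊙-⊙ w (λ t → 1# + g t) e)

  sortedSum-pair : ∀ {T T′ L} {g : ℕ → Carrier} (w : ℕ → Carrier) → AllPairs _≻_ (T ∷ T′ ∷ L) → (∀ t → g (suc t) ≈ q * g t) →
    (∀ t → letter T t ≈ w t * g t) → (∀ t → letter T′ t ≈ w t) →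
    sortedSum (T ∷ T′ ∷ L) ≐ (λ t → w t * (1# + g t)) ⊙ e ⋆ sortedSum L
  sortedSum-pair {T} {T′} {L} w sorted@(_ ∷ sorted′) g-suc p p′ =
    sortedSum-head sorted ≐∙ ⋆-congˡ (letter T ⊙ e) (sortedSum-head sorted′) ≐∙ merge w (sortedSum L) g-suc p p′

  private
    geometric-suc : ∀ x t → x * q ^ suc t ≈ q * (x * q ^ t)
    geometric-suc x t = solve 3 (λ x q y → x :* (q :* y) := q :* (x :* y)) refl x q (q ^ t)

  -- At position `t` the eight letters are the terms of `γˢ a₄ (1 + B)(1 + C)(1 + D)`. Neighbours
  -- have ratio `B`; the four factors obtained have ratio `C` in pairs, and the last two have ratio
  -- `D`.
  sortedSum-block : ∀ s L → AllPairs _≻_ (block s ++ L) → sortedSum (block s ++ L) ≐ (λ t → γ t ^ s * κ t) ⊙ e ⋆ sortedSum L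
  sortedSum-block s L p@(_ ∷ _ ∷ p₃@(_ ∷ _ ∷ p₅@(_ ∷ _ ∷ p₇@(_ ∷ _ ∷ _)))) =
    sortedSum-pair (λ t → W t * C t * D t) p B-suc
      (λ t → trans (letter-shiftBy s (2 ∷ 2 ∷ 2 ∷ 1 ∷ []) 3 ≡.refl t) (solve 6 (λ a b c d x g →
        g :* ((a :^ 2 :* (b :^ 2 :* (c :^ 2 :* d :^ 1))) :* x :^ 3) := g :* d :* (a :* c :* x) :* (b :* c :* x) :* (a :* b :* x)) refl a₁ a₂ a₃ a₄ (q ^ t) (γ t ^ s)))
      (λ t → trans (letter-shiftBy s (1 ∷ 1 ∷ 2 ∷ 1 ∷ []) 2 ≡.refl t) (solve 6 (λ a b c d x g →
        g :* ((a :^ 1 :* (b :^ 1 :* (c :^ 2 :* d :^ 1))) :* x :^ 2) := g :* d :* (a :* c :* x) :* (b :* c :* x)) refl a₁ a₂ a₃ a₄ (q ^ t) (γ t ^ s))) ≐∙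
    ⋆-congˡ ((λ t → W t * C t * D t * (1# + B t)) ⊙ e) (sortedSum-pair (λ t → W t * D t) p₃ B-suc
      (λ t → trans (letter-shiftBy s (1 ∷ 2 ∷ 1 ∷ 1 ∷ []) 2 ≡.refl t) (solve 6 (λ a b c d x g →
        g :* ((a :^ 1 :* (b :^ 2 :* (c :^ 1 :* d :^ 1))) :* x :^ 2) := g :* d :* (b :* c :* x) :* (a :* b :* x)) refl a₁ a₂ a₃ a₄ (q ^ t) (γ t ^ s)))
      (λ t → trans (letter-shiftBy s (0 ∷ 1 ∷ 1 ∷ 1 ∷ []) 1 ≡.refl t) (solve 6 (λ a b c d x g →
        g :* ((a :^ 0 :* (b :^ 1 :* (c :^ 1 :* d :^ 1))) :* x :^ 1) := g :* d :* (b :* c :* x)) refl a₁ a₂ a₃ a₄ (q ^ t) (γ t ^ s)))) ≐∙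
    merge (λ t → W t * D t * (1# + B t)) (sortedSum L₅) C-suc
      (λ t → solve 4 (λ w c d b → w :* c :* d :* b := w :* d :* b :* c) refl (W t) (C t) (D t) (1# + B t))
      (λ t → refl) ≐∙
    ⋆-congˡ ((λ t → W t * D t * (1# + B t) * (1# + C t)) ⊙ e) (sortedSum-pair (λ t → W t * C t) p₅ B-suc
      (λ t → trans (letter-shiftBy s (2 ∷ 1 ∷ 1 ∷ 1 ∷ []) 2 ≡.refl t) (solve 6 (λ a b c d x g →
        g :* ((a :^ 2 :* (b :^ 1 :* (c :^ 1 :* d :^ 1))) :* x :^ 2) := g :* d :* (a :* c :* x) :* (a :* b :* x)) refl a₁ a₂ a₃ a₄ (q ^ t) (γ t ^ s)))
      (λ t → trans (letter-shiftBy s (1 ∷ 0 ∷ 1 ∷ 1 ∷ []) 1 ≡.refl t) (solve 6 (λ a b c d x g →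
        g :* ((a :^ 1 :* (b :^ 0 :* (c :^ 1 :* d :^ 1))) :* x :^ 1) := g :* d :* (a :* c :* x)) refl a₁ a₂ a₃ a₄ (q ^ t) (γ t ^ s))) ≐∙
      ⋆-congˡ ((λ t → W t * C t * (1# + B t)) ⊙ e) (sortedSum-pair W p₇ B-suc
        (λ t → trans (letter-shiftBy s (1 ∷ 1 ∷ 0 ∷ 1 ∷ []) 1 ≡.refl t) (solve 6 (λ a b c d x g →
          g :* ((a :^ 1 :* (b :^ 1 :* (c :^ 0 :* d :^ 1))) :* x :^ 1) := g :* d :* (a :* b :* x)) refl a₁ a₂ a₃ a₄ (q ^ t) (γ t ^ s)))
        (λ t → trans (letter-shiftBy s (0 ∷ 0 ∷ 0 ∷ 1 ∷ []) 0 ≡.refl t) (solve 6 (λ a b c d x g →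
          g :* ((a :^ 0 :* (b :^ 0 :* (c :^ 0 :* d :^ 1))) :* x :^ 0) := g :* d) refl a₁ a₂ a₃ a₄ (q ^ t) (γ t ^ s)))) ≐∙
      merge (λ t → W t * (1# + B t)) (sortedSum L) C-suc
        (λ t → solve 3 (λ w c b → w :* c :* b := w :* b :* c) refl (W t) (C t) (1# + B t))
        (λ t → refl)) ≐∙
    merge (λ t → W t * (1# + B t) * (1# + C t)) (sortedSum L) D-suc
      (λ t → solve 4 (λ w d b c → w :* d :* b :* c := w :* b :* c :* d) refl (W t) (D t) (1# + B t) (1# + C t))
      (λ t → refl) ≐∙
    ⋆-congʳ (sortedSum L) (⊙-congʳ {f = e} λ t → solve 5 (λ g d b c x → g :* d :* b :* c :* x := g :* (d :* b :* c :* x)) refl (γ t ^ s) a₄ (1# + B t) (1# + C t) (1# + D t))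
    where
    W : ℕ → Carrier
    W t = γ t ^ s * a₄
    L₅ : List Quadruple
    L₅ = List.map (shiftBy s) (List.drop 4 block₀) ++ L
    B-suc = geometric-suc (a₁ * a₂)
    C-suc = geometric-suc (a₁ * a₃)
    D-suc = geometric-suc (a₂ * a₃)

  ground : Kernel
  ground = (λ t → a₃ * (1# + B t)) ⊙ e ⋆ ((λ _ → a₂) ⊙ e ⋆ (λ _ → a₁) ⊙ e)

  -- Only (1,1,1,0) and (0,0,1,0) are merged, again with ratio `B`; their factor matches
  -- `c (1 - abqᵗ)` in the transition for `c`.
  sortedSum-lowest : sortedSum lowest ≐ ground
  sortedSum-lowest with p@(_ ∷ _ ∷ p₃@(_ ∷ p₄@(_ ∷ []))) ← letters-sorted 0 =
    sortedSum-pair (λ _ → a₃) p (geometric-suc (a₁ * a₂))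
      (λ t → trans (letter-odd (1 ∷ 1 ∷ 1 ∷ 0 ∷ []) 1 ≡.refl t) (solve 5 (λ a b c d x →
        (a :^ 1 :* (b :^ 1 :* (c :^ 1 :* d :^ 0))) :* x :^ 1 := c :* (a :* b :* x)) refl a₁ a₂ a₃ a₄ (q ^ t)))
      (λ t → trans (letter-odd (0 ∷ 0 ∷ 1 ∷ 0 ∷ []) 0 ≡.refl t) (solve 5 (λ a b c d x →
        (a :^ 0 :* (b :^ 0 :* (c :^ 1 :* d :^ 0))) :* x :^ 0 := c) refl a₁ a₂ a₃ a₄ (q ^ t))) ≐∙
    ⋆-congˡ ((λ t → a₃ * (1# + B t)) ⊙ e) (sortedSum-head p₃ ≐∙ ⋆-cong
      (⊙-congʳ {f = e} λ t → trans (letter-odd (0 ∷ 1 ∷ 0 ∷ 0 ∷ []) 0 ≡.refl t) (solve 5 (λ a b c d x →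
        (a :^ 0 :* (b :^ 1 :* (c :^ 0 :* d :^ 0))) :* x :^ 0 := b) refl a₁ a₂ a₃ a₄ (q ^ t)))
      (sortedSum-head p₄ ≐∙ ⋆-congˡ X₁ sortedSum-[] ≐∙ ⋆-identityʳ X₁ ≐∙
        ⊙-congʳ {f = e} λ t → trans (letter-odd (1 ∷ 0 ∷ 0 ∷ 0 ∷ []) 0 ≡.refl t) (solve 5 (λ a b c d x →
        (a :^ 1 :* (b :^ 0 :* (c :^ 0 :* d :^ 0))) :* x :^ 0 := a) refl a₁ a₂ a₃ a₄ (q ^ t))))
    where
    X₁ = letter (1 ∷ 0 ∷ 0 ∷ 0 ∷ []) ⊙ e
    sortedSum-[] : sortedSum [] ≐ 𝟙
    sortedSum-[] k zero    = sortedSum-zero [] k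
    sortedSum-[] k (suc m) = refl

  module _ {r : ℕ → Carrier} (r-inverse : ∀ t → (1# - α t) * r t ≈ 1#) where

    reciprocal : Kernel
    reciprocal k m = Π r (k ℕ.+ k) m * 1/ m !

    -- Cauchy's identity at base `2k`: its numerators multiply values of `α` two steps apart, which
    -- are consecutive values of `γ`.
    reciprocal-step : reciprocal ≐ γ ⊙ reciprocal ⋆ e
    reciprocal-step k m = trans (sym (cauchy (geometric-suc a₁₂₃₄) r-inverse (k ℕ.+ k) m))
      (∑₊-cong (λ i j → *-congʳ (trans (*-assoc _ _ _) (*-congʳ (αα-γ k i)))) m)
      where
      αα-γ : ∀ k i → αα α (k ℕ.+ k) i ≈ Π γ k i
      αα-γ k zero    = refl
      αα-γ k (suc i) = *-congˡ (trans (reflexive (≡.cong (λ s → αα α (suc s) i) (≡.sym (ℕ.+-suc k k)))) (αα-γ (suc k) i))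

    top : Kernel
    top = κ ⊙ reciprocal

    -- top is the infinite product of the blocks: it absorbs the blocks one after another.
    top-step : ∀ M → (λ t → γ t ^ M) ⊙ top ≐ (λ t → γ t ^ suc M) ⊙ top ⋆ (λ t → γ t ^ M * κ t) ⊙ e
    top-step M =
      ⊙-⊙ (λ t → γ t ^ M) κ reciprocal ≐∙
      ⊙-congˡ reciprocal-step ≐∙
      ⊙-⋆ (λ t → γ t ^ M * κ t) (γ ⊙ reciprocal) e ≐∙
      ⋆-congʳ ((λ t → γ t ^ M * κ t) ⊙ e) (⊙-⊙ (λ t → γ t ^ M * κ t) γ reciprocal ≐∙
        ⊙-congʳ {f = reciprocal} (λ t → solve 3 (λ g k x → g :* k :* x := x :* g :* k) refl (γ t ^ M) (κ t) (γ t)) ≐∙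
        ≐-sym (⊙-⊙ (λ t → γ t ^ suc M) κ reciprocal))

    -- With `M` blocks split off, the front factor `γ ^ M ⊙ top` stands for all blocks of index at
    -- least `M`.
    top⋆ground : ∀ M → top ⋆ ground ≐ (λ t → γ t ^ M) ⊙ top ⋆ sortedSum (letters M)
    top⋆ground zero = ⋆-cong (λ k m → sym (trans (*-congʳ (Π-1 k m)) (*-identityˡ _))) (≐-sym sortedSum-lowest)
    top⋆ground (suc M) =
      top⋆ground M ≐∙
      ⋆-congʳ (sortedSum (letters M)) (top-step M) ≐∙
      ⋆-assoc ((λ t → γ t ^ suc M) ⊙ top) ((λ t → γ t ^ M * κ t) ⊙ e) (sortedSum (letters M)) ≐∙
      ⋆-congˡ ((λ t → γ t ^ suc M) ⊙ top) (≐-sym (sortedSum-block M (letters M) (letters-sorted (suc M))))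

    -- `γ` contains `a₁`, so off the diagonal the front factor is a multiple of `a₁ ^ M`, while on
    -- the diagonal it is 1. This congruence takes the place of convergence.
    top⋆ground-mod : ∀ M k m → Σ[ x ∈ Carrier ] (top ⋆ ground) k m ≈ sortedSum (letters M) k m + a₁ ^ M * x
    top⋆ground-mod M k m with remainder m
      where
      first : ∀ m → ((λ t → γ t ^ M) ⊙ top) k 0 * sortedSum (letters M) (k ℕ.+ 0) m ≈ sortedSum (letters M) k m
      first m = trans (*-cong (trans (*-congˡ (trans (*-congˡ (*-congˡ 1/0!)) (trans (*-identityˡ _) (*-identityˡ _)))) (*-identityˡ _))
        (reflexive (≡.cong (λ s → sortedSum (letters M) s m) (ℕ.+-identityʳ k)))) (*-identityˡ _)
      remainder : ∀ m → Σ[ x ∈ Carrier ] ((λ t → γ t ^ M) ⊙ top ⋆ sortedSum (letters M)) k m ≈ sortedSum (letters M) k m + a₁ ^ M * x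
      remainder zero    = 0# , trans (first 0) (sym (trans (+-congˡ (zeroʳ _)) (+-identityʳ _)))
      remainder (suc m) = _ , +-cong (first (suc m)) (trans (∑₊-cong (λ i j → *-congʳ (*-congʳ (*-congʳ
        (trans (^-congˡ M (*-assoc _ _ _)) (^-distrib-* a₁ _ M))))) m)
        (trans (∑₊-cong (λ i j → trans (*-congʳ (trans (*-congʳ (*-assoc _ _ _)) (*-assoc _ _ _))) (*-assoc _ _ _)) m) (∑₊-*ˡ _ _ m)))
    ... | x , p = x , trans (top⋆ground M k m) p

-- Passage between coefficients, power series and fractions

module StandardQFactorials (A : Ring₀) {q : El A} (q-unit : Units.Unit A q)
  (q-adm : QSeries.Base.Admissible A q-unit q) where
  open CommutativeRing A
  open Units A
  open SetoidReasoning setoid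
  open IntegerSolver A using (solve; _:=_; _:*_)
  open QSeries.Base A q-unit
  open Kernels A

  private
    !-suc : ∀ n → [_]! q-adm (suc n) ≈ [_]! q-adm n * bracket q-adm (suc n)
    !-suc n = trans (∏-Π (suc n) (bracket q-adm ∘ suc)) (trans (Π-sucʳ _ 0 n) (*-congʳ (sym (∏-Π n (bracket q-adm ∘ suc)))))

  standard : QFactorials A q
  standard = record
    { 1-q⁻¹       = inv (q-adm 0)
    ; 1-q-inverse = trans (*-congʳ (+-congˡ (-‿cong (sym (*-identityʳ q))))) (Unit.inverse (q-adm 0))
    ; 1/_!        = λ n → inv (unit-! q-adm n)
    ; 1/0!        = trans (sym (*-identityˡ _)) (Unit.inverse (unit-! q-adm 0))
    ; [suc]*1/!   = λ i → begin
        bracket q-adm (suc i) * inv (unit-! q-adm (suc i))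
          ≈⟨ trans (*-congʳ (Unit.inverse (unit-! q-adm i))) (*-identityˡ _) ⟨
        [_]! q-adm i * inv (unit-! q-adm i) * (bracket q-adm (suc i) * inv (unit-! q-adm (suc i)))
          ≈⟨ solve 4 (λ a b c d → a :* b :* (c :* d) := (a :* c) :* d :* b) refl _ _ _ _ ⟩
        [_]! q-adm i * bracket q-adm (suc i) * inv (unit-! q-adm (suc i)) * inv (unit-! q-adm i)
          ≈⟨ *-congʳ (trans (*-congʳ (sym (!-suc i))) (Unit.inverse (unit-! q-adm (suc i)))) ⟩
        1# * inv (unit-! q-adm i)
          ≈⟨ *-identityˡ _ ⟩
        inv (unit-! q-adm i) ∎
    ; [suc]-unit  = λ i → unit-* (q-adm i) (unit-inv (q-adm 0))
    }

module _ {A B : Ring₀} {f : El A → El B} (f-hom : Hom.IsHom A B f) where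
  private
    module A = CommutativeRing A
    module B = CommutativeRing B
    module f = Hom.IsHom f-hom
    module EB = CommutativeExp B.commutativeSemiring
    module KA = Kernels A
    module KB = Kernels B

  map-QFactorials : ∀ {q} → QFactorials A q → QFactorials B (f q)
  map-QFactorials {q} Q = record
    { 1-q⁻¹       = f Q.1-q⁻¹
    ; 1-q-inverse = B.trans (B.*-congʳ (B.sym (B.trans (f.+-homo _ _) (B.+-cong f.1#-homo (f.-‿homo _)))))
        (B.trans (B.sym (f.*-homo _ _)) (B.trans (f.⟦⟧-cong Q.1-q-inverse) f.1#-homo))
    ; 1/_!        = λ n → f (Q.1/ n !)
    ; 1/0!        = B.trans (f.⟦⟧-cong Q.1/0!) f.1#-homo
    ; [suc]*1/!   = λ i → B.trans (B.*-congʳ (B.sym (bracket (suc i)))) (B.trans (B.sym (f.*-homo _ _)) (f.⟦⟧-cong (Q.[suc]*1/! i)))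
    ; [suc]-unit  = λ i → Units.unit-resp B (bracket (suc i)) (Hom.unit-hom A B f-hom (Q.[suc]-unit i))
    }
    where
    module Q = QFactorials Q
    bracket : ∀ i → f (Q.[ i ]) B.≈ (B.1# B.- f q EB.^ i) B.* f Q.1-q⁻¹
    bracket i = B.trans (f.*-homo _ _) (B.*-congʳ (B.trans (f.+-homo _ _) (B.+-cong f.1#-homo
      (B.trans (f.-‿homo _) (B.-‿cong (Hom.^-hom A B f-hom q i))))))

  ∑₊-hom : ∀ h m → f (KA.∑₊ h m) B.≈ KB.∑₊ (λ i j → f (h i j)) m
  ∑₊-hom h zero    = B.refl
  ∑₊-hom h (suc m) = B.trans (f.+-homo _ _) (B.+-congˡ (∑₊-hom (h ∘ suc) m))

  Π-hom : ∀ g k m → f (KA.Π g k m) B.≈ KB.Π (f ∘ g) k m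
  Π-hom g k zero    = f.1#-homo
  Π-hom g k (suc m) = B.trans (f.*-homo _ _) (B.*-congˡ (Π-hom g (suc k) m))

  ⋆-hom : ∀ g h → (λ k m → f ((g KA.⋆ h) k m)) KB.≐ (λ k m → f (g k m)) KB.⋆ (λ k m → f (h k m))
  ⋆-hom g h k m = B.trans (∑₊-hom (λ i j → g k i A.* h (k ℕ.+ i) j) m) (KB.∑₊-cong (λ i j → f.*-homo _ _) m)

  ⊙-hom : ∀ g h → (λ k m → f ((g KA.⊙ h) k m)) KB.≐ (f ∘ g) KB.⊙ (λ k m → f (h k m))
  ⊙-hom g h k m = B.trans (f.*-homo _ _) (B.*-congʳ (Π-hom g k m))

module Transfer (K R L : Ring₀) {c : El K → El R} (c-hom : Hom.IsHom K R c) {ι : El R → El L} (ι-hom : Hom.IsHom R L ι)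
  {q : El K} (q-unit : Units.Unit K q) (q-adm : QSeries.Base.Admissible K q-unit q)
  (P : Parameters L) (I a₁ a₂ a₃ a₄ : El R)
  (q≡ : Parameters.q P ≡ ι (c q))
  (a≡ : Parameters.a P ≡ CommutativeRing._*_ L (ι I) (ι a₁))
  (b≡ : Parameters.b P ≡ CommutativeRing._*_ L (ι I) (ι a₂))
  (c≡ : Parameters.c P ≡ CommutativeRing._*_ L (ι I) (ι a₃))
  (d≡ : Parameters.d P ≡ CommutativeRing._*_ L (ι I) (ι a₄))
  (I-unit : Units.Unit L (ι I))
  (I² : CommutativeRing._≈_ R (CommutativeRing._*_ R I I) (CommutativeRing.-_ R (CommutativeRing.1# R)))
  (1-a₁*-unit : ∀ t → Units.Unit R (CommutativeRing._-_ R (CommutativeRing.1# R) (CommutativeRing._*_ R a₁ t)))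
  where

  private
    module R = CommutativeRing R
    module ER = CommutativeExp R.commutativeSemiring
    module ι = Hom.IsHom ι-hom
    module c = Hom.IsHom c-hom

  Q-K : QFactorials K q
  Q-K = StandardQFactorials.standard K q-unit q-adm

  Q-R : QFactorials R (c q)
  Q-R = map-QFactorials c-hom Q-K

  Q-L : QFactorials L (Parameters.q P)
  Q-L = ≡.subst (QFactorials L) (≡.sym q≡) (map-QFactorials ι-hom Q-R)

  module IP = InfiniteProduct Q-R a₁ a₂ a₃ a₄

  -- `α t` is a multiple of `a₁`, so the reciprocals exist in `R` itself and `top` is a kernel over
  -- `R`.
  r-R : ℕ → El R
  r-R t = Units.inv (1-a₁*-unit (a₂ R.* (a₃ R.* a₄) R.* c q ER.^ t))

  r-R-inverse : ∀ t → (R.1# R.- IP.α t) R.* r-R t R.≈ R.1#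
  r-R-inverse t = R.trans (R.*-congʳ (R.+-congˡ (R.-‿cong (R.*-assoc _ _ _)))) (Units.Unit.inverse (1-a₁*-unit _))

  top : Kernels.Kernel R
  top = IP.top r-R-inverse

  open CommutativeRing L
  open CommutativeExp commutativeSemiring using (_^_)
  open RingProperties ring using (-0#≈0#)
  open SetoidReasoning setoid
  open IntegerSolver L using (solve; con; _:=_; _:+_; _:*_; _:-_; :-_)
  open Units L using (Unit; inv)
  open Expansion P Q-L hiding (α)
  open Identities Q-L
  open Connection Q-L using (0s; 1s; transition; factor)

  private
    i⁻¹ : Carrier
    i⁻¹ = inv I-unit

    ιI² : ι I * ι I ≈ - 1#
    ιI² = trans (sym (ι.*-homo I I)) (trans (ι.⟦⟧-cong I²) (trans (ι.-‿homo _) (-‿cong ι.1#-homo)))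

    i⁻¹* : ∀ {u} x → u ≡ ι I * x → ∀ y → i⁻¹ * (u * y) ≈ x * y
    i⁻¹* x ≡.refl y = trans (solve 4 (λ j i x y → j :* (i :* x :* y) := i :* j :* (x :* y)) refl _ _ _ _)
      (trans (*-congʳ (Unit.inverse I-unit)) (*-identityˡ _))

    qᵗ : ∀ t → Parameters.q P ^ t ≈ ι (c q ER.^ t)
    qᵗ t = trans (reflexive (≡.cong (_^ t) q≡)) (sym (Hom.^-hom R L ι-hom (c q) t))

    subst-1/! : ∀ {q q′} (eq : q ≡ q′) (Q : QFactorials L q) n →
      QFactorials.1/_! (≡.subst (QFactorials L) eq Q) n ≡ QFactorials.1/_! Q n
    subst-1/! ≡.refl Q n = ≡.refl

    1/!≈ : ∀ n → 1/ n ! ≈ ι (QFactorials.1/_! Q-R n)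
    1/!≈ n = reflexive (subst-1/! (≡.sym q≡) (map-QFactorials ι-hom Q-R) n)

    -- A product of two parameters carries `I² = -1`; this is the origin of the plus signs on the
    -- combinatorial side.
    1+ι : ∀ {u v} x y → u ≡ ι I * ι x → v ≡ ι I * ι y → ∀ t → 1# - geo (u * v) t ≈ ι (R.1# R.+ x R.* y R.* c q ER.^ t)
    1+ι x y ≡.refl ≡.refl t = begin
      1# - ι I * ι x * (ι I * ι y) * Parameters.q P ^ t
        ≈⟨ +-congˡ (-‿cong (solve 4 (λ i x y z → i :* x :* (i :* y) :* z := (i :* i) :* (x :* y :* z)) refl _ _ _ _)) ⟩
      1# - ι I * ι I * (ι x * ι y * Parameters.q P ^ t)
        ≈⟨ +-congˡ (-‿cong (*-congʳ ιI²)) ⟩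
      1# - - 1# * (ι x * ι y * Parameters.q P ^ t)
        ≈⟨ solve 1 (λ z → con (+ 1) :- (:- con (+ 1)) :* z := con (+ 1) :+ z) refl _ ⟩
      1# + ι x * ι y * Parameters.q P ^ t
        ≈⟨ trans (ι.+-homo _ _) (+-cong ι.1#-homo (trans (ι.*-homo _ _) (*-cong (ι.*-homo _ _) (sym (qᵗ t))))) ⟨
      ι (R.1# R.+ x R.* y R.* c q ER.^ t) ∎

    1-0 : 1# - 0# ≈ 1#
    1-0 = trans (+-congˡ -0#≈0#) (+-identityʳ _)

    e≐ι : e ≐ (λ k m → ι (Identities.e Q-R k m))
    e≐ι k m = 1/!≈ m

    -- `W` starts at `abcdq⁻¹`, one step before `α`. Four parameters carry `I⁴ = 1`, so the sign
    -- stays.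
    r-shift : ∀ t → r (suc t) ≈ ι (r-R t)
    r-shift t = unit-cancel (abcd-adm 0 (suc t)) (trans (Unit.inverse (abcd-adm 0 (suc t))) (sym (begin
      (1# - W (suc t)) * ι (r-R t)
        ≈⟨ *-congʳ (begin
             1# - W (suc t)               ≈⟨ +-congˡ (-‿cong (begin
               W (suc t)
                 ≡⟨ ≡.cong₂ (λ x y → x * y * (q⁻¹ * 1#) * (Parameters.q P * Parameters.q P ^ t))
                      (≡.cong₂ _*_ (≡.cong₂ _*_ a≡ b≡) c≡) d≡ ⟩
               ι I * ι a₁ * (ι I * ι a₂) * (ι I * ι a₃) * (ι I * ι a₄) * (q⁻¹ * 1#) * (Parameters.q P * Parameters.q P ^ t)
                 ≈⟨ solve 8 (λ i a b c d p q x → i :* a :* (i :* b) :* (i :* c) :* (i :* d) :* (p :* con (+ 1)) :* (q :* x) :=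
                      (i :* i) :* (i :* i) :* (q :* p) :* (a :* (b :* (c :* d)) :* x)) refl (ι I) (ι a₁) (ι a₂) (ι a₃) (ι a₄) q⁻¹ (Parameters.q P) _ ⟩
               ι I * ι I * (ι I * ι I) * (Parameters.q P * q⁻¹) * (ι a₁ * (ι a₂ * (ι a₃ * ι a₄)) * Parameters.q P ^ t)
                 ≈⟨ *-congʳ (*-cong (*-cong ιI² ιI²) q*q⁻¹) ⟩
               - 1# * - 1# * 1# * (ι a₁ * (ι a₂ * (ι a₃ * ι a₄)) * Parameters.q P ^ t)
                 ≈⟨ solve 1 (λ x → (:- con (+ 1)) :* (:- con (+ 1)) :* con (+ 1) :* x := x) refl _ ⟩
               ι a₁ * (ι a₂ * (ι a₃ * ι a₄)) * Parameters.q P ^ t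
                 ≈⟨ trans (ι.*-homo _ _) (*-cong (trans (ι.*-homo _ _) (*-congˡ (trans (ι.*-homo _ _) (*-congˡ (ι.*-homo _ _)))))
                      (sym (qᵗ t))) ⟨
               ι (IP.α t) ∎)) ⟩
             1# - ι (IP.α t)              ≈⟨ trans (ι.+-homo _ _) (+-cong ι.1#-homo (ι.-‿homo _)) ⟨
             ι (R.1# R.- IP.α t)          ∎) ⟩
      ι (R.1# R.- IP.α t) * ι (r-R t)     ≈⟨ ι.*-homo _ _ ⟨
      ι ((R.1# R.- IP.α t) R.* r-R t)     ≈⟨ trans (ι.⟦⟧-cong (r-R-inverse t)) ι.1#-homo ⟩
      1#                                  ∎)))
      where open Parameters P using (abcd-adm)

    ι-* : ∀ x y → ι (x R.* y) ≈ ι x * ι y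
    ι-* = ι.*-homo

    -- An entry at distance `m` from the diagonal contains `m` leading parameters, each with one
    -- factor `I`, and the power of `i⁻¹` removes them.
    scaled-chain : (λ _ → i⁻¹) ⊙ chain ≐ (λ k m → ι ((Kernels._⋆_ R top IP.ground) k m))
    scaled-chain =
      ⊙-⋆ _ T₄ (T₃ ⋆ (T₂ ⋆ T₁)) ≐∙
      ⋆-cong E₄ (⊙-⋆ _ T₃ (T₂ ⋆ T₁) ≐∙ ⋆-cong E₃ (⊙-⋆ _ T₂ T₁ ≐∙ ⋆-cong E₂ E₁ ≐∙ ≐-sym (⋆-hom ι-hom S₂ S₁)) ≐∙
        ≐-sym (⋆-hom ι-hom S₃ (S₂ KR.⋆ S₁))) ≐∙
      ≐-sym (⋆-hom ι-hom top IP.ground)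
      where
      module KR = Kernels R
      open Parameters P using (a; b; d) renaming (c to c′)
      T₄ = transition d AB AC BC r
      T₃ = transition c′ AB 0s 0s 1s
      T₂ = transition b 0s 0s 0s 1s
      T₁ = (λ _ → a) ⊙ e
      S₃ S₂ S₁ : KR.Kernel
      S₃ = (λ t → a₃ R.* (R.1# R.+ IP.B t)) KR.⊙ Identities.e Q-R
      S₂ = (λ _ → a₂) KR.⊙ Identities.e Q-R
      S₁ = (λ _ → a₁) KR.⊙ Identities.e Q-R
      E₁ : (λ _ → i⁻¹) ⊙ T₁ ≐ (λ k m → ι (S₁ k m))
      E₁ = ⊙-⊙ (λ _ → i⁻¹) (λ _ → a) e ≐∙ ⊙-congʳ {f = e} (λ t → trans (*-congˡ (sym (*-identityʳ _))) (trans (i⁻¹* (ι a₁) a≡ 1#) (*-identityʳ _))) ≐∙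
        ⊙-congˡ e≐ι ≐∙ ≐-sym (⊙-hom ι-hom _ _)
      flat : ∀ x AB′ AC′ BC′ → transition x AB′ AC′ BC′ 1s ≐ factor x AB′ AC′ BC′ ⊙ e
      flat x AB′ AC′ BC′ k m = *-congʳ (trans (*-congˡ (Π-1 _ m)) (*-identityʳ _))
      E₂ : (λ _ → i⁻¹) ⊙ T₂ ≐ (λ k m → ι (S₂ k m))
      E₂ = ⊙-congˡ (flat b 0s 0s 0s) ≐∙ ⊙-⊙ (λ _ → i⁻¹) (factor b 0s 0s 0s) e ≐∙
        ⊙-congʳ {f = e} (λ t → trans (i⁻¹* (ι a₂) b≡ _) (trans (*-congˡ (trans (*-cong (trans (*-cong 1-0 1-0) (*-identityˡ _)) 1-0) (*-identityˡ _))) (*-identityʳ _))) ≐∙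
        ⊙-congˡ e≐ι ≐∙ ≐-sym (⊙-hom ι-hom _ _)
      E₃ : (λ _ → i⁻¹) ⊙ T₃ ≐ (λ k m → ι (S₃ k m))
      E₃ = ⊙-congˡ (flat c′ AB 0s 0s) ≐∙ ⊙-⊙ (λ _ → i⁻¹) (factor c′ AB 0s 0s) e ≐∙
        ⊙-congʳ {f = e} (λ t → trans (i⁻¹* (ι a₃) c≡ _) (trans (*-congˡ (trans (*-cong (trans (*-cong (1+ι a₁ a₂ a≡ b≡ t) 1-0) (*-identityʳ _)) 1-0) (*-identityʳ _))) (sym (ι-* _ _)))) ≐∙
        ⊙-congˡ e≐ι ≐∙ ≐-sym (⊙-hom ι-hom _ _)
      E₄ : (λ _ → i⁻¹) ⊙ T₄ ≐ (λ k m → ι (top k m))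
      E₄ = (λ k m → *-congˡ (*-assoc _ _ _)) ≐∙
        ⊙-⊙ (λ _ → i⁻¹) (factor d AB AC BC) (λ k m → Π r (suc (k ℕ.+ k)) m * 1/ m !) ≐∙
        (λ k m → *-cong
          (Π-cong (λ t → trans (i⁻¹* (ι a₄) d≡ _) (trans (*-congˡ (*-cong (*-cong (1+ι a₁ a₂ a≡ b≡ t) (1+ι a₁ a₃ a≡ c≡ t)) (1+ι a₂ a₃ b≡ c≡ t)))
            (sym (trans (ι-* _ _) (trans (*-congʳ (trans (ι-* _ _) (*-congʳ (ι-* _ _))))
              (solve 4 (λ a b c d → a :* b :* c :* d := a :* (b :* c :* d)) refl _ _ _ _)))))) k m)
          (*-congʳ (trans (sym (Π-shift r 1 (k ℕ.+ k) m)) (trans (Π-cong r-shift (k ℕ.+ k) m) (sym (Π-hom ι-hom r-R (k ℕ.+ k) m)))))) ≐∙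
        (λ k m → *-congˡ (trans (*-congˡ (1/!≈ m)) (sym (ι-* _ _)))) ≐∙
        ≐-sym (⊙-hom ι-hom IP.κ (IP.reciprocal r-R-inverse))

    aa-adm : ∀ {u} → u ≡ ι I * ι a₁ → ∀ i → Unit (1# - u * u * Parameters.q P ^ i)
    aa-adm ≡.refl i = Units.unit-resp L (begin
      ι (R.1# R.- a₁ R.* (I R.* (I R.* a₁) R.* c q ER.^ i))
        ≈⟨ trans (ι.+-homo _ _) (+-cong ι.1#-homo (trans (ι.-‿homo _) (-‿cong (trans (ι-* _ _) (*-congˡ (trans (ι-* _ _)
             (*-cong (trans (ι-* _ _) (*-congˡ (ι-* _ _))) (sym (qᵗ i))))))))) ⟩
      1# - ι a₁ * (ι I * (ι I * ι a₁) * Parameters.q P ^ i)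
        ≈⟨ +-congˡ (-‿cong (solve 3 (λ i a x → a :* (i :* (i :* a) :* x) := i :* a :* (i :* a) :* x) refl _ _ _)) ⟩
      1# - ι I * ι a₁ * (ι I * ι a₁) * Parameters.q P ^ i ∎) (Hom.unit-hom R L ι-hom (1-a₁*-unit _))

  open QSeries.Base K q-unit using (unit-!) renaming ([_]! to [_]!′)

  -- The normalisation is undone: `[n]!/[k]!` returns as an element of the coefficient ring `K`.
  connection-product : ∀ σ → AskeyWilson.IsConnection P σ → ∀ k m →
    (1# + 1#) ^ m * i⁻¹ ^ m * σ (k ℕ.+ m) k ≈
    ι (c (CommutativeRing._*_ K ([_]!′ q-adm (k ℕ.+ m)) (Units.inv (unit-! q-adm k))) R.* (Kernels._⋆_ R top IP.ground) k m)
  connection-product σ σ-connection k m = begin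
    (1# + 1#) ^ m * i⁻¹ ^ m * σ n k
      ≈⟨ trans (*-congˡ (trans (*-cong n!-inverse (factorial-inverse k)) (*-identityˡ _))) (*-identityʳ _) ⟨
    (1# + 1#) ^ m * i⁻¹ ^ m * σ n k * (n! * 1/ n ! * (factorial k * 1/ k !))
      ≈⟨ solve 7 (λ t i s n n′ k k′ → t :* i :* s :* (n :* n′ :* (k :* k′)) := n :* k′ :* (i :* (t :* s :* (n′ :* k)))) refl _ _ _ _ _ _ _ ⟩
    n! * 1/ k ! * (i⁻¹ ^ m * ((1# + 1#) ^ m * σ n k * (1/ n ! * factorial k)))
      ≈⟨ *-cong (trans (*-congˡ (1/!≈ k)) (sym (trans (ι.⟦⟧-cong (c.*-homo _ _)) (ι-* _ _)))) (*-cong (sym (Π-const i⁻¹ k m)) (connection-chain (aa-adm a≡) σ σ-connection k m)) ⟩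
    ι (c (CommutativeRing._*_ K ([_]!′ q-adm n) (Units.inv (unit-! q-adm k)))) * ((λ _ → i⁻¹) ⊙ chain) k m
      ≈⟨ *-congˡ (scaled-chain k m) ⟩
    ι (c (CommutativeRing._*_ K ([_]!′ q-adm n) (Units.inv (unit-! q-adm k)))) * ι ((Kernels._⋆_ R top IP.ground) k m)
      ≈⟨ ι-* _ _ ⟨
    ι (c (CommutativeRing._*_ K ([_]!′ q-adm n) (Units.inv (unit-! q-adm k))) R.* (Kernels._⋆_ R top IP.ground) k m) ∎
    where
    n = k ℕ.+ m
    n! : Carrier
    n! = ι (c ([_]!′ q-adm n))
    n!-inverse : n! * 1/ n ! ≈ 1#
    n!-inverse = trans (*-congˡ (1/!≈ n)) (trans (sym (trans (ι.⟦⟧-cong (c.*-homo _ _)) (ι-* _ _)))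
      (trans (ι.⟦⟧-cong (R.trans (c.⟦⟧-cong (Units.Unit.inverse (unit-! q-adm n))) c.1#-homo)) ι.1#-homo))

-- Coefficients of formal power series

module _ (A : Ring₀) where
  open CommutativeRing A
  open IntegerSolver A using (solve; con; _:=_; _:+_; _:*_; _:-_)

  fixed-point⇒inverse : ∀ x f g → g ≈ 1# + x * (f * g) → (1# - x * f) * g ≈ 1#
  fixed-point⇒inverse x f g p = trans (solve 3 (λ x f g → (con (+ 1) :- x :* f) :* g := g :- x :* (f :* g)) refl x f g)
    (trans (+-congʳ p) (solve 1 (λ y → con (+ 1) :+ y :- y := con (+ 1)) refl _))

module SeriesCoefficients (A : Ring₀) where
  open CommutativeRing A hiding (zero)
  open Series A using (conv; const; X; series; conv-constˡ)
  private
    module S = CommutativeRing series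
    module ES = CommutativeExp S.commutativeSemiring

  X*-suc : ∀ h n → (X S.* h) (suc n) ≈ h n
  X*-suc h n = trans (+-cong (zeroˡ _) (trans (conv-constˡ 1# h n) (*-identityˡ _))) (+-identityˡ _)

  monomial-≡ : ∀ c t g → (const c S.* (X ES.^ t S.* const g)) t ≈ c * g
  monomial-≡ c t g = trans (conv-constˡ c _ t) (*-congˡ (diagonal t))
    where
    diagonal : ∀ t → (X ES.^ t S.* const g) t ≈ g
    diagonal zero    = *-identityˡ g
    diagonal (suc t) = trans (S.*-assoc X (X ES.^ t) (const g) (suc t)) (trans (X*-suc _ t) (diagonal t))

  monomial-≢ : ∀ c t g n → n ≢ t → (const c S.* (X ES.^ t S.* const g)) n ≈ 0#
  monomial-≢ c t g n n≢t = trans (conv-constˡ c _ n) (trans (*-congˡ (off-diagonal t n n≢t)) (zeroʳ c))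
    where
    off-diagonal : ∀ t n → n ≢ t → (X ES.^ t S.* const g) n ≈ 0#
    off-diagonal zero    zero    p = contradiction ≡.refl p
    off-diagonal zero    (suc n) p = S.*-identityˡ (const g) (suc n)
    off-diagonal (suc t) zero    p = trans (S.*-assoc X (X ES.^ t) (const g) 0) (zeroˡ _)
    off-diagonal (suc t) (suc n) p = trans (S.*-assoc X (X ES.^ t) (const g) (suc n))
      (trans (X*-suc _ n) (off-diagonal t n (p ∘ ≡.cong suc)))

  X^*-vanishes : ∀ M h n → n < M → (X ES.^ M S.* h) n ≈ 0#
  X^*-vanishes (suc M) h zero    _         = trans (S.*-assoc X (X ES.^ M) h 0) (zeroˡ _)
  X^*-vanishes (suc M) h (suc n) (s≤s n<M) = trans (S.*-assoc X (X ES.^ M) h (suc n)) (trans (X*-suc _ n) (X^*-vanishes M h n n<M))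

  conv-cong≤ : ∀ f {g h} n → (∀ i → i ≤ n → g i ≈ h i) → conv f g n ≈ conv f h n
  conv-cong≤ f zero    p = *-congˡ (p 0 z≤n)
  conv-cong≤ f (suc n) p = +-cong (*-congˡ (p (suc n) ℕ.≤-refl)) (conv-cong≤ (f ∘ suc) n λ i i≤n → p i (ℕ.m≤n⇒m≤1+n i≤n))

  -- The inverse is the fixed point of `g ↦ 1 + X f g`. Its coefficient at `n` is final after `n`
  -- iterations, so the limit is read off along the diagonal.
  1-X*-unit : ∀ f → Units.Unit series (S.1# S.- X S.* f)
  1-X*-unit f = Units.mkUnit limit (fixed-point⇒inverse series X f limit limit-fixed)
    where
    approximation : ℕ → ℕ → Carrier
    approximation zero    = S.1#
    approximation (suc N) = S.1# S.+ X S.* (f S.* approximation N)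
    X*-cong : ∀ {g h} n → (∀ i → i < n → g i ≈ h i) → (X S.* (f S.* g)) n ≈ (X S.* (f S.* h)) n
    X*-cong zero    p = trans (zeroˡ _) (sym (zeroˡ _))
    X*-cong (suc n) p = trans (X*-suc _ n) (trans (conv-cong≤ f n (λ i i≤n → p i (s≤s i≤n))) (sym (X*-suc _ n)))
    stable : ∀ N n → n ≤ N → approximation (suc N) n ≈ approximation N n
    stable zero    .zero z≤n = trans (+-congˡ (zeroˡ _)) (+-identityʳ _)
    stable (suc N) n     n≤N = +-congˡ (X*-cong n λ i i<n → stable N i (ℕ.s≤s⁻¹ (ℕ.≤-trans i<n n≤N)))
    limit : ℕ → Carrier
    limit n = approximation n n
    limit-≈ : ∀ N n → n ≤ N → limit n ≈ approximation N n
    limit-≈ N n n≤N with ℕ.m≤n⇒∃[o]m+o≡n n≤N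
    ... | zero  , ≡.refl rewrite ℕ.+-identityʳ n = refl
    ... | suc o , ≡.refl rewrite ℕ.+-suc n o = trans (limit-≈ (n ℕ.+ o) n (ℕ.m≤m+n n o)) (sym (stable (n ℕ.+ o) n (ℕ.m≤m+n n o)))
    limit-fixed : ∀ n → limit n ≈ (S.1# S.+ X S.* (f S.* limit)) n
    limit-fixed n = trans (sym (stable n n ℕ.≤-refl)) (+-congˡ (X*-cong n λ i i<n → sym (limit-≈ n i (ℕ.<⇒≤ i<n))))

module FilteredSum (A : Ring₀) where
  open CommutativeRing A
  open ListSum A

  ∑ᴸ-filter : ∀ {X : Set} {P : X → Set} (P? : Decidable P) (f g : X → Carrier) xs →
    (∀ x → P x → f x ≈ g x) → (∀ x → ¬ P x → f x ≈ 0#) → ∑ᴸ f xs ≈ ∑ᴸ g (filter P? xs)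
  ∑ᴸ-filter P? f g []       p r = refl
  ∑ᴸ-filter P? f g (x ∷ xs) p r with P? x
  ... | yes Px = +-cong (p x Px) (∑ᴸ-filter P? f g xs p r)
  ... | no ¬Px = trans (+-cong (r x ¬Px) (∑ᴸ-filter P? f g xs p r)) (+-identityˡ _)

  ∑ᴸ-↭ : ∀ {X : Set} (f : X → Carrier) {xs ys} → xs ↭ ys → ∑ᴸ f xs ≈ ∑ᴸ f ys
  ∑ᴸ-↭ f Permutation.refl         = refl
  ∑ᴸ-↭ f (Permutation.prep x p)   = +-congˡ (∑ᴸ-↭ f p)
  ∑ᴸ-↭ f (Permutation.swap x y p) = trans (sym (+-assoc _ _ _)) (trans (+-cong (+-comm _ _) (∑ᴸ-↭ f p)) (+-assoc _ _ _))
  ∑ᴸ-↭ f (Permutation.trans p r)  = trans (∑ᴸ-↭ f p) (∑ᴸ-↭ f r)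

module Series₄Coefficients (A : Ring₀) where
  open CommutativeRing A
  open Series₄ A
  private
    A₁ = Series.series A
    A₂ = Series.series A₁
    A₃ = Series.series A₂
    module S₀ = Series A
    module S₁ = Series A₁
    module S₂ = Series A₂
    module S₃ = Series A₃
    module R₁ = CommutativeRing A₁
    module R₂ = CommutativeRing A₂
    module R₃ = CommutativeRing A₃
    module R₄ = CommutativeRing series₄
    module E₁ = CommutativeExp R₁.commutativeSemiring
    module E₂ = CommutativeExp R₂.commutativeSemiring
    module E₃ = CommutativeExp R₃.commutativeSemiring
    module E₄ = CommutativeExp R₄.commutativeSemiring

    m₁ : ℕ → A₁ .CommutativeRing.Carrier
    m₁ t₄ = S₀.X E₁.^ t₄ R₁.* S₀.const 1#
    m₂ : ℕ → ℕ → A₂ .CommutativeRing.Carrier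
    m₂ t₃ t₄ = S₁.X E₂.^ t₃ R₂.* S₁.const (m₁ t₄)
    m₃ : ℕ → ℕ → ℕ → A₃ .CommutativeRing.Carrier
    m₃ t₂ t₃ t₄ = S₂.X E₃.^ t₂ R₃.* S₂.const (m₂ t₃ t₄)

  monomial₄ : Quadruple → El series₄
  monomial₄ (t₁ ∷ t₂ ∷ t₃ ∷ t₄ ∷ []) = a₁ E₄.^ t₁ R₄.* (a₂ E₄.^ t₂ R₄.* (a₃ E₄.^ t₃ R₄.* a₄ E₄.^ t₄))

  private
    -- At each level the remaining variables are collected under one `const`, so that coefficients
    -- can be read one variable at a time.
    nested : ∀ t₁ t₂ t₃ t₄ → monomial₄ (t₁ ∷ t₂ ∷ t₃ ∷ t₄ ∷ []) R₄.≈ S₃.X E₄.^ t₁ R₄.* S₃.const (m₃ t₂ t₃ t₄)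
    nested t₁ t₂ t₃ t₄ = R₄.*-congˡ {S₃.X E₄.^ t₁} (R₄.trans
      (R₄.*-cong (R₄.sym (Hom.^-hom A₃ series₄ S₃.const-hom S₂.X t₂)) (R₄.trans
        (R₄.*-cong (R₄.sym (Hom.^-hom A₃ series₄ S₃.const-hom (S₂.const S₁.X) t₃)) (R₄.sym (Hom.^-hom A₃ series₄ S₃.const-hom (S₂.const (S₁.const S₀.X)) t₄)))
        (R₄.sym (C₃.*-homo _ _))))
      (R₄.trans (R₄.sym (C₃.*-homo _ _)) (C₃.⟦⟧-cong (R₃.*-congˡ {S₂.X E₃.^ t₂} (R₃.trans
        (R₃.*-cong (R₃.sym (Hom.^-hom A₂ A₃ S₂.const-hom S₁.X t₃)) (R₃.sym (Hom.^-hom A₂ A₃ S₂.const-hom (S₁.const S₀.X) t₄)))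
        (R₃.trans (R₃.sym (C₂.*-homo _ _)) (C₂.⟦⟧-cong (R₂.*-congˡ {S₁.X E₂.^ t₃} (R₂.trans
          (R₂.sym (Hom.^-hom A₁ A₂ S₁.const-hom S₀.X t₄)) (C₁.⟦⟧-cong (R₁.sym (R₁.*-identityʳ _))))))))))))
      where
      module C₁ = Hom.IsHom S₁.const-hom
      module C₂ = Hom.IsHom S₂.const-hom
      module C₃ = Hom.IsHom S₃.const-hom

    module M₀ = SeriesCoefficients A
    module M₁ = SeriesCoefficients A₁
    module M₂ = SeriesCoefficients A₂
    module M₃ = SeriesCoefficients A₃

  coefficient : El series₄ → Quadruple → Carrier
  coefficient f (e₁ ∷ e₂ ∷ e₃ ∷ e₄ ∷ []) = f e₁ e₂ e₃ e₄

  coefficient-≈ : ∀ f g → f R₄.≈ g → ∀ e → coefficient f e ≈ coefficient g e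
  coefficient-≈ f g p (e₁ ∷ e₂ ∷ e₃ ∷ e₄ ∷ []) = p e₁ e₂ e₃ e₄

  coefficient-const* : ∀ c f e → coefficient (const₄ c R₄.* f) e ≈ c * coefficient f e
  coefficient-const* c f (e₁ ∷ e₂ ∷ e₃ ∷ e₄ ∷ []) =
    trans (S₃.conv-constˡ (S₂.const (S₁.const (S₀.const c))) f e₁ e₂ e₃ e₄)
    (trans (S₂.conv-constˡ (S₁.const (S₀.const c)) (f e₁) e₂ e₃ e₄)
    (trans (S₁.conv-constˡ (S₀.const c) (f e₁ e₂) e₃ e₄)
    (S₀.conv-constˡ c (f e₁ e₂ e₃) e₄)))

  coefficient-monomial-≡ : ∀ c T → coefficient (const₄ c R₄.* monomial₄ T) T ≈ c
  coefficient-monomial-≡ c (t₁ ∷ t₂ ∷ t₃ ∷ t₄ ∷ []) =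
    trans (R₄.*-congˡ {const₄ c} (nested t₁ t₂ t₃ t₄) t₁ t₂ t₃ t₄)
    (trans (M₃.monomial-≡ (S₂.const (S₁.const (S₀.const c))) t₁ (m₃ t₂ t₃ t₄) t₂ t₃ t₄)
    (trans (M₂.monomial-≡ (S₁.const (S₀.const c)) t₂ (m₂ t₃ t₄) t₃ t₄)
    (trans (M₁.monomial-≡ (S₀.const c) t₃ (m₁ t₄) t₄)
    (trans (M₀.monomial-≡ c t₄ 1#) (*-identityʳ c)))))

  coefficient-monomial-≢ : ∀ c T e → T ≢ e → coefficient (const₄ c R₄.* monomial₄ T) e ≈ 0#
  coefficient-monomial-≢ c (t₁ ∷ t₂ ∷ t₃ ∷ t₄ ∷ []) (e₁ ∷ e₂ ∷ e₃ ∷ e₄ ∷ []) T≢e =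
    trans (R₄.*-congˡ {const₄ c} (nested t₁ t₂ t₃ t₄) e₁ e₂ e₃ e₄) level₁
    where
    level₁ : (const₄ c R₄.* (S₃.X E₄.^ t₁ R₄.* S₃.const (m₃ t₂ t₃ t₄))) e₁ e₂ e₃ e₄ ≈ 0#
    level₁ with e₁ ℕ.≟ t₁
    ... | no e₁≢t₁ = M₃.monomial-≢ (S₂.const (S₁.const (S₀.const c))) t₁ (m₃ t₂ t₃ t₄) e₁ e₁≢t₁ e₂ e₃ e₄
    ... | yes ≡.refl = trans (M₃.monomial-≡ (S₂.const (S₁.const (S₀.const c))) t₁ (m₃ t₂ t₃ t₄) e₂ e₃ e₄) level₂
      where
      level₂ : (S₂.const (S₁.const (S₀.const c)) R₃.* m₃ t₂ t₃ t₄) e₂ e₃ e₄ ≈ 0#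
      level₂ with e₂ ℕ.≟ t₂
      ... | no e₂≢t₂ = M₂.monomial-≢ (S₁.const (S₀.const c)) t₂ (m₂ t₃ t₄) e₂ e₂≢t₂ e₃ e₄
      ... | yes ≡.refl = trans (M₂.monomial-≡ (S₁.const (S₀.const c)) t₂ (m₂ t₃ t₄) e₃ e₄) level₃
        where
        level₃ : (S₁.const (S₀.const c) R₂.* m₂ t₃ t₄) e₃ e₄ ≈ 0#
        level₃ with e₃ ℕ.≟ t₃
        ... | no e₃≢t₃ = M₁.monomial-≢ (S₀.const c) t₃ (m₁ t₄) e₃ e₃≢t₃ e₄
        ... | yes ≡.refl = trans (M₁.monomial-≡ (S₀.const c) t₃ (m₁ t₄) e₄)
                (M₀.monomial-≢ c t₄ 1# e₄ λ { ≡.refl → T≢e ≡.refl })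

  coefficient-a₁^* : ∀ M f e → Vec.lookup e 0F < M → coefficient (a₁ E₄.^ M R₄.* f) e ≈ 0#
  coefficient-a₁^* M f (e₁ ∷ e₂ ∷ e₃ ∷ e₄ ∷ []) e₁<M = M₃.X^*-vanishes M f e₁ e₁<M e₂ e₃ e₄

  coefficient-∑ᴸ : ∀ {X : Set} (f : X → El series₄) xs e →
    coefficient (ListSum.∑ᴸ series₄ f xs) e ≡ ListSum.∑ᴸ A (λ x → coefficient (f x) e) xs
  coefficient-∑ᴸ f []       (_ ∷ _ ∷ _ ∷ _ ∷ []) = ≡.refl
  coefficient-∑ᴸ f (x ∷ xs) e@(e₁ ∷ e₂ ∷ e₃ ∷ e₄ ∷ []) = ≡.cong (λ s → f x e₁ e₂ e₃ e₄ + s) (coefficient-∑ᴸ f xs e)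

-- Comparison of coefficients and conclusion

module Weights (F R : Ring₀) {c : El F → El R} (c-hom : Hom.IsHom F R c) {q : El F} (q-unit : Units.Unit F q)
  (q-adm : QSeries.Base.Admissible F q-unit q) (a₁ a₂ a₃ a₄ : El R) where
  private
    module F = CommutativeRing F
    module R = CommutativeRing R
    module c = Hom.IsHom c-hom
    module EF = CommutativeExp F.commutativeSemiring
    module LF = ListSum F
    open QSeries.Base F q-unit using (multinomial; unit-!; ∏ᴸ) renaming ([_]! to [_]!′)
    open Units F using (inv)

  module IP = InfiniteProduct (map-QFactorials c-hom (StandardQFactorials.standard F q-unit q-adm)) a₁ a₂ a₃ a₄

  weightOf : ∀ {m} → ℕ → Vec Quadruple m → El F
  weightOf k w = (q EF.^ (‖ w ‖from k)) F.* ∏ᴸ (List.map (λ m → inv (unit-! q-adm m)) (runs w))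

  prefactor : ℕ → ℕ → El F
  prefactor n k = [_]!′ q-adm n F.* inv (unit-! q-adm k)

  term-weight : ∀ {m} k (w : Vec Quadruple m) →
    IP.powers k w R.* IP.runWeight (runs w) R.≈ c (weightOf k w) R.* IP.monomial (total w)
  term-weight k w = R.trans (R.*-cong (R.*-congˡ (R.sym (Hom.^-hom F R c-hom q (‖ w ‖from k)))) (R.sym (run-hom (runs w))))
    (R.trans (R.trans (R.*-assoc _ _ _) (R.*-comm _ _)) (R.*-congʳ (R.sym (c.*-homo _ _))))
    where
    run-hom : ∀ ms → c (∏ᴸ (List.map (λ m → inv (unit-! q-adm m)) ms)) R.≈ IP.runWeight ms
    run-hom []       = c.1#-homo
    run-hom (m ∷ ms) = R.trans (c.*-homo _ _) (R.*-congˡ (run-hom ms))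

  𝒯-words : ∀ m → Quadruple → List (Vec Quadruple m)
  𝒯-words m e = filter (λ w → is𝒯-sequence? w ×-dec Vec.≡-dec ℕ._≟_ (total w) e) (words m (box e))

  prefactor*∑weightOf : ∀ n k m e → let M = suc (Vec.lookup e 0F) in
    prefactor n k F.* LF.∑ᴸ (weightOf k) (filter (λ w → Vec.≡-dec ℕ._≟_ (total w) e) (sortedWords m (letters M))) F.≈
    LF.∑ᴸ (λ w → (q EF.^ (‖ w ‖from k)) F.* multinomial q-adm n k (runs w)) (𝒯-words m e)
  prefactor*∑weightOf n k m e = F.trans
    (F.*-congˡ (FilteredSum.∑ᴸ-↭ F (weightOf k) (Permutation.↭-sym (𝒯-words↭sortedWords m e (Vec.lookup e 0F) ℕ.≤-refl))))
    (F.trans (F.sym (LF.∑ᴸ-*ˡ (prefactor n k) (weightOf k) (𝒯-words m e)))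
      (LF.∑ᴸ-cong (𝒯-words m e) λ _ → F.trans (F.sym (F.*-assoc _ _ _)) (F.trans (F.*-congʳ (F.*-comm _ _)) (F.*-assoc _ _ _))))

module ProductCoefficients (F B : Ring₀) {re : El F → El B} (re-hom : Hom.IsHom F B re) {q : El F} (q-unit : Units.Unit F q)
  (q-adm : QSeries.Base.Admissible F q-unit q) where
  private
    module F = CommutativeRing F
    module B = CommutativeRing B
    module re = Hom.IsHom re-hom
    module EF = CommutativeExp F.commutativeSemiring
    open Series₄ B
    R = series₄
    module R = CommutativeRing R
    module ER = CommutativeExp R.commutativeSemiring
    module LF = ListSum F
    module LB = ListSum B
    open Series₄Coefficients B
    open QSeries.Base F q-unit using (multinomial)

  c : El F → El R
  c = const₄ ∘ re

  c-hom : Hom.IsHom F R c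
  c-hom = hom-∘ {F} {B} {R} re-hom const₄-hom

  open Weights F R c-hom q-unit q-adm a₁ a₂ a₃ a₄

  ∑ᴸ-re : ∀ {X : Set} (f : X → El F) xs → re (LF.∑ᴸ f xs) B.≈ LB.∑ᴸ (re ∘ f) xs
  ∑ᴸ-re f []       = re.0#-homo
  ∑ᴸ-re f (x ∷ xs) = B.trans (re.+-homo _ _) (B.+-congˡ (∑ᴸ-re f xs))

  monomial≡monomial₄ : ∀ T → IP.monomial T ≡ monomial₄ T
  monomial≡monomial₄ (_ ∷ _ ∷ _ ∷ _ ∷ []) = ≡.refl

  term-coefficient : ∀ {m} k (w : Vec Quadruple m) e →
    coefficient (IP.powers k w R.* IP.runWeight (runs w)) e B.≈ coefficient (const₄ (re (weightOf k w)) R.* monomial₄ (total w)) e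
  term-coefficient k w e = B.trans
    (coefficient-≈ (IP.powers k w R.* IP.runWeight (runs w)) (c (weightOf k w) R.* IP.monomial (total w)) (term-weight k w) e)
    (B.reflexive (≡.cong (λ x → coefficient (c (weightOf k w) R.* x) e) (monomial≡monomial₄ (total w))))

  sortedSum-coefficient : ∀ L k m e → coefficient (IP.sortedSum L k m) e B.≈
    re (LF.∑ᴸ (weightOf k) (filter (λ w → Vec.≡-dec ℕ._≟_ (total w) e) (sortedWords m L)))
  sortedSum-coefficient L k m e = B.trans
    (B.reflexive (coefficient-∑ᴸ (λ w → IP.powers k w R.* IP.runWeight (runs w)) (sortedWords m L) e)) (B.trans
    (FilteredSum.∑ᴸ-filter B (λ w → Vec.≡-dec ℕ._≟_ (total w) e)
      (λ w → coefficient (IP.powers k w R.* IP.runWeight (runs w)) e) (re ∘ weightOf k) (sortedWords m L)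
      (λ { w ≡.refl → B.trans (term-coefficient k w (total w)) (coefficient-monomial-≡ (re (weightOf k w)) (total w)) })
      (λ w total≢e → B.trans (term-coefficient k w e) (coefficient-monomial-≢ (re (weightOf k w)) (total w) e total≢e)))
    (B.sym (∑ᴸ-re (weightOf k) (filter (λ w → Vec.≡-dec ℕ._≟_ (total w) e) (sortedWords m L)))))

  coefficient-+ : ∀ f g e → coefficient (f R.+ g) e B.≈ coefficient f e B.+ coefficient g e
  coefficient-+ f g (_ ∷ _ ∷ _ ∷ _ ∷ []) = B.refl

  coefficient-mod : ∀ f S M x e → f R.≈ S R.+ a₁ ER.^ M R.* x → Vec.lookup e 0F < M → coefficient f e B.≈ coefficient S e
  coefficient-mod f S M x e p e₁<M = B.trans (coefficient-≈ f (S R.+ a₁ ER.^ M R.* x) p e)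
    (B.trans (coefficient-+ S (a₁ ER.^ M R.* x) e) (B.trans (B.+-congˡ (coefficient-a₁^* M x e e₁<M)) (B.+-identityʳ _)))

  product-coefficient : ∀ (r : ℕ → El R) (r-inverse : ∀ t → (R.1# R.- IP.α t) R.* r t R.≈ R.1#) n k m e →
    re (LF.∑ᴸ (λ w → (q EF.^ (‖ w ‖from k)) F.* multinomial q-adm n k (runs w)) (𝒯-words m e)) B.≈
    coefficient (c (prefactor n k) R.* Kernels._⋆_ R (IP.top {r} r-inverse) IP.ground k m) e
  product-coefficient r r-inverse n k m e = B.sym (begin
    coefficient (c (prefactor n k) R.* f) e
      ≈⟨ coefficient-const* (re (prefactor n k)) f e ⟩
    re (prefactor n k) B.* coefficient f e
      ≈⟨ B.*-congˡ (coefficient-mod f (IP.sortedSum (letters M) k m) M (proj₁ modulus) e (proj₂ modulus) ℕ.≤-refl) ⟩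
    re (prefactor n k) B.* coefficient (IP.sortedSum (letters M) k m) e
      ≈⟨ B.*-congˡ (sortedSum-coefficient (letters M) k m e) ⟩
    re (prefactor n k) B.* re (LF.∑ᴸ (weightOf k) (filter (λ w → Vec.≡-dec ℕ._≟_ (total w) e) (sortedWords m (letters M))))
      ≈⟨ re.*-homo _ _ ⟨
    re (prefactor n k F.* LF.∑ᴸ (weightOf k) (filter (λ w → Vec.≡-dec ℕ._≟_ (total w) e) (sortedWords m (letters M))))
      ≈⟨ re.⟦⟧-cong (prefactor*∑weightOf n k m e) ⟩
    re (LF.∑ᴸ (λ w → (q EF.^ (‖ w ‖from k)) F.* multinomial q-adm n k (runs w)) (𝒯-words m e)) ∎)
    where
    open SetoidReasoning B.setoid
    -- One more than the exponent of `a₁`: a multiple of `a₁ ^ M` cannot reach this coefficient, and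
    -- `letters M` contains every member of 𝒯 with `t₁` up to that exponent.
    M : ℕ
    M = suc (Vec.lookup e 0F)
    f : El R
    f = Kernels._⋆_ R (IP.top {r} r-inverse) IP.ground k m
    modulus : Σ[ x ∈ El R ] f R.≈ IP.sortedSum (letters M) k m R.+ a₁ ER.^ M R.* x
    modulus = IP.top⋆ground-mod {r} r-inverse M k m

module _ (A : Ring₀) where
  open CommutativeRing A
  open RingProperties ring using (-0#≈0#)
  open Gaussian A
  private module G = CommutativeRing gaussian

  𝐢²≈-1 : 𝐢 G.* 𝐢 G.≈ G.- G.1#
  𝐢²≈-1 = trans (+-cong (zeroˡ 0#) (-‿cong (*-identityˡ 1#))) (+-identityˡ _) ,
          trans (+-cong (zeroˡ 1#) (zeroʳ 1#)) (trans (+-identityˡ 0#) (sym -0#≈0#))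

module ConnectionSeries (F B D : Ring₀) {re : El F → El B} (re-hom : Hom.IsHom F B re)
  {ι : El (Series₄.series₄ B) → El D} (ι-hom : Hom.IsHom (Series₄.series₄ B) D ι)
  {q : El F} (q-unit : Units.Unit F q) (q-adm : QSeries.Base.Admissible F q-unit q)
  (i : El B) (i² : CommutativeRing._≈_ B (CommutativeRing._*_ B i i) (CommutativeRing.-_ B (CommutativeRing.1# B)))
  (i-unit : Units.Unit D (ι (Series₄.const₄ B i)))
  (P : Parameters D)
  (q≡ : Parameters.q P ≡ ι (Series₄.const₄ B (re q)))
  (a≡ : Parameters.a P ≡ CommutativeRing._*_ D (ι (Series₄.const₄ B i)) (ι (Series₄.a₁ B)))
  (b≡ : Parameters.b P ≡ CommutativeRing._*_ D (ι (Series₄.const₄ B i)) (ι (Series₄.a₂ B)))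
  (c≡ : Parameters.c P ≡ CommutativeRing._*_ D (ι (Series₄.const₄ B i)) (ι (Series₄.a₃ B)))
  (d≡ : Parameters.d P ≡ CommutativeRing._*_ D (ι (Series₄.const₄ B i)) (ι (Series₄.a₄ B)))
  where
  private
    module B = CommutativeRing B
    module D = CommutativeRing D
    module ED = CommutativeExp D.commutativeSemiring
    module EF = CommutativeExp (CommutativeRing.commutativeSemiring F)
    open Series₄ B
    module R = CommutativeRing series₄
    module PC = ProductCoefficients F B re-hom q-unit q-adm
    module W = Weights F series₄ PC.c-hom q-unit q-adm a₁ a₂ a₃ a₄

    I² : const₄ i R.* const₄ i R.≈ R.- R.1#
    I² = R.trans {const₄ i R.* const₄ i} {const₄ (i B.* i)} {R.- R.1#} (R.sym {const₄ (i B.* i)} (C.*-homo i i))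
      (R.trans {const₄ (i B.* i)} {const₄ (B.- B.1#)} {R.- R.1#} (C.⟦⟧-cong i²)
      (R.trans {const₄ (B.- B.1#)} {R.- const₄ B.1#} {R.- R.1#} (C.-‿homo B.1#) (R.-‿cong {const₄ B.1#} {R.1#} C.1#-homo)))
      where module C = Hom.IsHom const₄-hom

    module T = Transfer F series₄ D PC.c-hom ι-hom q-unit q-adm P (const₄ i) a₁ a₂ a₃ a₄
      q≡ a≡ b≡ c≡ d≡ i-unit I²
      (SeriesCoefficients.1-X*-unit (Series.series (Series.series (Series.series B))))

  𝒯-seriesOf : ℕ → ℕ → El series₄
  𝒯-seriesOf n k e₁ e₂ e₃ e₄ = re (ListSum.∑ᴸ F
    (λ w → CommutativeRing._*_ F (q EF.^ (‖ w ‖from k)) (QSeries.Base.multinomial F q-unit q-adm n k (runs w)))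
    (W.𝒯-words (n ∸ k) (e₁ ∷ e₂ ∷ e₃ ∷ e₄ ∷ [])))

  connection-series : ∀ σ → AskeyWilson.IsConnection P σ → ∀ n k → k ≤ n →
    (D.1# D.+ D.1#) ED.^ (n ∸ k) D.* Units.inv i-unit ED.^ (n ∸ k) D.* σ n k D.≈ ι (𝒯-seriesOf n k)
  connection-series σ σ-connection n k k≤n = D.trans
    (≡.subst (λ n′ → (D.1# D.+ D.1#) ED.^ (n ∸ k) D.* Units.inv i-unit ED.^ (n ∸ k) D.* σ n′ k D.≈
                     ι (PC.c (W.prefactor n′ k) R.* product))
      (ℕ.m+[n∸m]≡n k≤n) (T.connection-product σ σ-connection k (n ∸ k)))
    (Hom.IsHom.⟦⟧-cong ι-hom {PC.c (W.prefactor n k) R.* product} {𝒯-seriesOf n k}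
      λ e₁ e₂ e₃ e₄ → B.sym (PC.product-coefficient T.r-R T.r-R-inverse n k (n ∸ k) (e₁ ∷ e₂ ∷ e₃ ∷ e₄ ∷ [])))
    where
    product : El series₄
    product = Kernels._⋆_ series₄ T.top T.IP.ground k (n ∸ k)

theorem6p5 : (σ : ℕ → ℕ → L.Carrier) → AskeyWilson.IsConnection 𝐢a σ →
    ∀ n k → k ≤ n → tilde σ n k L.≈ ⌜ 𝒯-series n k ⌝
-- The equations for the five parameters hold by `refl`, since `𝐢a` is built from exactly these
-- scaled variables.
theorem6p5 = ConnectionSeries.connection-series ℚ⟨q⟩-ring ℚ⟨q,𝐢⟩.gaussian 𝕃 ℚ⟨q,𝐢⟩.re-hom Frac.ι-hom
  ℚ⟨q⟩.q-unit ℚ⟨q⟩.q-adm ℚ⟨q,𝐢⟩.𝐢 (𝐢²≈-1 ℚ⟨q⟩-ring) 𝐢-unit 𝐢a ≡.refl ≡.refl ≡.refl ≡.refl ≡.refl
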